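{- Let $m\geq 2$, let $q\geq 3$ be a prime power, and let $1\leq t\leq m-1$. Let $f\in R_q(t(q-1),m)$ be a second weight codeword, i.e. $|f|=2(q-1)q^{m-t-1}$, and let $S$ be its support. Then $S$ is contained in an affine subspace of $\mathbb{F}_q^m$ of codimension $t-1$, and either $S$ is the union of $2$ parallel affine subspaces of codimension $t$ minus their intersection with an affine subspace of codimension $t$ which is not parallel to them, or $S$ is the union of $2$ non-parallel affine subspaces of codimension $t$ minus their intersection.
   Context: $\mathbb{F}_q$ is the finite field with $q$ elements and $B_m^q$ is the $\mathbb{F}_q$-algebra of all functions $\mathbb{F}_q^m\to\mathbb{F}_q$. Every $f\in B_m^q$ is given by a unique polynomial in $\mathbb{F}_q[X_1,\ldots,X_m]$ of degree at most $q-1$ in each variable (its reduced form), and $\deg(f)$ is the total degree of this reduced form. For $0\leq r\leq m(q-1)$, $R_q(r,m)=\{f\in B_m^q:\deg(f)\leq r\}$ is the generalized Reed–Muller code. The support of $f$ is $\{x\in\mathbb{F}_q^m: f(x)\neq 0\}$ and $|f|$ denotes its cardinality (Hamming weight). Subspaces are affine subspaces of $\mathbb{F}_q^m$. Under the hypotheses, $2(q-1)q^{m-t-1}$ is the second smallest nonzero weight of $R_q(t(q-1),m)$. -}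

module Defs where

open import Level using (0ℓ)
open import Data.Nat as ℕ using (ℕ; zero; suc; _≤_)
open import Data.Fin using (Fin; toℕ)
open import Data.Fin.Properties using (_≟_)
open import Data.Vec.Functional using (_∷_)
open import Data.Product using (Σ; ∃; _×_; _,_)
open import Data.Sum using (_⊎_)
open import Relation.Nullary using (¬_; does)
open import Relation.Binary.PropositionalEquality using (_≡_; _≢_)
open import Algebra.Core using (Op₁; Op₂)
import Algebra.Structures as AS
open import Function.Bundles using (_⇔_)
open import Data.Bool using (if_then_else_)

-- A finite field with q elements, with carrier Fin q (every finite field
-- of order q is isomorphic to one of this form, by transport of structure).

record FiniteField (q : ℕ) : Set where
  field
    _+_ _*_   : Op₂ (Fin q)
    -_        : Op₁ (Fin q)
    0# 1#     : Fin q
    isCommutativeRing : AS.IsCommutativeRing {A = Fin q} _≡_ _+_ _*_ -_ 0# 1#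
    0≢1       : 0# ≢ 1#
    _⁻¹       : Fin q → Fin q
    ⁻¹-inverse : ∀ x → x ≢ 0# → x * (x ⁻¹) ≡ 1#

module FF {q : ℕ} (F : FiniteField q) where
  open FiniteField F public

  -- Points of F_q^m (also used as exponent vectors e : Fin m → Fin q,
  -- where the exponent of X_i is toℕ (e i) ∈ {0,…,q-1}).
  Pt : ℕ → Set
  Pt m = Fin m → Fin q

  sumFin : (n : ℕ) → (Fin n → Fin q) → Fin q
  sumFin zero    g = 0#
  sumFin (suc n) g = g Fin.zero + sumFin n (λ i → g (Fin.suc i))

  prodFin : (n : ℕ) → (Fin n → Fin q) → Fin q
  prodFin zero    g = 1#
  prodFin (suc n) g = g Fin.zero * prodFin n (λ i → g (Fin.suc i))

  sumPt : (m : ℕ) → (Pt m → Fin q) → Fin q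
  sumPt zero    g = g (λ ())
  sumPt (suc m) g = sumFin q (λ a → sumPt m (λ e → g (a ∷ e)))

  countPt : (m : ℕ) → (Pt m → Data.Bool.Bool) → ℕ
  countPt zero    P = if P (λ ()) then 1 else 0
  countPt (suc m) P = sumℕ q (λ a → countPt m (λ e → P (a ∷ e)))
    where
    sumℕ : (n : ℕ) → (Fin n → ℕ) → ℕ
    sumℕ zero    g = 0
    sumℕ (suc n) g = g Fin.zero ℕ.+ sumℕ n (λ i → g (Fin.suc i))

  pow : Fin q → ℕ → Fin q
  pow x zero    = 1#
  pow x (suc k) = x * pow x k

  -- Reduced polynomials in m variables: a coefficient for each exponent
  -- vector e with every exponent ≤ q-1.
  RedPoly : ℕ → Set
  RedPoly m = Pt m → Fin q

  monomial : {m : ℕ} → Pt m → Pt m → Fin q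
  monomial {m} e x = prodFin m (λ i → pow (x i) (toℕ (e i)))

  eval : {m : ℕ} → RedPoly m → Pt m → Fin q
  eval {m} c x = sumPt m (λ e → c e * monomial e x)

  totalDeg : {m : ℕ} → Pt m → ℕ
  totalDeg {zero}  e = 0
  totalDeg {suc m} e = toℕ (e Fin.zero) ℕ.+ totalDeg {m} (λ i → e (Fin.suc i))

  -- f ∈ R_q(r, m): the (unique) reduced form of f has total degree ≤ r
  InRM : (r m : ℕ) → (Pt m → Fin q) → Set
  InRM r m f = Σ (RedPoly m) λ c →
                 (∀ e → c e ≢ 0# → totalDeg e ≤ r) × (∀ x → f x ≡ eval c x)

  weight : {m : ℕ} → (Pt m → Fin q) → ℕ
  weight {m} f = countPt m (λ x → Data.Bool.not (does (f x ≟ 0#)))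

  Supp : {m : ℕ} → (Pt m → Fin q) → Pt m → Set
  Supp f x = f x ≢ 0#

  _⊕_ : {m : ℕ} → Pt m → Pt m → Pt m
  (u ⊕ v) i = u i + v i

  _·_ : {m : ℕ} → Fin q → Pt m → Pt m
  (a · v) i = a * v i

  𝟎 : {m : ℕ} → Pt m
  𝟎 i = 0#

  lincomb : {m d : ℕ} → (Fin d → Fin q) → (Fin d → Pt m) → Pt m
  lincomb {m} {d} λs vs i = sumFin d (λ j → λs j * vs j i)

  _≐_ : {m : ℕ} → Pt m → Pt m → Set
  u ≐ v = ∀ i → u i ≡ v i

  LinIndep : {m d : ℕ} → (Fin d → Pt m) → Set
  LinIndep {m} {d} vs = ∀ (λs : Fin d → Fin q) → lincomb λs vs ≐ 𝟎 → ∀ j → λs j ≡ 0#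

  record AffSub (m : ℕ) : Set where
    field
      dim  : ℕ
      base : Pt m
      dirs : Fin dim → Pt m
      indep : LinIndep dirs

  open AffSub public

  InDir : {m : ℕ} → AffSub m → Pt m → Set
  InDir A w = Σ (Fin (dim A) → Fin q) λ λs → w ≐ lincomb λs (dirs A)

  _∈A_ : {m : ℕ} → Pt m → AffSub m → Set
  x ∈A A = Σ (Fin (dim A) → Fin q) λ λs → x ≐ (base A ⊕ lincomb λs (dirs A))

  Codim : {m : ℕ} → ℕ → AffSub m → Set
  Codim {m} k A = dim A ℕ.+ k ≡ m

  Parallel : {m : ℕ} → AffSub m → AffSub m → Set
  Parallel A B = ∀ w → InDir A w ⇔ InDir B w

  SameSet : {m : ℕ} → AffSub m → AffSub m → Set
  SameSet A B = ∀ x → x ∈A A ⇔ x ∈A B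

-- Put n = m − t, and let K of the hyperplanes y = a of a parallel class meet the support S of f. Dividing f by the q − K
-- other factors y − a lowers the degree of the slices, so the minimum weight gives each nonempty slice at least
-- (q + 1 − K) q^(n−1) points. As |S| ≤ 2(q − 1) q^(n−1), this leaves K ∈ {1, 2, q − 1, q}.
--
-- If a slice has the least possible weight q^(n−1), it lies in a subspace L of codimension 2, and by averaging some
-- hyperplane H ⊃ L contains so many points of S that its own parallel class has K ≤ 2, or K = q and all slices of the class
-- but H are translates of one another: two light slices, moved onto each other by a shear, differ by a function of
-- lower degree that is too light to be nonzero.
--
-- For t ≥ 2, subspaces of codimension 2 that contain a slice are joined to further points of S; this yields hyperplanes
-- with more and more points until one contains S. Restricting to it lowers t and m by one, down to t = 1. There K = 2 gives
-- two parallel hyperplanes and the translates give two crossing ones, while K = q − 1 for all hyperplanes of a pencil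
-- makes f vanish on q hyperplanes of distinct slopes, too many for its degree.
module Submission where

open import Defs
open import Data.Nat using (ℕ; zero; suc; _≤_; _<_; z≤n; s≤s; _*_; _+_; _∸_; _^_; >-nonZero)
open import Data.Nat.Properties
open import Data.Nat.Tactic.RingSolver using (solve-∀)
open import Data.Fin using (Fin; zero; suc; punchIn; toℕ)
open import Data.Fin.Properties using (punchInᵢ≢i; punchIn-punchOut; punchOut-injective; any?) renaming (_≟_ to _≟F_; suc-injective to sucF-injective)
open import Data.Vec using (Vec; []; _∷_; lookup; tabulate; head; tail)
open import Data.Vec.Properties using (≡-dec; lookup∘tabulate; tabulate∘lookup)
open import Data.Product using (Σ; ∃; _×_; _,_; proj₁; proj₂)
open import Data.Sum using (_⊎_; inj₁; inj₂)
open import Data.Maybe using (Maybe; just; nothing)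
open import Data.Empty using (⊥; ⊥-elim)
open import Data.Bool using (Bool; true; false; if_then_else_; not)
open import Relation.Nullary using (¬_; Dec; yes; no; does; ¬?; _×-dec_)
open import Relation.Binary.PropositionalEquality hiding ([_])
open import Function using (_∘_; id; case_of_)
open import Function.Bundles using (_⇔_; mk⇔; Equivalence)
import Data.Vec.Functional as VF
open import Algebra.Bundles using (CommutativeRing; RawRing)
import Algebra.Properties.Ring
import Algebra.Properties.AbelianGroup
import Algebra.Properties.Semiring.Mult
import Algebra.Solver.Ring
import Algebra.Solver.Ring.AlmostCommutativeRing as ACR
open import Level using (0ℓ)

-- The case K = q is the obstacle: nothing can be divided out, so the slices have the same degree as
-- f. It is met by an induction on n, for which the classification covers all words of weight at
-- most the second weight. Applied to slices it gives a gap: with U the minimum weight of a slice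
-- and `Q` = q - 1, a slice weighs 0, U or at least 2QU/q. If K = q and no slice weighs U, all
-- slices weigh exactly 2QU/q and fall under the induction. The `n` of the code is one less than the
-- n above, so that U = `q ^ n`. Degree bounds are strict: `Pol d` means degree less than d, and
-- `Pol 0` contains only zero functions. Degree at most tQ + (q - k) therefore reads
-- `d + k ≤ suc t * Q + 2`, and k q^n is the minimum weight for it. Words attaining this minimum are
-- studied on their own, since they occur as slices and as halves of f. Every hyperplane is moved by
-- an affine bijection to a slice of the first coordinate.

lin : ∀ {a b x y} → a ≤ b → ∀ s → x + b + s ≡ y + a → x ≤ y
lin {a} {b} {x} {y} a≤b s e = +-cancelʳ-≤ b x y (begin
  x + b       ≤⟨ m≤m+n (x + b) s ⟩
  x + b + s   ≡⟨ e ⟩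
  y + a       ≤⟨ +-monoʳ-≤ y a≤b ⟩
  y + b       ∎)
  where open ≤-Reasoning

-- Like `lin`, a certificate for linear arithmetic: hypotheses are added with suitable multipliers,
-- and an identity with explicit slack `s` is left to the ring solver.
absurd-≤ : ∀ {a b} {A : Set} → a ≤ b → ∀ s → b + suc s ≡ a → A
absurd-≤ {a} {b} a≤b s e = ⊥-elim (n≮n b (begin-strict
  b            <⟨ m<m+n b {suc s} (s≤s z≤n) ⟩
  b + suc s    ≡⟨ e ⟩
  a            ≤⟨ a≤b ⟩
  b            ∎))
  where open ≤-Reasoning

slack : ∀ {a b} → a ≤ b → ∃ λ s → b ≡ a + s
slack {a} {b} p = b ∸ a , sym (m+[n∸m]≡n p)

-- Finite sums and their exchange

sumF : ∀ {n} → (Fin n → ℕ) → ℕ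
sumF {zero}  g = 0
sumF {suc n} g = g zero + sumF (g ∘ suc)

-- What exchanging two sums requires of the inner one, so that one proof serves sums over `Fin` and
-- over vectors alike.
record Additive {A : Set} (T : (A → ℕ) → ℕ) : Set where
  field
    cong-T : ∀ {g h} → (∀ a → g a ≡ h a) → T g ≡ T h
    zero-T : T (λ _ → 0) ≡ 0
    add-T  : ∀ g h → T (λ a → g a + h a) ≡ T g + T h

open Additive

+-interchange : ∀ a b c d → (a + b) + (c + d) ≡ (a + c) + (b + d)
+-interchange = solve-∀

sumF-additive : ∀ {n} → Additive (sumF {n})
sumF-additive {zero} = record { cong-T = λ _ → refl ; zero-T = refl ; add-T = λ _ _ → refl }
sumF-additive {suc n} = record
  { cong-T = λ e → cong₂ _+_ (e zero) (cong-T sumF-additive (λ i → e (suc i)))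
  ; zero-T = zero-T (sumF-additive {n})
  ; add-T  = λ g h → trans (cong (g zero + h zero +_) (add-T sumF-additive (g ∘ suc) (h ∘ suc)))
                           (+-interchange (g zero) (h zero) _ _)
  }

sumF-cong : ∀ {n} {g h : Fin n → ℕ} → (∀ i → g i ≡ h i) → sumF g ≡ sumF h
sumF-cong = cong-T sumF-additive

sumF-+ : ∀ {n} (g h : Fin n → ℕ) → sumF (λ i → g i + h i) ≡ sumF g + sumF h
sumF-+ = add-T sumF-additive

sumF-mono : ∀ {n} {g h : Fin n → ℕ} → (∀ i → g i ≤ h i) → sumF g ≤ sumF h
sumF-mono {zero}  e = z≤n
sumF-mono {suc n} e = +-mono-≤ (e zero) (sumF-mono (λ i → e (suc i)))

sumF-* : ∀ {n} c (g : Fin n → ℕ) → sumF (λ i → c * g i) ≡ c * sumF g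
sumF-* {zero}  c g = sym (*-zeroʳ c)
sumF-* {suc n} c g = trans (cong (c * g zero +_) (sumF-* c (g ∘ suc))) (sym (*-distribˡ-+ c (g zero) _))

sumF-const : ∀ n c → sumF {n} (λ _ → c) ≡ n * c
sumF-const zero    c = refl
sumF-const (suc n) c = cong (c +_) (sumF-const n c)

sumF-const-≡ : ∀ {n} {g : Fin n → ℕ} {c} → (∀ i → g i ≡ c) → sumF g ≡ n * c
sumF-const-≡ {n} {g} {c} e = trans (sumF-cong e) (sumF-const n c)

sumF-lower : ∀ {n} {g : Fin n → ℕ} {c} → (∀ i → c ≤ g i) → n * c ≤ sumF g
sumF-lower {n} {g} {c} e = subst (_≤ sumF g) (sumF-const n c) (sumF-mono e)

sumF-upper : ∀ {n} {g : Fin n → ℕ} {c} → (∀ i → g i ≤ c) → sumF g ≤ n * c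
sumF-upper {n} {g} {c} e = subst (sumF g ≤_) (sumF-const n c) (sumF-mono e)

sumF-punch : ∀ {n} (g : Fin (suc n) → ℕ) i → sumF g ≡ g i + sumF (λ j → g (punchIn i j))
sumF-punch g zero = refl
sumF-punch {suc n} g (suc i) = begin
  g zero + sumF (g ∘ suc)                                          ≡⟨ cong (g zero +_) (sumF-punch (g ∘ suc) i) ⟩
  g zero + (g (suc i) + sumF (λ j → g (suc (punchIn i j))))        ≡⟨ sym (+-assoc (g zero) _ _) ⟩
  g zero + g (suc i) + sumF (λ j → g (suc (punchIn i j)))          ≡⟨ cong (_+ sumF (λ j → g (suc (punchIn i j)))) (+-comm (g zero) _) ⟩
  g (suc i) + g zero + sumF (λ j → g (suc (punchIn i j)))          ≡⟨ +-assoc (g (suc i)) _ _ ⟩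
  g (suc i) + (g zero + sumF (λ j → g (suc (punchIn i j))))        ∎
  where open ≡-Reasoning

sumF-term : ∀ {n} (g : Fin n → ℕ) i → g i ≤ sumF g
sumF-term {suc n} g i = subst (g i ≤_) (sym (sumF-punch g i)) (m≤m+n _ _)

sumF-terms : ∀ {n} (g : Fin n → ℕ) {i j} → i ≢ j → g i + g j ≤ sumF g
sumF-terms {suc n} g {i} {j} i≢j = subst (g i + g j ≤_) (sym (sumF-punch g i))
  (+-monoʳ-≤ (g i) (subst (λ k → g k ≤ _) (punchIn-punchOut i≢j) (sumF-term (λ k → g (punchIn i k)) _)))

le : ∀ {x y} s → x + s ≡ y → x ≤ y
le {x} s e = subst (x ≤_) e (m≤m+n x s)

sumF-pos : ∀ {n} (g : Fin n → ℕ) → sumF g ≢ 0 → ∃ λ i → g i ≢ 0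
sumF-pos {zero}  g ne = ⊥-elim (ne refl)
sumF-pos {suc n} g ne with g zero ≟ 0
... | no ne₀ = zero , ne₀
... | yes e with sumF-pos (g ∘ suc) (λ e′ → ne (cong₂ _+_ e e′))
... | i , ne′ = suc i , ne′

sumF-three : ∀ {n} (g : Fin n → ℕ) {i j k} → i ≢ j → i ≢ k → j ≢ k → g i + (g j + g k) ≤ sumF g
sumF-three {suc n} g {i} {j} {k} i≢j i≢k j≢k = subst (g i + (g j + g k) ≤_) (sym (sumF-punch g i))
  (+-monoʳ-≤ (g i) (subst₂ (λ u v → g u + g v ≤ _) (punchIn-punchOut i≢j) (punchIn-punchOut i≢k)
    (sumF-terms (λ l → g (punchIn i l)) (λ eq → j≢k (punchOut-injective i≢j i≢k eq)))))

choose-all : ∀ {n} {A : Set} {B : Fin n → Set} → (∀ i → A ⊎ B i) → A ⊎ (∀ i → B i)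
choose-all {zero}  f = inj₂ (λ ())
choose-all {suc n} f with f zero | choose-all (λ i → f (suc i))
... | inj₁ a | _      = inj₁ a
... | inj₂ _ | inj₁ a = inj₁ a
... | inj₂ b | inj₂ g = inj₂ (λ { zero → b ; (suc i) → g i })

sumF-pigeonhole : ∀ {n} (g : Fin (suc n) → ℕ) → ∃ λ i → sumF g ≤ suc n * g i
sumF-pigeonhole g = proj₁ (maximum g) , sumF-upper (proj₂ (maximum g))
  where
  maximum : ∀ {n} (g : Fin (suc n) → ℕ) → ∃ λ i → ∀ j → g j ≤ g i
  maximum {zero} g = zero , λ { zero → ≤-refl }
  maximum {suc n} g with maximum (g ∘ suc)
  ... | i , max with ≤-total (g zero) (g (suc i))
  ... | inj₁ le = suc i , λ { zero → le ; (suc j) → max j }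
  ... | inj₂ ge = zero , λ { zero → ≤-refl ; (suc j) → ≤-trans (max j) ge }

swapF : ∀ {n} {A : Set} {T : (A → ℕ) → ℕ} → Additive T → (h : Fin n → A → ℕ) →
        sumF (λ i → T (h i)) ≡ T (λ a → sumF (λ i → h i a))
swapF {zero}  ad h = sym (zero-T ad)
swapF {suc n} {T = T} ad h = trans (cong (T (h zero) +_) (swapF ad (h ∘ suc))) (sym (add-T ad _ _))

[_] : ∀ {p} {P : Set p} → Dec P → ℕ
[ d ] = if does d then 1 else 0

[yes] : ∀ {p} {P : Set p} (d : Dec P) → P → [ d ] ≡ 1
[yes] (yes _) _ = refl
[yes] (no ¬p) p = ⊥-elim (¬p p)

[no] : ∀ {p} {P : Set p} (d : Dec P) → ¬ P → [ d ] ≡ 0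
[no] (yes p) ¬p = ⊥-elim (¬p p)
[no] (no _)  _  = refl

[]-cong : ∀ {p r} {P : Set p} {R : Set r} (d : Dec P) (e : Dec R) → (P → R) → (R → P) → [ d ] ≡ [ e ]
[]-cong (yes p) e f g = sym ([yes] e (f p))
[]-cong (no ¬p) e f g = sym ([no] e (λ r → ¬p (g r)))

sumF-pick : ∀ {n} (a : Fin n) (h : Fin n → ℕ) → sumF (λ i → [ i ≟F a ] * h i) ≡ h a
sumF-pick {suc n} a h = begin
  sumF (λ i → [ i ≟F a ] * h i)
    ≡⟨ sumF-punch (λ i → [ i ≟F a ] * h i) a ⟩
  [ a ≟F a ] * h a + sumF (λ j → [ punchIn a j ≟F a ] * h (punchIn a j))
    ≡⟨ cong₂ _+_ (trans (cong (_* h a) ([yes] (a ≟F a) refl)) (*-identityˡ (h a)))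
                 (trans (sumF-const-≡ (λ j → cong (_* h (punchIn a j)) ([no] (punchIn a j ≟F a) (punchInᵢ≢i a j)))) (*-zeroʳ n)) ⟩
  h a + 0
    ≡⟨ +-identityʳ (h a) ⟩
  h a ∎
  where open ≡-Reasoning

record FiniteSum (A : Set) : Set₁ where
  field
    S    : (A → ℕ) → ℕ
    S-additive : Additive S
    S-swap : ∀ {B : Set} {T : (B → ℕ) → ℕ} → Additive T → (h : A → B → ℕ) → S (λ a → T (h a)) ≡ T (λ b → S (λ a → h a b))
    _≟S_ : (a b : A) → Dec (a ≡ b)
    S-pick : ∀ a (h : A → ℕ) → S (λ x → [ x ≟S a ] * h x) ≡ h a

  -- `g (φ x)` is a sum over y against the indicator of y = φ x. After the exchange of sums this is
  -- the indicator of x = ψ y, which sums to one for each y.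
  S-reindex : (φ ψ : A → A) → (∀ x → φ (ψ x) ≡ x) → (∀ x → ψ (φ x) ≡ x) → (g : A → ℕ) → S (g ∘ φ) ≡ S g
  S-reindex φ ψ φψ ψφ g = begin
    S (λ x → g (φ x))
      ≡⟨ cong-T S-additive (λ x → sym (S-pick (φ x) g)) ⟩
    S (λ x → S (λ y → [ y ≟S φ x ] * g y))
      ≡⟨ S-swap S-additive _ ⟩
    S (λ y → S (λ x → [ y ≟S φ x ] * g y))
      ≡⟨ cong-T S-additive (λ y → cong-T S-additive (λ x → cong (_* g y)
           ([]-cong (y ≟S φ x) (x ≟S ψ y) (λ e → trans (sym (ψφ x)) (cong ψ (sym e))) (λ e → trans (sym (φψ y)) (cong φ (sym e)))))) ⟩
    S (λ y → S (λ x → [ x ≟S ψ y ] * g y))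
      ≡⟨ cong-T S-additive (λ y → S-pick (ψ y) (λ _ → g y)) ⟩
    S g ∎
    where open ≡-Reasoning

finSum : ∀ {n} → FiniteSum (Fin n)
finSum = record { S = sumF ; S-additive = sumF-additive ; S-swap = swapF ; _≟S_ = _≟F_ ; S-pick = sumF-pick }

module _ {q : ℕ} where

  sumV : ∀ {m} → (Vec (Fin q) m → ℕ) → ℕ
  sumV {zero}  g = g []
  sumV {suc m} g = sumF (λ a → sumV (λ x → g (a ∷ x)))

  sumV-additive : ∀ {m} → Additive (sumV {m})
  sumV-additive {zero} = record { cong-T = λ e → e [] ; zero-T = refl ; add-T = λ _ _ → refl }
  sumV-additive {suc m} = record
    { cong-T = λ e → sumF-cong (λ a → cong-T sumV-additive (λ x → e (a ∷ x)))
    ; zero-T = trans (sumF-cong {q} (λ _ → zero-T (sumV-additive {m}))) (zero-T (sumF-additive {q}))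
    ; add-T  = λ g h → trans (sumF-cong {q} (λ a → add-T sumV-additive (λ x → g (a ∷ x)) (λ x → h (a ∷ x)))) (sumF-+ {q} _ _)
    }

  sumV-cong : ∀ {m} {g h : Vec (Fin q) m → ℕ} → (∀ x → g x ≡ h x) → sumV g ≡ sumV h
  sumV-cong = cong-T sumV-additive

  swapV : ∀ {m} {A : Set} {T : (A → ℕ) → ℕ} → Additive T → (h : Vec (Fin q) m → A → ℕ) →
          sumV (λ x → T (h x)) ≡ T (λ a → sumV (λ x → h x a))
  swapV {zero}  ad h = refl
  swapV {suc m} ad h = trans (sumF-cong {q} (λ a → swapV ad (λ x → h (a ∷ x)))) (swapF {q} ad _)

  sumV-* : ∀ {m} c (g : Vec (Fin q) m → ℕ) → sumV (λ x → c * g x) ≡ c * sumV g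
  sumV-* {zero}  c g = refl
  sumV-* {suc m} c g = trans (sumF-cong {q} (λ a → sumV-* c (λ x → g (a ∷ x)))) (sumF-* {q} c _)

  _≟V_ : ∀ {m} (x y : Vec (Fin q) m) → Dec (x ≡ y)
  _≟V_ = ≡-dec _≟F_

  sumV-pick : ∀ {m} (a : Vec (Fin q) m) (h : Vec (Fin q) m → ℕ) → sumV (λ x → [ x ≟V a ] * h x) ≡ h a
  sumV-pick [] h = *-identityˡ (h [])
  sumV-pick (a ∷ as) h = begin
    sumF (λ b → sumV (λ x → [ (b ∷ x) ≟V (a ∷ as) ] * h (b ∷ x)))
      ≡⟨ sumF-cong (λ b → trans (sumV-cong (λ x → trans (cong (_* h (b ∷ x)) (split b x)) (*-assoc [ b ≟F a ] _ _)))
                               (sumV-* [ b ≟F a ] (λ x → [ x ≟V as ] * h (b ∷ x)))) ⟩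
    sumF (λ b → [ b ≟F a ] * sumV (λ x → [ x ≟V as ] * h (b ∷ x)))
      ≡⟨ sumF-pick a _ ⟩
    sumV (λ x → [ x ≟V as ] * h (a ∷ x))
      ≡⟨ sumV-pick as (λ x → h (a ∷ x)) ⟩
    h (a ∷ as) ∎
    where
    open ≡-Reasoning
    split : ∀ b x → [ (b ∷ x) ≟V (a ∷ as) ] ≡ [ b ≟F a ] * [ x ≟V as ]
    split b x with b ≟F a | x ≟V as
    ... | yes _ | yes _ = refl
    ... | yes _ | no _  = refl
    ... | no _  | _     = refl

  vecSum : ∀ {m} → FiniteSum (Vec (Fin q) m)
  vecSum = record { S = sumV ; S-additive = sumV-additive ; S-swap = swapV ; _≟S_ = _≟V_ ; S-pick = sumV-pick }

  sumV-mono : ∀ {m} {g h : Vec (Fin q) m → ℕ} → (∀ x → g x ≤ h x) → sumV g ≤ sumV h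
  sumV-mono {zero}  e = e []
  sumV-mono {suc m} e = sumF-mono (λ a → sumV-mono (λ x → e (a ∷ x)))

  sumV-term : ∀ {m} (g : Vec (Fin q) m → ℕ) x → g x ≤ sumV g
  sumV-term g []       = ≤-refl
  sumV-term g (a ∷ x) = ≤-trans (sumV-term (λ y → g (a ∷ y)) x) (sumF-term (λ b → sumV (λ y → g (b ∷ y))) a)

-- The local function of Defs.FF.countPt has no name outside Defs; the metavariable is solved by unification against its unfolding.
mutual
  countPt-sum : ∀ q (F : FiniteField q) (n : ℕ) (g : Fin n → ℕ) → ℕ
  countPt-sum q F n g = _

  countPt-sum-solution : ∀ Q (F : FiniteField (suc Q)) →
    FF.countPt F 1 (λ _ → true) ≡ 1 + countPt-sum (suc Q) F Q (λ a → FF.countPt F 0 (λ _ → true))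
  countPt-sum-solution Q F with (λ (a : Fin Q) → FF.countPt F 0 (λ _ → true)) | suc Q | F
  ... | g | w | F' = refl

countPt-sum≡sumF : ∀ q F n g → countPt-sum q F n g ≡ sumF g
countPt-sum≡sumF q F zero    g = refl
countPt-sum≡sumF q F (suc n) g = cong (g zero +_) (countPt-sum≡sumF q F n (g ∘ suc))

-- Points are functions, and pointwise equal functions need not be identified; hence the condition
-- that `P` sees a point only through its table of values.
countPt≡sumV : ∀ {q} (F : FiniteField q) {m} (P : FF.Pt F m → Bool) (P′ : Vec (Fin q) m → Bool) →
               (∀ x → P x ≡ P′ (tabulate x)) → FF.countPt F m P ≡ sumV (λ x → if P′ x then 1 else 0)
countPt≡sumV F {zero}  P P′ e = cong (if_then 1 else 0) (e (λ ()))
countPt≡sumV {q} F {suc m} P P′ e = trans (countPt-sum≡sumF q F q _)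
  (sumF-cong (λ a → countPt≡sumV F (λ x → P (a VF.∷ x)) (λ x → P′ (a ∷ x)) (λ x → e (a VF.∷ x))))

module Proof (Q : ℕ) (F : FiniteField (suc Q)) (2≤Q : 2 ≤ Q) where
  open FiniteField F using (isCommutativeRing; 0≢1; ⁻¹-inverse; _⁻¹)
    renaming (_+_ to infixl 6 _⊹_; _*_ to infixl 7 _⊗_; -_ to infix 8 ⊝_; 0# to 𝟘; 1# to 𝟙)

  -- Polynomial functions of bounded degree

  module Polynomials where

    q : ℕ
    q = suc Q

    K : Set
    K = Fin q

    fieldRing : CommutativeRing 0ℓ 0ℓ
    fieldRing = record { isCommutativeRing = isCommutativeRing }

    module R = CommutativeRing fieldRing
    module RP = Algebra.Properties.Ring R.ring
    module RG = Algebra.Properties.AbelianGroup R.+-abelianGroup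

    infixl 6 _⊖_
    _⊖_ : K → K → K
    a ⊖ b = a ⊹ ⊝ b

    -- Integers as formal differences, reduced so that equal integers are syntactically equal.
    module FieldSolver where
      open Algebra.Properties.Semiring.Mult R.semiring using (×-homo-+; ×1-homo-*) renaming (_×_ to _×′_)

      reduce : ℕ → ℕ → ℕ × ℕ
      reduce zero    b       = 0 , b
      reduce (suc a) zero    = suc a , 0
      reduce (suc a) (suc b) = reduce a b

      coeff : ℕ × ℕ → K
      coeff (a , b) = a ×′ 𝟙 ⊖ b ×′ 𝟙

      ⊖-interchange : ∀ a b c d → (a ⊹ c) ⊖ (b ⊹ d) ≡ (a ⊖ b) ⊹ (c ⊖ d)
      ⊖-interchange a b c d = begin
        (a ⊹ c) ⊹ ⊝ (b ⊹ d)         ≡⟨ cong ((a ⊹ c) ⊹_) (sym (RP.-‿+-comm b d)) ⟩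
        (a ⊹ c) ⊹ (⊝ b ⊹ ⊝ d)       ≡⟨ R.+-assoc a c _ ⟩
        a ⊹ (c ⊹ (⊝ b ⊹ ⊝ d))       ≡⟨ cong (a ⊹_) (trans (sym (R.+-assoc c _ _)) (trans (cong (_⊹ ⊝ d) (R.+-comm c _)) (R.+-assoc _ c _))) ⟩
        a ⊹ (⊝ b ⊹ (c ⊹ ⊝ d))       ≡⟨ sym (R.+-assoc a _ _) ⟩
        (a ⊹ ⊝ b) ⊹ (c ⊹ ⊝ d)       ∎
        where open ≡-Reasoning

      coeff-reduce : ∀ a b → coeff (reduce a b) ≡ coeff (a , b)
      coeff-reduce zero    b       = refl
      coeff-reduce (suc a) zero    = refl
      coeff-reduce (suc a) (suc b) = trans (coeff-reduce a b) (sym (trans (⊖-interchange 𝟙 𝟙 _ _)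
        (trans (cong (_⊹ coeff (a , b)) (R.-‿inverseʳ 𝟙)) (R.+-identityˡ _))))

      ⊖-product : ∀ a b c d → (a ⊖ b) ⊗ (c ⊖ d) ≡ (a ⊗ c ⊹ b ⊗ d) ⊖ (a ⊗ d ⊹ b ⊗ c)
      ⊖-product a b c d = begin
        (a ⊖ b) ⊗ (c ⊖ d)                               ≡⟨ R.distribʳ _ a (⊝ b) ⟩
        a ⊗ (c ⊖ d) ⊹ ⊝ b ⊗ (c ⊖ d)                     ≡⟨ cong₂ _⊹_ (R.distribˡ a c (⊝ d)) (R.distribˡ (⊝ b) c (⊝ d)) ⟩
        (a ⊗ c ⊹ a ⊗ ⊝ d) ⊹ (⊝ b ⊗ c ⊹ ⊝ b ⊗ ⊝ d)       ≡⟨ cong₂ _⊹_ (cong (a ⊗ c ⊹_) (sym (RP.-‿distribʳ-* a d)))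
                                                             (cong₂ _⊹_ (sym (RP.-‿distribˡ-* b c)) (trans (sym (RP.-‿distribˡ-* b (⊝ d))) (trans (cong ⊝_ (sym (RP.-‿distribʳ-* b d))) (RG.⁻¹-involutive _)))) ⟩
        (a ⊗ c ⊖ a ⊗ d) ⊹ (⊝ (b ⊗ c) ⊹ b ⊗ d)           ≡⟨ cong (a ⊗ c ⊖ a ⊗ d ⊹_) (R.+-comm _ _) ⟩
        (a ⊗ c ⊖ a ⊗ d) ⊹ (b ⊗ d ⊖ b ⊗ c)               ≡⟨ sym (⊖-interchange _ _ _ _) ⟩
        (a ⊗ c ⊹ b ⊗ d) ⊖ (a ⊗ d ⊹ b ⊗ c)               ∎
        where open ≡-Reasoning

      integers : RawRing 0ℓ 0ℓ
      integers = record
        { Carrier = ℕ × ℕ ; _≈_ = _≡_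
        ; _+_ = λ { (a , b) (c , d) → reduce (a + c) (b + d) }
        ; _*_ = λ { (a , b) (c , d) → reduce (a * c + b * d) (a * d + b * c) }
        ; -_ = λ { (a , b) → b , a } ; 0# = 0 , 0 ; 1# = 1 , 0 }

      open ACR using (_-Raw-AlmostCommutative⟶_; fromCommutativeRing; Induced-equivalence)

      almostRing : ACR.AlmostCommutativeRing 0ℓ 0ℓ
      almostRing = fromCommutativeRing fieldRing

      morphism : integers -Raw-AlmostCommutative⟶ almostRing
      morphism = record
        { ⟦_⟧ = coeff
        ; +-homo = λ { (a , b) (c , d) → trans (coeff-reduce (a + c) (b + d))
            (trans (cong₂ _⊖_ (×-homo-+ 𝟙 a c) (×-homo-+ 𝟙 b d)) (⊖-interchange _ _ _ _)) }
        ; *-homo = λ { (a , b) (c , d) → trans (coeff-reduce (a * c + b * d) (a * d + b * c))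
            (trans (cong₂ _⊖_ (trans (×-homo-+ 𝟙 (a * c) (b * d)) (cong₂ _⊹_ (×1-homo-* a c) (×1-homo-* b d)))
                              (trans (×-homo-+ 𝟙 (a * d) (b * c)) (cong₂ _⊹_ (×1-homo-* a d) (×1-homo-* b c))))
                   (sym (⊖-product _ _ _ _))) }
        ; -‿homo = λ { (a , b) → neg (a ×′ 𝟙) (b ×′ 𝟙) }
        ; 0-homo = R.-‿inverseʳ 𝟘
        ; 1-homo = trans (cong ((𝟙 ⊹ 𝟘) ⊹_) RG.ε⁻¹≈ε) (trans (R.+-identityʳ _) (R.+-identityʳ 𝟙))
        }
        where
        neg : ∀ x y → y ⊖ x ≡ ⊝ (x ⊖ y)
        neg x y = trans (R.+-comm y _) (trans (cong (⊝ x ⊹_) (sym (RG.⁻¹-involutive y))) (RP.-‿+-comm x (⊝ y)))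

      _coeff≟_ : (x y : ℕ × ℕ) → Maybe (coeff x ≡ coeff y)
      (a , b) coeff≟ (c , d) with a ≟ c | b ≟ d
      ... | yes refl | yes refl = just refl
      ... | _        | _        = nothing

      open Algebra.Solver.Ring integers almostRing morphism _coeff≟_ public
        using (solve; _:=_; _:+_; _:*_; :-_; _:-_)

    open FieldSolver using (solve; _:=_; _:+_; _:*_; :-_; _:-_)

    ⊗-cancel-zero : ∀ {a b} → a ≢ 𝟘 → a ⊗ b ≡ 𝟘 → b ≡ 𝟘
    ⊗-cancel-zero {a} {b} a≢0 e = begin
      b                ≡⟨ sym (R.*-identityˡ b) ⟩
      𝟙 ⊗ b            ≡⟨ cong (_⊗ b) (sym (⁻¹-inverse a a≢0)) ⟩
      (a ⊗ a ⁻¹) ⊗ b   ≡⟨ solve 3 (λ a i b → (a :* i) :* b := i :* (a :* b)) refl a (a ⁻¹) b ⟩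
      a ⁻¹ ⊗ (a ⊗ b)   ≡⟨ cong (a ⁻¹ ⊗_) e ⟩
      a ⁻¹ ⊗ 𝟘         ≡⟨ R.zeroʳ _ ⟩
      𝟘 ∎
      where open ≡-Reasoning

    ⊗-nonzero : ∀ {a b} → a ≢ 𝟘 → b ≢ 𝟘 → a ⊗ b ≢ 𝟘
    ⊗-nonzero a≢0 b≢0 e = b≢0 (⊗-cancel-zero a≢0 e)

    ⊖-zero : ∀ {a b} → a ⊖ b ≡ 𝟘 → a ≡ b
    ⊖-zero {a} {b} e = begin
      a             ≡⟨ solve 2 (λ a b → a := (a :- b) :+ b) refl a b ⟩
      (a ⊖ b) ⊹ b   ≡⟨ cong (_⊹ b) e ⟩
      𝟘 ⊹ b         ≡⟨ R.+-identityˡ b ⟩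
      b ∎
      where open ≡-Reasoning

    ⊖-self : ∀ a → a ⊖ a ≡ 𝟘
    ⊖-self = R.-‿inverseʳ

    ⊖-nonzero : ∀ {a b} → a ≢ b → a ⊖ b ≢ 𝟘
    ⊖-nonzero a≢b e = a≢b (⊖-zero e)

    𝟙≢𝟘 : 𝟙 ≢ 𝟘
    𝟙≢𝟘 e = 0≢1 (sym e)

    V : ℕ → Set
    V = Vec K

    cmb : K → K → K → K → K
    cmb s x y z = x ⊹ s ⊗ (y ⊖ z)

    cmbV : ∀ {m} → K → V m → V m → V m → V m
    cmbV s []       []       []       = []
    cmbV s (x ∷ xs) (y ∷ ys) (z ∷ zs) = cmb s x y z ∷ cmbV s xs ys zs

    0V : ∀ {m} → V m
    0V {zero}  = []
    0V {suc m} = 𝟘 ∷ 0V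

    cmb-fixed : ∀ s x y → cmb s x y y ≡ x
    cmb-fixed = solve 3 (λ s x y → x :+ s :* (y :- y) := x) refl

    cmbV-fixed : ∀ {m} s (x y : V m) → cmbV s x y y ≡ x
    cmbV-fixed s []       []       = refl
    cmbV-fixed s (x ∷ xs) (y ∷ ys) = cong₂ _∷_ (cmb-fixed s x y) (cmbV-fixed s xs ys)

    cmb-unit : ∀ a → cmb a 𝟘 𝟙 𝟘 ≡ a
    cmb-unit a = trans (R.+-identityˡ _) (trans (cong (a ⊗_) (trans (cong (𝟙 ⊹_) RG.ε⁻¹≈ε) (R.+-identityʳ 𝟙))) (R.*-identityʳ a))

    -- Compatibility with x + s (y − z) characterises affine maps.
    IsAffine : ∀ {k m} → (V k → V m) → Set
    IsAffine φ = ∀ s x y z → φ (cmbV s x y z) ≡ cmbV s (φ x) (φ y) (φ z)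

    -- Pol d f: the function f is given by a polynomial of total degree less than d.
    data Pol {m : ℕ} : ℕ → (V m → K) → Set where
      zeroP  : ∀ {d f} → (∀ x → f x ≡ 𝟘) → Pol d f
      constP : ∀ {d f} c → (∀ x → f x ≡ c) → Pol (suc d) f
      addP   : ∀ {d f g h} → Pol d f → Pol d g → (∀ x → h x ≡ f x ⊹ g x) → Pol d h
      varP   : ∀ {d f h} i → Pol d f → (∀ x → h x ≡ lookup x i ⊗ f x) → Pol (suc d) h

    pol-ext : ∀ {m d} {f g : V m → K} → (∀ x → g x ≡ f x) → Pol d f → Pol d g
    pol-ext e (zeroP z)    = zeroP (λ x → trans (e x) (z x))
    pol-ext e (constP c k) = constP c (λ x → trans (e x) (k x))
    pol-ext e (addP p r a) = addP p r (λ x → trans (e x) (a x))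
    pol-ext e (varP i p v) = varP i p (λ x → trans (e x) (v x))

    pol-weaken : ∀ {m d d′} {f : V m → K} → d ≤ d′ → Pol d f → Pol d′ f
    pol-weaken le       (zeroP z)    = zeroP z
    pol-weaken (s≤s le) (constP c k) = constP c k
    pol-weaken le       (addP p r a) = addP (pol-weaken le p) (pol-weaken le r) a
    pol-weaken (s≤s le) (varP i p v) = varP i (pol-weaken le p) v

    pol-0 : ∀ {m} {f : V m → K} → Pol 0 f → ∀ x → f x ≡ 𝟘
    pol-0 (zeroP z)    x = z x
    pol-0 (addP p r a) x = trans (a x) (trans (cong₂ _⊹_ (pol-0 p x) (pol-0 r x)) (R.+-identityˡ 𝟘))

    pol-1 : ∀ {m} {f : V m → K} → Pol 1 f → ∃ λ c → ∀ x → f x ≡ c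
    pol-1 (zeroP z)    = 𝟘 , z
    pol-1 (constP c k) = c , k
    pol-1 (addP p r a) with pol-1 p | pol-1 r
    ... | c , e | c′ , e′ = c ⊹ c′ , λ x → trans (a x) (cong₂ _⊹_ (e x) (e′ x))
    pol-1 (varP i p v) = 𝟘 , λ x → trans (v x) (trans (cong (lookup x i ⊗_) (pol-0 p x)) (R.zeroʳ _))

    pol-scale : ∀ {m d} {f : V m → K} c → Pol d f → Pol d (λ x → c ⊗ f x)
    pol-scale c (zeroP z)     = zeroP (λ x → trans (cong (c ⊗_) (z x)) (R.zeroʳ c))
    pol-scale c (constP c′ k) = constP (c ⊗ c′) (λ x → cong (c ⊗_) (k x))
    pol-scale c (addP p r a)  = addP (pol-scale c p) (pol-scale c r) (λ x → trans (cong (c ⊗_) (a x)) (R.distribˡ c _ _))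
    pol-scale c (varP {f = f} i p v) = varP i (pol-scale c p) (λ x → trans (cong (c ⊗_) (v x))
      (solve 3 (λ c l y → c :* (l :* y) := l :* (c :* y)) refl c (lookup x i) (f x)))

    pol-sub : ∀ {m d} {f g : V m → K} → Pol d f → Pol d g → Pol d (λ x → f x ⊖ g x)
    pol-sub {f = f} {g} p r = addP p (pol-scale (⊝ 𝟙) r) (λ x → cong (f x ⊹_) (sym (RP.-1*x≈-x (g x))))

    -- Stands for "`ℓ` has degree at most one": all that is used of an affine function is that
    -- multiplying by it raises a degree bound by at most one.
    Mulable : ∀ {m} → (V m → K) → Set
    Mulable {m} ℓ = ∀ {d} {f : V m → K} → Pol d f → Pol (suc d) (λ x → ℓ x ⊗ f x)

    mul-const : ∀ {m} c → Mulable {m} (λ _ → c)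
    mul-const c p = pol-weaken (n≤1+n _) (pol-scale c p)

    mul-var : ∀ {m} (i : Fin m) → Mulable (λ x → lookup x i)
    mul-var i p = varP i p (λ _ → refl)

    mul-add : ∀ {m} {ℓ ℓ′ : V m → K} → Mulable ℓ → Mulable ℓ′ → Mulable (λ x → ℓ x ⊹ ℓ′ x)
    mul-add M M′ p = addP (M p) (M′ p) (λ x → R.distribʳ _ _ _)

    mul-scale : ∀ {m} {ℓ : V m → K} c → Mulable ℓ → Mulable (λ x → c ⊗ ℓ x)
    mul-scale c M p = pol-ext (λ x → R.*-assoc c _ _) (pol-scale c (M p))

    mul-ext : ∀ {m} {ℓ ℓ′ : V m → K} → (∀ x → ℓ′ x ≡ ℓ x) → Mulable ℓ → Mulable ℓ′
    mul-ext e M {f = f} p = pol-ext (λ x → cong (_⊗ f x) (e x)) (M p)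

    -- Induction on the number of coordinates: `ℓ` is its restriction to head 0 plus a constant
    -- times the head. The map `π` keeps all functions on the same space while coordinates are
    -- stripped off.
    affine-mulable : ∀ {k m} {ℓ : V k → K} → (∀ s x y z → ℓ (cmbV s x y z) ≡ cmb s (ℓ x) (ℓ y) (ℓ z)) →
                     (π : V m → V k) → (∀ i → Mulable (λ v → lookup (π v) i)) → Mulable (ℓ ∘ π)
    affine-mulable {zero} {ℓ = ℓ} aff π M = mul-ext (λ x → cong ℓ (empty (π x))) (mul-const (ℓ []))
      where
      empty : (x : V 0) → x ≡ []
      empty [] = refl
    affine-mulable {suc k} {ℓ = ℓ} aff π M =
      mul-ext (λ v → split (π v)) (mul-add
        (affine-mulable {ℓ = λ x → ℓ (𝟘 ∷ x)}
          (λ s x y z → trans (cong (λ a → ℓ (a ∷ cmbV s x y z)) (sym (cmb-fixed s 𝟘 𝟘))) (aff s (𝟘 ∷ x) (𝟘 ∷ y) (𝟘 ∷ z)))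
          (λ v → tail (π v)) (λ i → mul-ext (λ v → sym (lookup-suc (π v) i)) (M (suc i))))
        (mul-scale κ (mul-ext (λ v → sym (lookup-zero (π v))) (M zero))))
      where
      κ = ℓ (𝟙 ∷ 0V) ⊖ ℓ (𝟘 ∷ 0V)
      lookup-suc : (x : V (suc k)) (i : Fin k) → lookup x (suc i) ≡ lookup (tail x) i
      lookup-suc (_ ∷ _) i = refl
      lookup-zero : (x : V (suc k)) → lookup x zero ≡ head x
      lookup-zero (_ ∷ _) = refl
      split : (x : V (suc k)) → ℓ x ≡ ℓ (𝟘 ∷ tail x) ⊹ κ ⊗ head x
      split (a ∷ x) = trans (cong ℓ (sym (cong₂ _∷_ (cmb-unit a) (cmbV-fixed a x 0V))))
        (trans (aff a (𝟘 ∷ x) (𝟙 ∷ 0V) (𝟘 ∷ 0V)) (cong (ℓ (𝟘 ∷ x) ⊹_) (R.*-comm a κ)))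

    lookup-cmbV : ∀ {m} s (x y z : V m) i → lookup (cmbV s x y z) i ≡ cmb s (lookup x i) (lookup y i) (lookup z i)
    lookup-cmbV s (x ∷ xs) (y ∷ ys) (z ∷ zs) zero    = refl
    lookup-cmbV s (x ∷ xs) (y ∷ ys) (z ∷ zs) (suc i) = lookup-cmbV s xs ys zs i

    pol-pull : ∀ {k m d} {f : V m → K} {φ : V k → V m} → IsAffine φ → Pol d f → Pol d (f ∘ φ)
    pol-pull aff (zeroP z)    = zeroP (λ x → z _)
    pol-pull aff (constP c k) = constP c (λ x → k _)
    pol-pull aff (addP p r a) = addP (pol-pull aff p) (pol-pull aff r) (λ x → a _)
    pol-pull {k} {m} {φ = φ} aff (varP i p v) = pol-ext (λ x → v _)
      (affine-mulable {ℓ = λ x → lookup (φ x) i} (λ s x y z → trans (cong (λ w → lookup w i) (aff s x y z)) (lookup-cmbV s (φ x) (φ y) (φ z) i)) id mul-var (pol-pull aff p))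

    cons-affine : ∀ {m} a → IsAffine {m} (a ∷_)
    cons-affine a s x y z = cong (_∷ cmbV s x y z) (sym (cmb-fixed s a a))

    infix 30 _↾_
    _↾_ : ∀ {m} → (V (suc m) → K) → K → V m → K
    (f ↾ a) x = f (a ∷ x)

    pol-slice : ∀ {m d} {f : V (suc m) → K} a → Pol d f → Pol d (f ↾ a)
    pol-slice a p = pol-pull (cons-affine a) p

    abstract
      -- Division by y - a with remainder `f (a ∷ x)`, by induction on the derivation of `Pol`. For
      -- a product with the first coordinate, y((y - a)g + r) = (y - a)(yg + r) + ar.
      pol-divide : ∀ {m d} {f : V (suc m) → K} → Pol d f → ∀ a →
                   ∃ λ g → Pol (d ∸ 1) g × (∀ y x → f (y ∷ x) ≡ (y ⊖ a) ⊗ g (y ∷ x) ⊹ f (a ∷ x))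
      pol-divide (zeroP z) a = (λ _ → 𝟘) , zeroP (λ _ → refl) , λ y x →
        trans (z _) (sym (trans (cong₂ _⊹_ (R.zeroʳ _) (z _)) (R.+-identityˡ 𝟘)))
      pol-divide (constP c k) a = (λ _ → 𝟘) , zeroP (λ _ → refl) , λ y x →
        trans (k _) (sym (trans (cong₂ _⊹_ (R.zeroʳ _) (k _)) (R.+-identityˡ c)))
      pol-divide (addP {f = f} {g} p r e) a with pol-divide p a | pol-divide r a
      ... | u , pu , eu | w , pw , ew = (λ x → u x ⊹ w x) , addP pu pw (λ _ → refl) , λ y x →
        trans (e _) (trans (cong₂ _⊹_ (eu y x) (ew y x)) (trans
          (solve 5 (λ d u w fa ga → (d :* u :+ fa) :+ (d :* w :+ ga) := d :* (u :+ w) :+ (fa :+ ga)) refl (y ⊖ a) (u (y ∷ x)) (w (y ∷ x)) (f (a ∷ x)) (g (a ∷ x)))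
          (cong ((y ⊖ a) ⊗ (u (y ∷ x) ⊹ w (y ∷ x)) ⊹_) (sym (e _)))))
      pol-divide (varP {zero} {h = h} i p e) a = (λ _ → 𝟘) , zeroP (λ _ → refl) , λ y x →
        trans (vanish _) (sym (trans (cong₂ _⊹_ (R.zeroʳ _) (vanish _)) (R.+-identityˡ 𝟘)))
        where
        vanish : ∀ x → h x ≡ 𝟘
        vanish = λ x → trans (e x) (trans (cong (lookup x i ⊗_) (pol-0 p x)) (R.zeroʳ _))
      pol-divide {m} (varP {suc d} {f} {h} zero p e) a with pol-divide p a
      ... | g , pg , eg = (λ x → lookup x zero ⊗ g x ⊹ f (a ∷ tail x))
        , addP (varP zero pg (λ _ → refl)) (pol-pull {φ = λ x → a ∷ tail x} restrict-affine p) (λ _ → refl)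
        , λ y x → trans (e _) (trans (cong (y ⊗_) (eg y x)) (trans
            (solve 4 (λ y a g fa → y :* ((y :- a) :* g :+ fa) := (y :- a) :* (y :* g :+ fa) :+ a :* fa) refl y a (g (y ∷ x)) (f (a ∷ x)))
            (cong ((y ⊖ a) ⊗ (y ⊗ g (y ∷ x) ⊹ f (a ∷ x)) ⊹_) (sym (e (a ∷ x))))))
        where
        restrict-affine : IsAffine {suc m} (λ x → a ∷ tail x)
        restrict-affine s (_ ∷ x) (_ ∷ y) (_ ∷ z) = cons-affine a s x y z
      pol-divide (varP {suc d} {f} (suc i) p e) a with pol-divide p a
      ... | g , pg , eg = (λ x → lookup x (suc i) ⊗ g x) , varP (suc i) pg (λ _ → refl)
        , λ y x → trans (e _) (trans (cong (lookup x i ⊗_) (eg y x)) (trans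
            (solve 4 (λ d l g fa → l :* (d :* g :+ fa) := d :* (l :* g) :+ l :* fa) refl (y ⊖ a) (lookup x i) (g (y ∷ x)) (f (a ∷ x)))
            (cong ((y ⊖ a) ⊗ (lookup x i ⊗ g (y ∷ x)) ⊹_) (sym (e (a ∷ x))))))

  open Polynomials
  open FieldSolver using (solve; _:=_; _:+_; _:*_; :-_; _:-_)

  -- Weights, slice counts and the minimum weight

  module Weights where

    Zero : ∀ {m} → (V m → K) → Set
    Zero f = ∀ x → f x ≡ 𝟘

    abstract
      nz : K → ℕ
      nz x = if does (x ≟F 𝟘) then 0 else 1

      nz-zero : ∀ {x} → x ≡ 𝟘 → nz x ≡ 0
      nz-zero {x} e with x ≟F 𝟘
      ... | yes _ = refl
      ... | no ne = ⊥-elim (ne e)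

      nz-one : ∀ {x} → x ≢ 𝟘 → nz x ≡ 1
      nz-one {x} ne with x ≟F 𝟘
      ... | yes e = ⊥-elim (ne e)
      ... | no _  = refl

      nz≤1 : ∀ x → nz x ≤ 1
      nz≤1 x with x ≟F 𝟘
      ... | yes _ = z≤n
      ... | no _  = ≤-refl

      nz≡0 : ∀ {x} → nz x ≡ 0 → x ≡ 𝟘
      nz≡0 {x} e with x ≟F 𝟘
      ... | yes p = p

      nz-mono : ∀ a b → (b ≡ 𝟘 → a ≡ 𝟘) → nz a ≤ nz b
      nz-mono a b e with b ≟F 𝟘
      ... | yes b≡0 = ≤-trans (≤-reflexive (nz-zero (e b≡0))) z≤n
      ... | no _    = nz≤1 a

      nz-sub : ∀ a b → nz (a ⊖ b) ≤ nz a + nz b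
      nz-sub a b with a ≟F 𝟘 | b ≟F 𝟘
      ... | yes refl | yes refl = ≤-trans (≤-reflexive (nz-zero (⊖-self 𝟘))) z≤n
      ... | yes _    | no _     = nz≤1 (a ⊖ b)
      ... | no _     | _        = ≤-trans (nz≤1 (a ⊖ b)) (m≤m+n 1 _)

      wt : ∀ {m} → (V m → K) → ℕ
      wt f = sumV (λ x → nz (f x))

      wt-indicator : ∀ {m} (f : V m → K) → wt f ≡ sumV (λ v → if not (does (f v ≟F 𝟘)) then 1 else 0)
      wt-indicator f = sumV-cong (λ v → flip (does (f v ≟F 𝟘)))
        where
        flip : ∀ b → (if b then 0 else 1) ≡ (if not b then 1 else 0)
        flip true  = refl
        flip false = refl

      wt-suc : ∀ {m} (f : V (suc m) → K) → wt f ≡ sumF (λ a → wt (f ↾ a))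
      wt-suc f = refl

      wt-cong : ∀ {m} {f g : V m → K} → (∀ x → f x ≡ g x) → wt f ≡ wt g
      wt-cong e = sumV-cong (λ x → cong nz (e x))

      sumV-0 : ∀ {m} → sumV {q} {m} (λ _ → 0) ≡ 0
      sumV-0 {m} = Additive.zero-T (sumV-additive {q} {m})

      Zero⇒wt≡0 : ∀ {m} {f : V m → K} → Zero f → wt f ≡ 0
      Zero⇒wt≡0 {m} z = trans (sumV-cong (λ x → nz-zero (z x))) (sumV-0 {m})

      wt≡0⇒Zero : ∀ {m} {f : V m → K} → wt f ≡ 0 → Zero f
      wt≡0⇒Zero {f = f} e x = nz≡0 (n≤0⇒n≡0 (subst (nz (f x) ≤_) e (sumV-term (λ x → nz (f x)) x)))

      zero? : ∀ {m} (f : V m → K) → Dec (Zero f)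
      zero? f with wt f ≟ 0
      ... | yes e = yes (wt≡0⇒Zero e)
      ... | no ne = no (λ z → ne (Zero⇒wt≡0 z))

      wt-pos : ∀ {m} {f : V m → K} → ¬ Zero f → 1 ≤ wt f
      wt-pos {f = f} nz = n≢0⇒n>0 (λ e → nz (wt≡0⇒Zero e))

      wt-nonzero : ∀ {m} {f : V m → K} → 1 ≤ wt f → ¬ Zero f
      wt-nonzero p z = n≮n 0 (subst (1 ≤_) (Zero⇒wt≡0 z) p)

      nonzero-slice : ∀ {m} {f : V (suc m) → K} → ¬ Zero f → ∃ λ a → ¬ Zero (f ↾ a)
      nonzero-slice {f = f} nf with sumF-pos (λ a → wt (f ↾ a)) (λ e → nf (wt≡0⇒Zero e))
      ... | a , ne = a , λ z → ne (Zero⇒wt≡0 z)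

      nonzero-point : ∀ {m} {f : V m → K} → ¬ Zero f → ∃ λ x → f x ≢ 𝟘
      nonzero-point {zero} {f} nf = [] , λ e → nf (λ { [] → e })
      nonzero-point {suc m} nf with nonzero-slice nf
      ... | a , na with nonzero-point na
      ... | x , ne = a ∷ x , ne

      wt-point : ∀ {m} {f : V m → K} {x} → f x ≢ 𝟘 → 1 ≤ wt f
      wt-point {f = f} {x} ne = wt-pos {f = f} (λ z → ne (z x))

      wt-upper : ∀ {m} (f : V m → K) → wt f ≤ q ^ m
      wt-upper {zero}  f = nz≤1 (f [])
      wt-upper {suc m} f = sumF-upper (λ a → wt-upper (f ↾ a))

      wt-full : ∀ {m} {f : V m → K} → (∀ x → f x ≢ 𝟘) → wt f ≡ q ^ m
      wt-full {zero}  ne = nz-one (ne [])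
      wt-full {suc m} ne = sumF-const-≡ (λ a → wt-full (λ x → ne (a ∷ x)))

      wt-const : ∀ {m} {f : V m → K} {c} → c ≢ 𝟘 → (∀ x → f x ≡ c) → wt f ≡ q ^ m
      wt-const c≢0 e = wt-full (λ x z → c≢0 (trans (sym (e x)) z))

      wt-mono : ∀ {m} {f g : V m → K} → (∀ x → g x ≡ 𝟘 → f x ≡ 𝟘) → wt f ≤ wt g
      wt-mono {f = f} {g} e = sumV-mono λ x → nz-mono (f x) (g x) (e x)

      wt-scale : ∀ {m} {f g : V m → K} {κ} → κ ≢ 𝟘 → (∀ x → f x ≡ κ ⊗ g x) → wt f ≡ wt g
      wt-scale {κ = κ} κ≢0 e = ≤-antisym (wt-mono (λ x z → trans (e x) (trans (cong (κ ⊗_) z) (R.zeroʳ κ))))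
                                 (wt-mono (λ x z → ⊗-cancel-zero κ≢0 (trans (sym (e x)) z)))

      wt-sub : ∀ {m} (f g : V m → K) → wt (λ x → f x ⊖ g x) ≤ wt f + wt g
      wt-sub f g = ≤-trans (sumV-mono (λ x → nz-sub (f x) (g x)))
        (≤-reflexive (Additive.add-T sumV-additive (λ x → nz (f x)) (λ x → nz (g x))))

      -- At a common point of the supports the right side counts 2 and the difference at most 1.
      -- This one unit later puts a difference below a minimum weight.
      wt-sub-overlap : ∀ {m} (f g : V m → K) {x} → f x ≢ 𝟘 → g x ≢ 𝟘 → suc (wt (λ x → f x ⊖ g x)) ≤ wt f + wt g
      wt-sub-overlap f g {x₀} fx gx = begin
        suc (wt (λ x → f x ⊖ g x))
          ≡⟨ +-comm 1 _ ⟩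
        wt (λ x → f x ⊖ g x) + 1
          ≡⟨ cong (wt (λ x → f x ⊖ g x) +_) (sym (sumV-pick x₀ (λ _ → 1))) ⟩
        wt (λ x → f x ⊖ g x) + sumV (λ x → [ x ≟V x₀ ] * 1)
          ≡⟨ sym (Additive.add-T sumV-additive (λ x → nz (f x ⊖ g x)) (λ x → [ x ≟V x₀ ] * 1)) ⟩
        sumV (λ x → nz (f x ⊖ g x) + [ x ≟V x₀ ] * 1)
          ≤⟨ sumV-mono pointwise ⟩
        sumV (λ x → nz (f x) + nz (g x))
          ≡⟨ Additive.add-T sumV-additive (λ x → nz (f x)) (λ x → nz (g x)) ⟩
        wt f + wt g ∎
        where
        open ≤-Reasoning
        pointwise : ∀ x → nz (f x ⊖ g x) + [ x ≟V x₀ ] * 1 ≤ nz (f x) + nz (g x)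
        pointwise x with x ≟V x₀
        ... | no _     = ≤-trans (≤-reflexive (+-identityʳ _)) (nz-sub (f x) (g x))
        ... | yes refl = ≤-trans (+-monoˡ-≤ 1 (nz≤1 (f x ⊖ g x))) (≤-reflexive (sym (cong₂ _+_ (nz-one fx) (nz-one gx))))

      wt-strict : ∀ {m} {f g : V m → K} {x} → (∀ x → f x ≡ 𝟘 → g x ≡ 𝟘) → f x ≢ 𝟘 → g x ≡ 𝟘 → suc (wt g) ≤ wt f
      wt-strict {f = f} {g} {x₀} e fx gx = begin
        suc (wt g)
          ≡⟨ +-comm 1 _ ⟩
        wt g + 1
          ≡⟨ cong (wt g +_) (sym (sumV-pick x₀ (λ _ → 1))) ⟩
        wt g + sumV (λ x → [ x ≟V x₀ ] * 1)
          ≡⟨ sym (Additive.add-T sumV-additive (λ x → nz (g x)) (λ x → [ x ≟V x₀ ] * 1)) ⟩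
        sumV (λ x → nz (g x) + [ x ≟V x₀ ] * 1)
          ≤⟨ sumV-mono pointwise ⟩
        wt f ∎
        where
        open ≤-Reasoning
        pointwise : ∀ x → nz (g x) + [ x ≟V x₀ ] * 1 ≤ nz (f x)
        pointwise x with x ≟V x₀
        ... | no _     = ≤-trans (≤-reflexive (+-identityʳ _)) (nz-mono (g x) (f x) (e x))
        ... | yes refl = ≤-reflexive (trans (cong (_+ 1) (nz-zero gx)) (sym (nz-one fx)))

      wt-reindex : ∀ {m} (φ ψ : V m → V m) → (∀ x → φ (ψ x) ≡ x) → (∀ x → ψ (φ x) ≡ x) → (f : V m → K) → wt (f ∘ φ) ≡ wt f
      wt-reindex φ ψ φψ ψφ f = FiniteSum.S-reindex vecSum φ ψ φψ ψφ (λ x → nz (f x))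

    abstract
      -- For the class of the first coordinate, `#nonzero f` is the K of the overview and `#zero f`
      -- = q - K the number of factors that divide f.
      vanishes occurs : ∀ {m} (f : V (suc m) → K) → K → ℕ
      vanishes f a = if does (zero? (f ↾ a)) then 1 else 0
      occurs   f a = if does (zero? (f ↾ a)) then 0 else 1

      #zero #nonzero : ∀ {m} → (V (suc m) → K) → ℕ
      #zero f    = sumF (vanishes f)
      #nonzero f = sumF (occurs f)

      #nonzero+#zero : ∀ {m} (f : V (suc m) → K) → #nonzero f + #zero f ≡ q
      #nonzero+#zero f = trans (sym (sumF-+ (occurs f) (vanishes f))) (trans (sumF-const-≡ one) (*-identityʳ q))
        where
        one : ∀ a → occurs f a + vanishes f a ≡ 1
        one a with zero? (f ↾ a)
        ... | yes _ = refl
        ... | no _  = refl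

      occurs-nonzero : ∀ {m} {f : V (suc m) → K} {a} → ¬ Zero (f ↾ a) → occurs f a ≡ 1
      occurs-nonzero {f = f} {a} n with zero? (f ↾ a)
      ... | yes z = ⊥-elim (n z)
      ... | no _  = refl

      occurs≡0 : ∀ {m} {f : V (suc m) → K} {a} → occurs f a ≡ 0 → Zero (f ↾ a)
      occurs≡0 {f = f} {a} e with zero? (f ↾ a)
      ... | yes z = z

      vanishes≢0 : ∀ {m} {f : V (suc m) → K} {a} → vanishes f a ≢ 0 → Zero (f ↾ a)
      vanishes≢0 {f = f} {a} ne with zero? (f ↾ a)
      ... | yes z = z
      ... | no _  = ⊥-elim (ne refl)

      #nonzero-pos : ∀ {m} {f : V (suc m) → K} → ¬ Zero f → 1 ≤ #nonzero f
      #nonzero-pos {f = f} nf with nonzero-slice nf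
      ... | a , na = subst (_≤ #nonzero f) (occurs-nonzero {f = f} na) (sumF-term (occurs f) a)

    abstract
      #nonzero≡1 : ∀ {m} {f : V (suc m) → K} → #nonzero f ≡ 1 → ∀ {c} → ¬ Zero (f ↾ c) → ∀ a → a ≢ c → Zero (f ↾ a)
      #nonzero≡1 {f = f} e {c} nc a a≢c = occurs≡0 {f = f} (n≤0⇒n≡0 (+-cancelˡ-≤ 1 _ 0
        (subst₂ _≤_ (cong (_+ occurs f a) (occurs-nonzero {f = f} nc)) e (sumF-terms (occurs f) (λ c≡a → a≢c (sym c≡a))))))

      #nonzero≡2 : ∀ {m} {f : V (suc m) → K} → #nonzero f ≡ 2 → ∀ {a b} → a ≢ b → ¬ Zero (f ↾ a) → ¬ Zero (f ↾ b) → ∀ y → y ≢ a → y ≢ b → Zero (f ↾ y)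
      #nonzero≡2 {f = f} e {a} {b} a≢b na nb y y≢a y≢b = occurs≡0 {f = f} (n≤0⇒n≡0 (+-cancelˡ-≤ 2 _ 0
        (subst₂ _≤_ (cong₂ (λ u v → u + (v + occurs f y)) (occurs-nonzero {f = f} na) (occurs-nonzero {f = f} nb)) e
          (sumF-three (occurs f) a≢b (λ eq → y≢a (sym eq)) (λ eq → y≢b (sym eq))))))

      occurs-≤ : ∀ {m} (f : V (suc m) → K) {B} → (∀ a → ¬ Zero (f ↾ a) → B ≤ wt (f ↾ a)) → ∀ a → B * occurs f a ≤ wt (f ↾ a)
      occurs-≤ f {B} b a with zero? (f ↾ a)
      ... | yes _ = ≤-trans (≤-reflexive (*-zeroʳ B)) z≤n
      ... | no n  = ≤-trans (≤-reflexive (*-identityʳ B)) (b a n)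

      slice-bound : ∀ {m} (f : V (suc m) → K) {B} → (∀ a → ¬ Zero (f ↾ a) → B ≤ wt (f ↾ a)) → #nonzero f * B ≤ wt f
      slice-bound f {B} b = ≤-trans (≤-reflexive (sym (trans (sumF-* B (occurs f)) (*-comm B _)))) (sumF-mono (occurs-≤ f b))

      -- The slice at `c` counts with its true weight, every other nonzero slice with `B`; the `B`
      -- on the right avoids subtracting one from `#nonzero f`.
      slice-bound-at : ∀ {m} (f : V (suc m) → K) {B} → (∀ a → ¬ Zero (f ↾ a) → B ≤ wt (f ↾ a)) →
                       ∀ {c} → ¬ Zero (f ↾ c) → wt (f ↾ c) + #nonzero f * B ≤ wt f + B
      slice-bound-at {m} f {B} b {c} nc = begin
        wt (f ↾ c) + #nonzero f * B
          ≡⟨ cong (λ s → wt (f ↾ c) + s * B) (trans (sumF-punch (occurs f) c) (cong (_+ rest) (occurs-nonzero {f = f} nc))) ⟩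
        wt (f ↾ c) + (B + rest * B)
          ≡⟨ rearrange (wt (f ↾ c)) B (rest * B) ⟩
        wt (f ↾ c) + rest * B + B
          ≤⟨ +-monoˡ-≤ B (+-monoʳ-≤ (wt (f ↾ c)) rest≤) ⟩
        wt (f ↾ c) + sumF (λ j → wt (f ↾ punchIn c j)) + B
          ≡⟨ cong (_+ B) (sym (sumF-punch (λ a → wt (f ↾ a)) c)) ⟩
        wt f + B ∎
        where
        open ≤-Reasoning
        rest : ℕ
        rest = sumF (λ j → occurs f (punchIn c j))
        rest≤ : rest * B ≤ sumF (λ j → wt (f ↾ punchIn c j))
        rest≤ = ≤-trans (≤-reflexive (sym (trans (sumF-* B (λ j → occurs f (punchIn c j))) (*-comm B _))))
                        (sumF-mono (λ j → occurs-≤ f b (punchIn c j)))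
        rearrange : ∀ x y z → x + (y + z) ≡ x + z + y
        rearrange = solve-∀

      -- `N` need not consist of the slice weights of `f`: in the shear argument `f` becomes the
      -- difference `g′`, while `N` holds the slice weights of the original word.
      two-sided-bound : ∀ {m} (f : V (suc m) → K) (N : K → ℕ) {A B} → (∀ a → Zero (f ↾ a) → A ≤ N a) → (∀ a → ¬ Zero (f ↾ a) → B ≤ N a) →
                        ∀ {c} → ¬ Zero (f ↾ c) → N c + (#zero f * A + #nonzero f * B) ≤ sumF N + B
      two-sided-bound f N {A} {B} lo hi {c} nc = begin
        N c + (#zero f * A + #nonzero f * B)
          ≡⟨ cong (N c +_) (cong₂ _+_ (trans (*-comm _ A) (sym (sumF-* A (vanishes f)))) (trans (*-comm _ B) (sym (sumF-* B (occurs f))))) ⟩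
        N c + (sumF (λ a → A * vanishes f a) + sumF (λ a → B * occurs f a))
          ≡⟨ cong (N c +_) (trans (sym (sumF-+ (λ a → A * vanishes f a) (λ a → B * occurs f a))) (sumF-punch (λ a → A * vanishes f a + B * occurs f a) c)) ⟩
        N c + (A * vanishes f c + B * occurs f c + sumF (λ j → A * vanishes f (punchIn c j) + B * occurs f (punchIn c j)))
          ≤⟨ +-monoʳ-≤ (N c) (+-mono-≤ (≤-reflexive at-c) (sumF-mono (λ j → term (punchIn c j)))) ⟩
        N c + (B + sumF (λ j → N (punchIn c j)))
          ≡⟨ rearrange (N c) B _ ⟩
        N c + sumF (λ j → N (punchIn c j)) + B
          ≡⟨ cong (_+ B) (sym (sumF-punch N c)) ⟩
        sumF N + B ∎
        where
        open ≤-Reasoning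
        rearrange : ∀ x y z → x + (y + z) ≡ x + z + y
        rearrange = solve-∀
        term : ∀ a → A * vanishes f a + B * occurs f a ≤ N a
        term a with zero? (f ↾ a)
        ... | yes z = ≤-trans (≤-reflexive (trans (cong₂ _+_ (*-identityʳ A) (*-zeroʳ B)) (+-identityʳ A))) (lo a z)
        ... | no n  = ≤-trans (≤-reflexive (cong₂ _+_ (*-zeroʳ A) (*-identityʳ B))) (hi a n)
        at-c : A * vanishes f c + B * occurs f c ≡ B
        at-c with zero? (f ↾ c)
        ... | yes z = ⊥-elim (nc z)
        ... | no _  = cong₂ _+_ (*-zeroʳ A) (*-identityʳ B)

      vanishes-zero : ∀ {m} (f : V (suc m) → K) {a} → Zero (f ↾ a) → vanishes f a ≡ 1
      vanishes-zero f {a} z with zero? (f ↾ a)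
      ... | yes _ = refl
      ... | no n  = ⊥-elim (n z)

      zero-slice : ∀ {m} (f : V (suc m) → K) → 1 ≤ #zero f → ∃ λ a → Zero (f ↾ a)
      zero-slice f pos with sumF-pos (vanishes f) (λ e → n≮n 0 (≤-trans pos (≤-reflexive e)))
      ... | a , ne = a , vanishes≢0 {f = f} ne

      #zero≥1 : ∀ {m} {f : V (suc m) → K} {a} → Zero (f ↾ a) → 1 ≤ #zero f
      #zero≥1 {f = f} {a} z = ≤-trans (≤-reflexive (sym (vanishes-zero f z))) (sumF-term (vanishes f) a)

      #zero≥2 : ∀ {m} {f : V (suc m) → K} {a b} → a ≢ b → Zero (f ↾ a) → Zero (f ↾ b) → 2 ≤ #zero f
      #zero≥2 {f = f} a≢b za zb = ≤-trans (≤-reflexive (sym (cong₂ _+_ (vanishes-zero f za) (vanishes-zero f zb)))) (sumF-terms (vanishes f) a≢b)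

      #zero≥Q : ∀ {m} {f : V (suc m) → K} {c} → (∀ y → y ≢ c → Zero (f ↾ y)) → Q ≤ #zero f
      #zero≥Q {f = f} {c} z = ≤-trans (≤-reflexive (sym (trans (sumF-const-≡ (λ j → vanishes-zero f (z (punchIn c j) (punchInᵢ≢i c j)))) (*-identityʳ Q))))
        (≤-trans (m≤n+m _ (vanishes f c)) (≤-reflexive (sym (sumF-punch (vanishes f) c))))

      #zero≥q : ∀ {m} {f : V (suc m) → K} → (∀ y → Zero (f ↾ y)) → q ≤ #zero f
      #zero≥q {f = f} z = ≤-reflexive (sym (trans (sumF-const-≡ (λ a → vanishes-zero f (z a))) (*-identityʳ q)))

      #zero≡0 : ∀ {m} {f : V (suc m) → K} → #zero f ≡ 0 → ∀ a → ¬ Zero (f ↾ a)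
      #zero≡0 {f = f} e a z = n≮n 0 (≤-trans (#zero≥1 {f = f} z) (≤-reflexive e))

      slice-exact : ∀ {m} (f : V (suc m) → K) {B} → (∀ a → ¬ Zero (f ↾ a) → B ≤ wt (f ↾ a)) →
                    wt f ≤ #nonzero f * B → ∀ {c} → ¬ Zero (f ↾ c) → wt (f ↾ c) ≡ B
      slice-exact f {B} b e {c} nc = ≤-antisym
        (+-cancelʳ-≤ (#nonzero f * B) _ _ (≤-trans (slice-bound-at f b nc) (≤-trans (+-monoˡ-≤ B e) (≤-reflexive (+-comm _ B)))))
        (b c nc)

      -- The vanishing slices in the list `e` are divided out one at a time. The scalar `κ` collects
      -- the values a - e i, which are nonzero as long as a is none of the slices divided out.
      pol-peel : ∀ {m d} {f : V (suc m) → K} → Pol d f → ∀ n (e : Fin n → K) → (∀ {i j} → e i ≡ e j → i ≡ j) →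
                 ∃ λ g → Pol (d ∸ sumF (vanishes f ∘ e)) g ×
                   (∀ a → (∀ i → Zero (f ↾ e i) → e i ≢ a) → ∃ λ κ → κ ≢ 𝟘 × (∀ x → f (a ∷ x) ≡ κ ⊗ g (a ∷ x)))
      pol-peel {f = f} p zero e inj = f , p , λ a _ → 𝟙 , 𝟙≢𝟘 , λ x → sym (R.*-identityˡ _)
      pol-peel {d = d} {f} p (suc n) e inj with pol-peel p n (e ∘ suc) (λ eq → sucF-injective (inj eq)) | zero? (f ↾ e zero)
      ... | g , pg , fg | no n₀ = g , pg , λ a av → fg a (λ i → av (suc i))
      -- Injectivity of `e` keeps the earlier factors nonzero at `e zero`; so `g` still vanishes
      -- there and the remainder drops out.
      ... | g , pg , fg | yes z with pol-divide pg (e zero) | fg (e zero) (λ i _ eq → case inj eq of λ ())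
      ... | g′ , pg′ , gg′ | κ₀ , κ₀≢0 , fκ₀ = g′
        , subst (λ s → Pol s g′) (trans (∸-+-assoc d (sumF (vanishes f ∘ e ∘ suc)) 1) (cong (d ∸_) (+-comm (sumF (vanishes f ∘ e ∘ suc)) 1))) pg′
        , λ a av → let (κ , κ≢0 , fκ) = fg a (λ i → av (suc i)) in
            κ ⊗ (a ⊖ e zero) , ⊗-nonzero κ≢0 (⊖-nonzero (λ eq → av zero z (sym eq)))
            , λ x → trans (fκ x) (trans (cong (κ ⊗_) (trans (gg′ a x)
                (trans (cong ((a ⊖ e zero) ⊗ g′ (a ∷ x) ⊹_) (⊗-cancel-zero κ₀≢0 (trans (sym (fκ₀ x)) (z x)))) (R.+-identityʳ _))))
                (sym (R.*-assoc κ _ _)))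

    abstract
      pol-quotient : ∀ {m d} {f : V (suc m) → K} → Pol d f →
        ∃ λ g → Pol (d ∸ #zero f) g × (∀ a → ¬ Zero (f ↾ a) → ∃ λ κ → κ ≢ 𝟘 × (∀ x → f (a ∷ x) ≡ κ ⊗ g (a ∷ x)))
      pol-quotient p with pol-peel p q id id
      ... | g , pg , fg = g , pg , λ a na → fg a (λ { i z refl → na z })

    pol-slice-∸ : ∀ {m d} {f : V (suc m) → K} → Pol d f → ∀ a → Pol (d ∸ #zero f) (f ↾ a)
    pol-slice-∸ {f = f} p a with zero? (f ↾ a) | pol-quotient p
    ... | yes z | _ = zeroP z
    ... | no n  | g , pg , fg with fg a n
    ... | κ , _ , e = pol-ext e (pol-scale κ (pol-slice a pg))

    -- With `d` or more vanishing slices the quotient would have degree bound 0, and all other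
    -- slices would vanish too.
    slice-degree-nonneg : ∀ {m d} {f : V (suc m) → K} → Pol d f → ¬ Zero f → #zero f < d
    slice-degree-nonneg {d = d} {f} p nf with d ≤? #zero f | nonzero-slice nf
    ... | no ≰  | _ = ≰⇒> ≰
    ... | yes le | a , na = ⊥-elim (na (pol-0 (subst (λ s → Pol s (f ↾ a)) (m≤n⇒m∸n≡0 le) (pol-slice-∸ p a))))

    degree-low-codim : ∀ d κ j Z t₀ → κ + Z ≡ q → Z ≤ d → d + (κ + j) ≤ suc (suc t₀) * Q + 2 → d ∸ Z + suc j ≤ suc t₀ * Q + 2
    degree-low-codim d κ j Z t₀ κ+Z Z≤d h with slack Z≤d
    ... | e , refl = lin h 0 (trans (cong (λ w → w + suc j + (suc (suc t₀) * Q + 2) + 0) (m+n∸m≡n Z e))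
            (trans (eq₁ e j t₀ Q) (trans (cong (λ w → suc t₀ * Q + 2 + e + j + w) (sym κ+Z)) (eq₂ e j t₀ κ Z Q))))
      where
      eq₁ : ∀ e j t₀ Q → e + suc j + (suc (suc t₀) * Q + 2) + 0 ≡ suc t₀ * Q + 2 + e + j + suc Q
      eq₁ = solve-∀
      eq₂ : ∀ e j t₀ κ Z Q → suc t₀ * Q + 2 + e + j + (κ + Z) ≡ suc t₀ * Q + 2 + (Z + e + (κ + j))
      eq₂ = solve-∀

    degree-low-dim : ∀ d k Z D → Z ≤ d → d + k ≤ D → d ∸ Z + (k + Z) ≤ D
    degree-low-dim d k Z D Z≤d h = subst (_≤ D) (sym (trans (sym (+-assoc (d ∸ Z) k Z))
      (trans (cong (_+ Z) (+-comm (d ∸ Z) k)) (trans (+-assoc k _ Z) (trans (cong (k +_) (m∸n+n≡m Z≤d)) (+-comm k d)))))) h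

    abstract
      -- The degree is at most q - k, and at least q - k slices vanish. A nonzero word has no more
      -- vanishing slices than its degree, so both numbers equal q - k and the quotient is constant.
      constant-slices : ∀ {m d} (f : V (suc m) → K) k → Pol d f → d + k ≤ 1 * Q + 2 → #nonzero f ≤ k → ¬ Zero f →
                        #nonzero f ≡ k × (∀ a → ¬ Zero (f ↾ a) → ∃ λ c → c ≢ 𝟘 × (∀ x → f (a ∷ x) ≡ c))
      constant-slices {d = d} f k p h κ≤k nf with slack κ≤k
      ... | j , refl = trans (sym (+-identityʳ _)) (cong (#nonzero f +_) (sym j≡0)) , full
        where
        d≤ : d + j ≤ suc (#zero f)
        d≤ = lin h 0 (trans (eq₁ d j Q) (trans (cong (d + j + 1 +_) (sym (#nonzero+#zero f))) (eq₂ d j (#nonzero f) (#zero f))))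
          where
          eq₁ : ∀ d j Q → d + j + (1 * Q + 2) + 0 ≡ d + j + 1 + suc Q
          eq₁ = solve-∀
          eq₂ : ∀ d j κ Z → d + j + 1 + (κ + Z) ≡ suc Z + (d + (κ + j))
          eq₂ = solve-∀
        j≡0 : j ≡ 0
        j≡0 = n≤0⇒n≡0 (+-cancelˡ-≤ (suc (#zero f)) j 0
          (≤-trans (+-monoˡ-≤ j (slice-degree-nonneg p nf)) (≤-trans d≤ (≤-reflexive (sym (+-identityʳ _))))))
        full : ∀ a → ¬ Zero (f ↾ a) → ∃ λ c → c ≢ 𝟘 × (∀ x → f (a ∷ x) ≡ c)
        full a na with pol-1 (pol-weaken (m≤n+o⇒m∸n≤o d (#zero f) (≤-trans (m≤m+n d j) (≤-trans d≤ (≤-reflexive (+-comm 1 _))))) (pol-slice-∸ p a))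
        ... | c , e = c , (λ c≡0 → na (λ x → trans (e x) c≡0)) , e

      -- The minimum weight of a polynomial of degree t(q − 1) + s is (q − s) q^(m − t − 1); here k = q − s.
      minimum-weight : ∀ m t n → m ≡ t + n → (f : V (suc m) → K) → ∀ {d} k → Pol d f →
                       d + k ≤ suc t * Q + 2 → k ≤ q → ¬ Zero f → k * q ^ n ≤ wt f
      minimum-weight m t n m≡ f {d} k p h k≤q nf with #nonzero f ≤? k
      minimum-weight m t n m≡ f {d} k p h k≤q nf | yes κ≤k with slack κ≤k
      minimum-weight m zero n refl f {d} k p h k≤q nf | yes κ≤k | j , _ with constant-slices f k p h κ≤k nf
      ... | κ≡k , const = ≤-trans (≤-reflexive (cong (_* q ^ n) (sym κ≡k)))
        (slice-bound f (λ a na → let (c , c≢0 , e) = const a na in ≤-reflexive (sym (wt-const c≢0 e))))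
      -- At most k nonzero slices, k = K + j: t drops by one, each nonzero slice weighs at least (j
      -- + 1)q^n, and K(j + 1) ≥ K + j.
      minimum-weight m (suc t₀) n refl f {d} k p h k≤q nf | yes κ≤k | j , refl =
        ≤-trans (≤-trans (*-monoˡ-≤ (q ^ n) (κ+j≤ (#nonzero f) j (#nonzero-pos nf))) (≤-reflexive (*-assoc (#nonzero f) (suc j) _)))
                (slice-bound f (λ a na → minimum-weight (t₀ + n) t₀ n refl (f ↾ a) (suc j) (pol-slice-∸ p a)
                  (degree-low-codim d (#nonzero f) j (#zero f) t₀ (#nonzero+#zero f) (<⇒≤ (slice-degree-nonneg p nf)) h)
                  (≤-trans (+-monoˡ-≤ j (#nonzero-pos nf)) k≤q) na))
        where
        κ+j≤ : ∀ κ j → 1 ≤ κ → κ + j ≤ κ * suc j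
        κ+j≤ (suc κ) j (s≤s z≤n) = le (κ * j) (eq κ j)
          where
          eq : ∀ κ j → suc κ + j + κ * j ≡ suc κ * suc j
          eq = solve-∀
      minimum-weight m t zero m≡ f {d} k p h k≤q nf | no κ≰k =
        ≤-trans (≤-reflexive (*-identityʳ k)) (≤-trans (<⇒≤ (≰⇒> κ≰k))
          (subst (_≤ wt f) (*-identityʳ _) (slice-bound f (λ a na → wt-pos na))))
      minimum-weight zero t (suc n) m≡ f k p h k≤q nf | no κ≰k with () ← trans m≡ (+-suc t n)
      -- More than k nonzero slices: t stays and the dimension drops, while the Z factors divided
      -- out raise k to k + Z. For K = k + i, K(k + Z) exceeds kq by iZ.
      minimum-weight (suc m) t (suc n) m≡ f {d} k p h k≤q nf | no κ≰k with slack (<⇒≤ (≰⇒> κ≰k))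
      ... | i , κ≡ = ≤-trans (≤-trans (≤-reflexive (cong (λ w → k * (w * q ^ n)) (sym κ+Z)))
                       (≤-trans (le (i * #zero f * q ^ n) (eq k i (#zero f) (q ^ n))) (≤-reflexive (cong (_* ((k + #zero f) * q ^ n)) (sym κ≡)))))
        (slice-bound f (λ a na → minimum-weight m t n (suc-injective (trans m≡ (+-suc t n))) (f ↾ a) (k + #zero f) (pol-slice-∸ p a)
           (degree-low-dim d k (#zero f) _ (<⇒≤ (slice-degree-nonneg p nf)) h) (subst (k + #zero f ≤_) κ+Z (+-monoˡ-≤ (#zero f) (m≤m+n k i))) na))
        where
        κ+Z : k + i + #zero f ≡ q
        κ+Z = trans (cong (_+ #zero f) (sym κ≡)) (#nonzero+#zero f)
        eq : ∀ k i Z U → k * ((k + i + Z) * U) + i * Z * U ≡ (k + i) * ((k + Z) * U)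
        eq = solve-∀

  open Weights

  -- Affine bijections and pencils of hyperplanes

  module AffineMaps where

    record Iso (m : ℕ) : Set where
      field
        to from : V m → V m
        affine  : IsAffine to
        to-from : ∀ x → to (from x) ≡ x
        from-to : ∀ x → from (to x) ≡ x

    open Iso

    id-iso : ∀ {m} → Iso m
    id-iso = record { to = id ; from = id ; affine = λ _ _ _ _ → refl ; to-from = λ _ → refl ; from-to = λ _ → refl }

    _∘I_ : ∀ {m} → Iso m → Iso m → Iso m
    φ ∘I ψ = record
      { to = to φ ∘ to ψ ; from = from ψ ∘ from φ
      ; affine = λ s x y z → trans (cong (to φ) (affine ψ s x y z)) (affine φ s _ _ _)
      ; to-from = λ x → trans (cong (to φ) (to-from ψ _)) (to-from φ x)
      ; from-to = λ x → trans (cong (from ψ) (from-to φ _)) (from-to ψ x)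
      }

    ext-iso : ∀ {m} → Iso m → Iso (suc m)
    ext-iso ψ = record
      { to = λ { (y ∷ x) → y ∷ to ψ x } ; from = λ { (y ∷ x) → y ∷ from ψ x }
      ; affine = λ { s (_ ∷ x) (_ ∷ y) (_ ∷ z) → cong (_ ∷_) (affine ψ s x y z) }
      ; to-from = λ { (y ∷ x) → cong (y ∷_) (to-from ψ x) }
      ; from-to = λ { (y ∷ x) → cong (y ∷_) (from-to ψ x) }
      }

    -- The slices of f ∘ to (pencil-iso a l) at c, for varying l, are the hyperplanes z = c + l (y − a) of the pencil through y = a, z = c.
    pencil-iso : ∀ {m} → K → K → Iso (suc (suc m))
    pencil-iso a l = record
      { to = λ { (u ∷ y ∷ x) → y ∷ u ⊹ l ⊗ (y ⊖ a) ∷ x } ; from = λ { (y ∷ z ∷ x) → z ⊖ l ⊗ (y ⊖ a) ∷ y ∷ x }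
      ; affine = λ { s (u ∷ y ∷ x) (u′ ∷ y′ ∷ x′) (u″ ∷ y″ ∷ x″) → cong (λ w → cmb s y y′ y″ ∷ w ∷ cmbV s x x′ x″)
          (solve 9 (λ s u y u′ y′ u″ y″ l a → (u :+ s :* (u′ :- u″)) :+ l :* ((y :+ s :* (y′ :- y″)) :- a)
              := (u :+ l :* (y :- a)) :+ s :* ((u′ :+ l :* (y′ :- a)) :- (u″ :+ l :* (y″ :- a)))) refl s u y u′ y′ u″ y″ l a) }
      ; to-from = λ { (y ∷ z ∷ x) → cong (λ w → y ∷ w ∷ x) (solve 2 (λ z w → (z :- w) :+ w := z) refl z (l ⊗ (y ⊖ a))) }
      ; from-to = λ { (u ∷ y ∷ x) → cong (λ w → w ∷ y ∷ x) (solve 2 (λ z w → (z :+ w) :- w := z) refl u (l ⊗ (y ⊖ a))) }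
      }

    shift : ∀ {m} → K → V m → V m → V m
    shift s []       []       = []
    shift s (w ∷ ws) (x ∷ xs) = x ⊹ s ⊗ w ∷ shift s ws xs

    shift-cmbV : ∀ {m} s a y₁ y₂ y₃ (w x₁ x₂ x₃ : V m) →
      shift (cmb s y₁ y₂ y₃ ⊖ a) w (cmbV s x₁ x₂ x₃) ≡ cmbV s (shift (y₁ ⊖ a) w x₁) (shift (y₂ ⊖ a) w x₂) (shift (y₃ ⊖ a) w x₃)
    shift-cmbV s a y₁ y₂ y₃ []       []         []         []         = refl
    shift-cmbV s a y₁ y₂ y₃ (w ∷ ws) (x₁ ∷ xs₁) (x₂ ∷ xs₂) (x₃ ∷ xs₃) = cong₂ _∷_
      (solve 9 (λ s y₁ y₂ y₃ a w x₁ x₂ x₃ → (x₁ :+ s :* (x₂ :- x₃)) :+ ((y₁ :+ s :* (y₂ :- y₃)) :- a) :* w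
          := (x₁ :+ (y₁ :- a) :* w) :+ s :* ((x₂ :+ (y₂ :- a) :* w) :- (x₃ :+ (y₃ :- a) :* w))) refl s y₁ y₂ y₃ a w x₁ x₂ x₃)
      (shift-cmbV s a y₁ y₂ y₃ ws xs₁ xs₂ xs₃)

    shift-inverseʳ : ∀ {m} s (w x : V m) → shift s w (shift (⊝ s) w x) ≡ x
    shift-inverseʳ s []       []       = refl
    shift-inverseʳ s (w ∷ ws) (x ∷ xs) = cong₂ _∷_ (solve 3 (λ s w x → (x :+ (:- s) :* w) :+ s :* w := x) refl s w x) (shift-inverseʳ s ws xs)

    shift-inverseˡ : ∀ {m} s (w x : V m) → shift (⊝ s) w (shift s w x) ≡ x
    shift-inverseˡ s []       []       = refl
    shift-inverseˡ s (w ∷ ws) (x ∷ xs) = cong₂ _∷_ (solve 3 (λ s w x → (x :+ s :* w) :+ (:- s) :* w := x) refl s w x) (shift-inverseˡ s ws xs)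

    shift-zero : ∀ {m} s (w x : V m) → s ≡ 𝟘 → shift s w x ≡ x
    shift-zero s []       []       e = refl
    shift-zero s (w ∷ ws) (x ∷ xs) e = cong₂ _∷_ (trans (cong (x ⊹_) (trans (cong (_⊗ w) e) (R.zeroˡ w))) (R.+-identityʳ x)) (shift-zero s ws xs e)

    connect : ∀ {m} → K → V m → V m → V m
    connect s []       []       = []
    connect s (x ∷ xs) (y ∷ ys) = s ⁻¹ ⊗ (y ⊖ x) ∷ connect s xs ys

    shift-connect : ∀ {m} s → s ≢ 𝟘 → (x y : V m) → shift s (connect s x y) x ≡ y
    shift-connect s s≢0 []       []       = refl
    shift-connect s s≢0 (x ∷ xs) (y ∷ ys) = cong₂ _∷_
      (trans (solve 4 (λ s i x y → x :+ s :* (i :* (y :- x)) := x :+ (s :* i) :* (y :- x)) refl s (s ⁻¹) x y)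
        (trans (cong (λ u → x ⊹ u ⊗ (y ⊖ x)) (⁻¹-inverse s s≢0))
          (trans (cong (x ⊹_) (R.*-identityˡ _)) (solve 2 (λ x y → x :+ (y :- x) := y) refl x y))))
      (shift-connect s s≢0 xs ys)

    -- Fixes the hyperplane y = a pointwise and translates the slice at y by (y - a)w. With `w` from
    -- `connect`, one other slice can be translated by any prescribed vector.
    shear-iso : ∀ {m} → K → V m → Iso (suc m)
    shear-iso a w = record
      { to = λ { (y ∷ x) → y ∷ shift (y ⊖ a) w x } ; from = λ { (y ∷ x) → y ∷ shift (⊝ (y ⊖ a)) w x }
      ; affine = λ { s (y₁ ∷ x₁) (y₂ ∷ x₂) (y₃ ∷ x₃) → cong (_ ∷_) (shift-cmbV s a y₁ y₂ y₃ w x₁ x₂ x₃) }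
      ; to-from = λ { (y ∷ x) → cong (y ∷_) (shift-inverseʳ (y ⊖ a) w x) }
      ; from-to = λ { (y ∷ x) → cong (y ∷_) (shift-inverseˡ (y ⊖ a) w x) }
      }

    wt-iso : ∀ {m} (φ : Iso m) (f : V m → K) → wt (f ∘ to φ) ≡ wt f
    wt-iso φ f = wt-reindex (to φ) (from φ) (to-from φ) (from-to φ) f

    Zero-iso : ∀ {m} (φ : Iso m) {f : V m → K} → Zero (f ∘ to φ) → Zero f
    Zero-iso φ {f} z x = trans (cong f (sym (to-from φ x))) (z (from φ x))

    InHyperplane : ∀ {m} → (V (suc m) → K) → Set
    InHyperplane {m} f = ∃ λ (φ : Iso (suc m)) → ∃ λ c → ∀ y → y ≢ c → Zero ((f ∘ to φ) ↾ y)

    inHyperplane-iso : ∀ {m} {f : V (suc m) → K} (φ : Iso (suc m)) → InHyperplane (f ∘ to φ) → InHyperplane f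
    inHyperplane-iso φ (ψ , c , z) = φ ∘I ψ , c , z

    inHyperplane-zero : ∀ {m} {f : V (suc m) → K} → Zero f → InHyperplane f
    inHyperplane-zero z = id-iso , 𝟘 , λ y _ x → z _

    inHyperplane-#nonzero : ∀ {m} {f : V (suc m) → K} → ¬ Zero f → #nonzero f ≡ 1 → InHyperplane f
    inHyperplane-#nonzero nf e with nonzero-slice nf
    ... | c , nc = id-iso , c , #nonzero≡1 e nc

    wt-single : ∀ {m} {f : V (suc m) → K} {c} → (∀ y → y ≢ c → Zero (f ↾ y)) → wt f ≡ wt (f ↾ c)
    wt-single {f = f} {c} z = trans (trans (wt-suc f) (sumF-punch (λ a → wt (f ↾ a)) c))
      (trans (cong (wt (f ↾ c) +_) (trans (sumF-const-≡ {c = 0} (λ j → Zero⇒wt≡0 (z _ (punchInᵢ≢i c j)))) (*-zeroʳ Q))) (+-identityʳ _))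

    line : ∀ {m} → (V (suc (suc m)) → K) → K → K → K → K → V m → K
    line f a c l y x = f (y ∷ c ⊹ l ⊗ (y ⊖ a) ∷ x)

    line-base : ∀ {m} (f : V (suc (suc m)) → K) a c l x → line f a c l a x ≡ f (a ∷ c ∷ x)
    line-base f a c l x = cong (λ z → f (a ∷ z ∷ x)) (solve 3 (λ a c l → c :+ l :* (a :- a) := c) refl a c l)

    abstract
      -- Through the subspace y = c₁, z = c₂ and the further point passes either y = c₁ itself or
      -- the member of the pencil with slope (z - c₂)/(y - c₁).
      join-point : ∀ {m} (f : V (suc (suc m)) → K) c₁ c₂ {y z x} → f (y ∷ z ∷ x) ≢ 𝟘 → ¬ (y ≡ c₁ × z ≡ c₂) →
                   ∃ λ φ → ∃ λ c → suc (wt (λ x → f (c₁ ∷ c₂ ∷ x))) ≤ wt ((f ∘ to φ) ↾ c)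
      join-point f c₁ c₂ {y} {z} {x} fp ¬L with y ≟F c₁
      ... | yes refl = id-iso , c₁ , ≤-trans (≤-trans (≤-reflexive (+-comm 1 _)) (+-monoʳ-≤ _ (wt-point {f = λ x → f (c₁ ∷ z ∷ x)} fp)))
                       (≤-trans (sumF-terms (λ a → wt (λ x → f (c₁ ∷ a ∷ x))) (λ c₂≡z → ¬L (refl , sym c₂≡z))) (≤-reflexive (sym (wt-suc (f ↾ c₁)))))
      ... | no y≢c₁ = pencil-iso c₁ l , c₂ , ≤-trans
        (≤-trans (≤-reflexive (trans (+-comm 1 _) (cong (_+ 1) (sym (wt-cong (line-base f c₁ c₂ l))))))
                 (+-monoʳ-≤ (wt (line f c₁ c₂ l c₁)) (wt-point {f = line f c₁ c₂ l y} (λ e → fp (trans (cong (λ w → f (y ∷ w ∷ x)) (sym z≡)) e)))))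
        (≤-trans (sumF-terms (λ y → wt (line f c₁ c₂ l y)) (λ c₁≡y → y≢c₁ (sym c₁≡y))) (≤-reflexive (sym (wt-suc ((f ∘ to (pencil-iso c₁ l)) ↾ c₂)))))
        where
        l : K
        l = (y ⊖ c₁) ⁻¹ ⊗ (z ⊖ c₂)
        z≡ : c₂ ⊹ l ⊗ (y ⊖ c₁) ≡ z
        z≡ = trans (solve 4 (λ c i z d → c :+ (i :* (z :- c)) :* d := c :+ (d :* i) :* (z :- c)) refl c₂ ((y ⊖ c₁) ⁻¹) z (y ⊖ c₁))
          (trans (cong (λ u → c₂ ⊹ u ⊗ (z ⊖ c₂)) (⁻¹-inverse (y ⊖ c₁) (⊖-nonzero y≢c₁)))
            (trans (cong (c₂ ⊹_) (R.*-identityˡ _)) (solve 2 (λ x y → x :+ (y :- x) := y) refl c₂ z)))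

      join-slice : ∀ {m} {f : V (suc (suc m)) → K} {a} → InHyperplane (f ↾ a) → ∀ {b} → b ≢ a → ¬ Zero (f ↾ b) →
                   ∃ λ φ → ∃ λ c → suc (wt (f ↾ a)) ≤ wt ((f ∘ to φ) ↾ c)
      join-slice {f = f} {a} (ψ , c₂ , z) {b} b≢a nb with nonzero-point (λ zb → nb (Zero-iso ψ {f ↾ b} zb))
      ... | (z₀ ∷ x₀) , fp with join-point (f ∘ to (ext-iso ψ)) a c₂ {b} {z₀} {x₀} fp (λ { (e , _) → b≢a e })
      ... | φ , c , le′ = ext-iso ψ ∘I φ , c , ≤-trans (s≤s (≤-reflexive (trans (sym (wt-iso ψ (f ↾ a))) (wt-single {f = (f ↾ a) ∘ to ψ} z)))) le′

      other-slice : ∀ {m} {f : V (suc m) → K} a → (∀ y → y ≢ a → Zero (f ↾ y)) ⊎ (∃ λ b → b ≢ a × ¬ Zero (f ↾ b))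
      other-slice {f = f} a with any? (λ b → ¬? (zero? (f ↾ b)) ×-dec ¬? (b ≟F a))
      ... | yes (b , nb , b≢a) = inj₂ (b , b≢a , nb)
      ... | no none = inj₁ (λ y y≢a → case zero? (f ↾ y) of λ { (yes z) → z ; (no n) → ⊥-elim (none (y , n , y≢a)) })

      -- Each of the q + 1 hyperplanes through the subspace y = a, z = c contains it, and together
      -- they partition its complement. The member y = a has no slope and enters as a separate term.
      pencil-sum : ∀ {m} (f : V (suc (suc m)) → K) a c →
        sumF (λ l → wt ((f ∘ to (pencil-iso a l)) ↾ c)) + wt (f ↾ a) ≡ q * wt (λ x → f (a ∷ c ∷ x)) + wt f
      pencil-sum f a c = begin
        sumF (λ l → wt ((f ∘ to (pencil-iso a l)) ↾ c)) + wt (f ↾ a)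
          ≡⟨ cong (_+ wt (f ↾ a)) (sumF-cong (λ l → wt-suc ((f ∘ to (pencil-iso a l)) ↾ c))) ⟩
        sumF (λ l → sumF (λ y → wt (line f a c l y))) + wt (f ↾ a)
          ≡⟨ cong (_+ wt (f ↾ a)) (swapF sumF-additive (λ l y → wt (line f a c l y))) ⟩
        sumF (λ y → sumF (λ l → wt (line f a c l y))) + wt (f ↾ a)
          ≡⟨ cong (_+ wt (f ↾ a)) (sumF-punch (λ y → sumF (λ l → wt (line f a c l y))) a) ⟩
        sumF (λ l → wt (line f a c l a)) + sumF (λ j → sumF (λ l → wt (line f a c l (punchIn a j)))) + wt (f ↾ a)
          ≡⟨ cong₂ (λ u v → u + v + wt (f ↾ a))
               (sumF-const-≡ (λ l → wt-cong (line-base f a c l)))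
               -- For y ≠ a the map from l to c + l(y - a) is a bijection of the field.
               (sumF-cong (λ j → trans (FiniteSum.S-reindex finSum (λ l → c ⊹ l ⊗ (punchIn a j ⊖ a)) (λ z → (punchIn a j ⊖ a) ⁻¹ ⊗ (z ⊖ c))
                  (λ z → trans (to-from′ c z ((punchIn a j ⊖ a) ⁻¹) (punchIn a j ⊖ a)) (unit j z))
                  (λ l → trans (from-to′ c l ((punchIn a j ⊖ a) ⁻¹) (punchIn a j ⊖ a)) (unit′ j l))
                  (λ z → wt (λ x → f (punchIn a j ∷ z ∷ x)))) (sym (wt-suc (f ↾ punchIn a j))))) ⟩
        q * wt (λ x → f (a ∷ c ∷ x)) + sumF (λ j → wt (f ↾ punchIn a j)) + wt (f ↾ a)
          ≡⟨ trans (+-assoc (q * wt (λ x → f (a ∷ c ∷ x))) _ _) (cong (q * wt (λ x → f (a ∷ c ∷ x)) +_) (trans (+-comm _ (wt (f ↾ a))) (trans (sym (sumF-punch (λ y → wt (f ↾ y)) a)) (sym (wt-suc f))))) ⟩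
        q * wt (λ x → f (a ∷ c ∷ x)) + wt f ∎
        where
        open ≡-Reasoning
        inverse : ∀ j → (punchIn a j ⊖ a) ⊗ (punchIn a j ⊖ a) ⁻¹ ≡ 𝟙
        inverse j = ⁻¹-inverse _ (⊖-nonzero (punchInᵢ≢i a j))
        to-from′ : ∀ c z i d → c ⊹ (i ⊗ (z ⊖ c)) ⊗ d ≡ c ⊹ (d ⊗ i) ⊗ (z ⊖ c)
        to-from′ = solve 4 (λ c z i d → c :+ (i :* (z :- c)) :* d := c :+ (d :* i) :* (z :- c)) refl
        from-to′ : ∀ c l i d → i ⊗ ((c ⊹ l ⊗ d) ⊖ c) ≡ (d ⊗ i) ⊗ l
        from-to′ = solve 4 (λ c l i d → i :* ((c :+ l :* d) :- c) := (d :* i) :* l) refl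
        unit : ∀ j z → c ⊹ ((punchIn a j ⊖ a) ⊗ (punchIn a j ⊖ a) ⁻¹) ⊗ (z ⊖ c) ≡ z
        unit j z = trans (cong (λ u → c ⊹ u ⊗ (z ⊖ c)) (inverse j))
          (trans (cong (c ⊹_) (R.*-identityˡ _)) (solve 2 (λ x y → x :+ (y :- x) := y) refl c z))
        unit′ : ∀ j l → ((punchIn a j ⊖ a) ⊗ (punchIn a j ⊖ a) ⁻¹) ⊗ l ≡ l
        unit′ j l = trans (cong (_⊗ l) (inverse j)) (R.*-identityˡ l)

      pencil-max : ∀ {m} (f : V (suc (suc m)) → K) a c →
        ∃ λ l → q * wt (λ x → f (a ∷ c ∷ x)) + wt f ≤ q * wt ((f ∘ to (pencil-iso a l)) ↾ c) + wt (f ↾ a)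
      pencil-max f a c with sumF-pigeonhole (λ l → wt ((f ∘ to (pencil-iso a l)) ↾ c))
      ... | l , le′ = l , ≤-trans (≤-reflexive (sym (pencil-sum f a c))) (+-monoˡ-≤ (wt (f ↾ a)) le′)

  open AffineMaps
  open Iso

  -- Words of minimum weight

  module MinimalWords where

    q^-pos : ∀ n → 1 ≤ q ^ n
    q^-pos zero    = ≤-refl
    q^-pos (suc n) = ≤-trans (q^-pos n) (m≤m+n _ _)

    codim-slices : ∀ {m t₀ n d} → m ≡ t₀ + n → (f : V (suc (suc m)) → K) → ∀ j → Pol d f →
                   d + (#nonzero f + j) ≤ suc (suc t₀) * Q + 2 → #nonzero f + j ≤ q → ¬ Zero f →
                   ∀ a → ¬ Zero (f ↾ a) → suc j * q ^ n ≤ wt (f ↾ a)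
    codim-slices {m} {t₀} {n} {d} e f j p h k≤q nf a na = minimum-weight m t₀ n e (f ↾ a) (suc j) (pol-slice-∸ p a)
      (degree-low-codim d (#nonzero f) j (#zero f) t₀ (#nonzero+#zero f) (<⇒≤ (slice-degree-nonneg p nf)) h)
      (≤-trans (+-monoˡ-≤ j (#nonzero-pos nf)) k≤q) na

    dim-slices : ∀ {m t n d} → suc m ≡ t + suc n → (f : V (suc (suc m)) → K) → ∀ k → Pol d f →
                 d + k ≤ suc t * Q + 2 → k ≤ #nonzero f → ¬ Zero f → ∀ a → ¬ Zero (f ↾ a) → (k + #zero f) * q ^ n ≤ wt (f ↾ a)
    dim-slices {m} {t} {n} {d} e f k p h k≤κ nf a na = minimum-weight m t n (suc-injective (trans e (+-suc t n))) (f ↾ a) (k + #zero f)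
      (pol-slice-∸ p a) (degree-low-dim d k (#zero f) _ (<⇒≤ (slice-degree-nonneg p nf)) h)
      (≤-trans (+-monoˡ-≤ (#zero f) k≤κ) (≤-reflexive (#nonzero+#zero f))) na

    -- K slices of weight at least (k + Z)q^n exceed k q^(n+1) = k(K + Z)q^n by (K - k)Z q^n. This
    -- forces Z = 0 and equality on every slice.
    no-zero-slices : ∀ {m t n d} → suc m ≡ t + suc n → (f : V (suc (suc m)) → K) → ∀ k → Pol d f →
                     d + k ≤ suc t * Q + 2 → wt f ≡ k * q ^ suc n → k < #nonzero f → ¬ Zero f →
                     #zero f ≡ 0 × (∀ a → ¬ Zero (f ↾ a) → wt (f ↾ a) ≡ k * q ^ n)
    no-zero-slices {m} {t} {n} e f k p h wf k<κ nf = Z≡0 , λ a na → trans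
      (slice-exact f (dim-slices e f k p h (<⇒≤ k<κ) nf) exact na)
      (cong (_* q ^ n) (trans (cong (k +_) Z≡0) (+-identityʳ k)))
      where
      U : ℕ
      U = q ^ n
      bound : #nonzero f * ((k + #zero f) * U) ≤ k * (q * U)
      bound = ≤-trans (slice-bound f (dim-slices e f k p h (<⇒≤ k<κ) nf)) (≤-reflexive wf)
      Z≤0 : ∀ κ Z → k < κ → κ + Z ≡ q → κ * ((k + Z) * U) ≤ k * (q * U) → Z ≡ 0
      Z≤0 κ Z k<κ κ+Z b with slack k<κ
      ... | i , refl = n≤0⇒n≡0 (≤-trans (m≤m*n Z U {{>-nonZero (q^-pos n)}})
              (lin (subst (λ w → (suc k + i) * ((k + Z) * U) ≤ k * (w * U)) (sym κ+Z) b) (i * Z * U) (eq k i Z U)))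
        where
        eq : ∀ k i Z U → Z * U + k * ((suc k + i + Z) * U) + i * Z * U ≡ 0 + (suc k + i) * ((k + Z) * U)
        eq = solve-∀
      Z≡0 : #zero f ≡ 0
      Z≡0 = Z≤0 (#nonzero f) (#zero f) k<κ (#nonzero+#zero f) bound
      κ≡q : #nonzero f ≡ q
      κ≡q = trans (sym (+-identityʳ _)) (trans (cong (#nonzero f +_) (sym Z≡0)) (#nonzero+#zero f))
      exact : wt f ≤ #nonzero f * ((k + #zero f) * U)
      exact = ≤-reflexive (trans wf (trans (eq k q U) (sym (cong₂ (λ u v → u * ((k + v) * U)) κ≡q Z≡0))))
        where
        eq : ∀ k q U → k * (q * U) ≡ q * ((k + 0) * U)
        eq = solve-∀

    pol-iso : ∀ {m d} {f : V m → K} (φ : Iso m) → Pol d f → Pol d (f ∘ to φ)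
    pol-iso φ = pol-pull (affine φ)

    single-point : ∀ {m} {f : V (suc m) → K} → wt f ≡ 1 → InHyperplane f
    single-point {f = f} w with nonzero-slice {f = f} (wt-nonzero (≤-reflexive (sym w)))
    ... | a , na = id-iso , a , λ y y≢a → wt≡0⇒Zero (n≤0⇒n≡0 (+-cancelˡ-≤ 1 _ 0
      (≤-trans (+-monoˡ-≤ _ (wt-pos na)) (≤-trans (sumF-terms (λ b → wt (f ↾ b)) (λ a≡y → y≢a (sym a≡y))) (≤-reflexive (trans (sym (wt-suc f)) w))))))

    nonzero-of-wt : ∀ {m} {f : V m → K} {k n} → 1 ≤ k → wt f ≡ k * q ^ n → ¬ Zero f
    nonzero-of-wt {k = k} {n} 1≤k w = wt-nonzero (≤-trans (≤-trans (q^-pos n) (≤-trans (≤-reflexive (sym (*-identityˡ _))) (*-monoˡ-≤ (q ^ n) 1≤k))) (≤-reflexive (sym w)))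

    data MinimalProfile {m : ℕ} (n k : ℕ) (f : V (suc m) → K) : Set where
      one-slice  : #nonzero f ≡ 1 → MinimalProfile n k f
      k-slices   : #nonzero f ≡ k → (∀ a → ¬ Zero (f ↾ a) → wt (f ↾ a) ≡ q ^ n) → MinimalProfile n k f
      all-slices : ∀ {n′} → n ≡ suc n′ → #zero f ≡ 0 → (∀ a → ¬ Zero (f ↾ a) → wt (f ↾ a) ≡ k * q ^ n′) → MinimalProfile n k f

    abstract
      -- For k = K + j the slices give K(j + 1) ≤ K + j, that is (K - 1)j ≤ 0, so K is 1 or k. For K
      -- > k no slice vanishes, by `no-zero-slices`.
      minimal-profile : ∀ n t₀ m → m ≡ t₀ + n → (f : V (suc (suc m)) → K) → ∀ {d} k → Pol d f →
                        d + k ≤ suc (suc t₀) * Q + 2 → 1 ≤ k → k ≤ q → wt f ≡ k * q ^ n → MinimalProfile n k f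
      minimal-profile n t₀ m e f {d} k p h 1≤k k≤q wf with #nonzero f ≤? k
      ... | yes κ≤k with slack κ≤k
      ... | j , refl = choose j (#nonzero f) refl refl
        where
        nf : ¬ Zero f
        nf = nonzero-of-wt {f = f} {n = n} 1≤k wf
        low : ∀ a → ¬ Zero (f ↾ a) → suc j * q ^ n ≤ wt (f ↾ a)
        low = codim-slices {t₀ = t₀} {n = n} e f j p h k≤q nf
        choose : ∀ i κ → i ≡ j → κ ≡ #nonzero f → MinimalProfile n k f
        choose zero κ refl refl = k-slices (sym (+-identityʳ _)) (λ a na → trans (slice-exact f low
          (≤-reflexive (trans wf (trans (cong (_* q ^ n) (+-identityʳ (#nonzero f))) (cong (#nonzero f *_) (sym (*-identityˡ (q ^ n))))))) na) (*-identityˡ _))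
        choose (suc i) κ refl κ≡ = one-slice (trans (sym κ≡) (κ≡1 κ (subst (1 ≤_) (sym κ≡) (#nonzero-pos nf))
          (subst (λ w → w * (suc (suc i) * q ^ n) ≤ (w + suc i) * q ^ n) (sym κ≡) (≤-trans (slice-bound f low) (≤-reflexive wf)))))
          where
          κ≡1 : ∀ κ → 1 ≤ κ → κ * (suc (suc i) * q ^ n) ≤ (κ + suc i) * q ^ n → κ ≡ 1
          κ≡1 (suc zero) _ _ = refl
          κ≡1 (suc (suc κ)) _ b = absurd-≤ (*-cancelʳ-≤ _ _ (q ^ n) {{>-nonZero (q^-pos n)}} (subst (_≤ (suc (suc κ) + suc i) * q ^ n) (sym (*-assoc (suc (suc κ)) (suc (suc i)) (q ^ n))) b))
            (κ + i + κ * i) (eq κ i)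
            where
            eq : ∀ κ i → suc (suc κ) + suc i + suc (κ + i + κ * i) ≡ suc (suc κ) * suc (suc i)
            eq = solve-∀
      minimal-profile zero t₀ m e f {d} k p h 1≤k k≤q wf | no κ≰k = ⊥-elim (κ≰k
        (≤-trans (subst (_≤ wt f) (*-identityʳ _) (slice-bound f (λ a na → wt-pos na))) (≤-reflexive (trans wf (*-identityʳ k)))))
      minimal-profile (suc n) t₀ m e f {d} k p h 1≤k k≤q wf | no κ≰k
        with no-zero-slices {t = suc t₀} {n} (cong suc e) f k p h wf (≰⇒> κ≰k) (nonzero-of-wt {f = f} {n = suc n} 1≤k wf)
      ... | Z≡0 , slices = all-slices refl Z≡0 slices

      -- By induction a nonzero slice lies in a subspace of codimension 2; joined to a further point
      -- it gives a class with a strictly heavier slice. Slices weigh k q^(n-1) ≤ q^n if K = q and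
      -- q^n if K = k, so two joins at most lead to K = 1.
      minimal-in-hyperplane : ∀ n t₀ m → m ≡ t₀ + n → (f : V (suc (suc m)) → K) → ∀ {d} k → Pol d f →
                              d + k ≤ suc (suc t₀) * Q + 2 → 2 ≤ k → k ≤ q → wt f ≡ k * q ^ n → InHyperplane f

      minimal-in-hyperplane-suc : ∀ n t₀ m → m ≡ t₀ + suc n → (f : V (suc m) → K) → ∀ {d} k → Pol d f →
                                  d + k ≤ suc (suc t₀) * Q + 2 → 2 ≤ k → k ≤ q → wt f ≡ k * q ^ n → InHyperplane f
      minimal-in-hyperplane-suc n t₀ zero    e with () ← trans e (+-suc t₀ n)
      minimal-in-hyperplane-suc n t₀ (suc m) e = minimal-in-hyperplane n t₀ m (suc-injective (trans e (+-suc t₀ n)))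

      -- The weight q^n is k q^(n-1) with k = q, which brings it under the induction on n; for n = 0
      -- the support is a point.
      flat-in-hyperplane : ∀ n t₀ m → m ≡ t₀ + n → (f : V (suc m) → K) → ∀ {d} → Pol d f →
                           d + q ≤ suc (suc t₀) * Q + 2 → wt f ≡ q ^ n → InHyperplane f
      flat-in-hyperplane zero    t₀ m e f p h wf = single-point wf
      flat-in-hyperplane (suc n) t₀ m e f p h wf = minimal-in-hyperplane-suc n t₀ m e f q p h (s≤s (≤-trans (n≤1+n 1) 2≤Q)) ≤-refl wf

      minimal-in-hyperplane n t₀ m e f {d} k p h 2≤k k≤q wf = any-profile f p wf (profile f p wf)
        where
        1≤k : 1 ≤ k
        1≤k = ≤-trans (n≤1+n 1) 2≤k
        profile : ∀ (g : V (suc (suc m)) → K) → Pol d g → wt g ≡ k * q ^ n → MinimalProfile n k g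
        profile g pg = minimal-profile n t₀ m e g k pg h 1≤k k≤q
        nonzero : ∀ (g : V (suc (suc m)) → K) → wt g ≡ k * q ^ n → ¬ Zero g
        nonzero g = nonzero-of-wt {f = g} {n = n} 1≤k

        heavy : ∀ (g : V (suc (suc m)) → K) → wt g ≡ k * q ^ n → MinimalProfile n k g → ∀ c → suc (q ^ n) ≤ wt (g ↾ c) → InHyperplane g
        heavy g wg (one-slice κ≡1) c big = inHyperplane-#nonzero (nonzero g wg) κ≡1
        heavy g wg (k-slices _ s) c big = ⊥-elim (n≮n (q ^ n) (≤-trans big (≤-reflexive (s c (wt-nonzero (≤-trans (s≤s z≤n) big))))))
        heavy g wg (all-slices {n′} refl _ s) c big = ⊥-elim (n≮n (q ^ n)
          (≤-trans big (≤-trans (≤-reflexive (s c (wt-nonzero (≤-trans (s≤s z≤n) big)))) (*-monoˡ-≤ (q ^ n′) k≤q))))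

        -- Joining the hyperplane of a slice to a further point of the support gives a hyperplane with strictly more points.
        join : ∀ (g : V (suc (suc m)) → K) c → InHyperplane (g ↾ c) →
               (∀ (φ : Iso (suc (suc m))) c′ → suc (wt (g ↾ c)) ≤ wt ((g ∘ to φ) ↾ c′) → InHyperplane (g ∘ to φ)) → InHyperplane g
        join g c hc next with other-slice {f = g} c
        ... | inj₁ z = id-iso , c , z
        ... | inj₂ (b , b≢c , nb) with join-slice {f = g} hc b≢c nb
        ... | φ , c′ , big = inHyperplane-iso {f = g} φ (next φ c′ big)

        k-profile : ∀ (g : V (suc (suc m)) → K) → Pol d g → wt g ≡ k * q ^ n → #nonzero g ≡ k → (∀ a → ¬ Zero (g ↾ a) → wt (g ↾ a) ≡ q ^ n) → InHyperplane g
        k-profile g pg wg κ≡k s with nonzero-slice (nonzero g wg)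
        ... | c , nc = join g c
          (flat-in-hyperplane n t₀ m e (g ↾ c) (pol-slice-∸ pg c)
            (subst (λ w → d ∸ #zero g + w ≤ suc (suc t₀) * Q + 2) (trans (cong (_+ #zero g) (sym κ≡k)) (#nonzero+#zero g))
              (degree-low-dim d k (#zero g) _ (<⇒≤ (slice-degree-nonneg pg (nonzero g wg))) h))
            (s c nc))
          (λ φ c′ big → heavy (g ∘ to φ) (trans (wt-iso φ g) wg) (profile _ (pol-iso φ pg) (trans (wt-iso φ g) wg)) c′
            (≤-trans (s≤s (≤-reflexive (sym (s c nc)))) big))

        any-profile : ∀ (g : V (suc (suc m)) → K) → Pol d g → wt g ≡ k * q ^ n → MinimalProfile n k g → InHyperplane g
        any-profile g pg wg (one-slice κ≡1) = inHyperplane-#nonzero (nonzero g wg) κ≡1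
        any-profile g pg wg (k-slices κ≡k s) = k-profile g pg wg κ≡k s
        any-profile g pg wg (all-slices {n′} refl Z≡0 s) with nonzero-slice (nonzero g wg)
        ... | c , nc = join g c (minimal-in-hyperplane-suc n′ t₀ m e (g ↾ c) k (pol-slice c pg) h 2≤k k≤q (s c nc)) next
          where
          next : ∀ (φ : Iso (suc (suc m))) c′ → suc (wt (g ↾ c)) ≤ wt ((g ∘ to φ) ↾ c′) → InHyperplane (g ∘ to φ)
          next φ c′ big with profile (g ∘ to φ) (pol-iso φ pg) (trans (wt-iso φ g) wg)
          ... | one-slice κ≡1 = inHyperplane-#nonzero (nonzero (g ∘ to φ) (trans (wt-iso φ g) wg)) κ≡1
          ... | k-slices κ≡k s′ = k-profile (g ∘ to φ) (pol-iso φ pg) (trans (wt-iso φ g) wg) κ≡k s′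
          ... | all-slices refl _ s′ = ⊥-elim (n≮n _ (≤-trans big
                  (≤-reflexive (trans (s′ c′ (wt-nonzero (≤-trans (s≤s z≤n) big))) (sym (s c nc))))))

    ParallelConstant : ∀ {n} → ℕ → (V (suc n) → K) → Set
    ParallelConstant k f = #nonzero f ≡ k × (∀ a → ¬ Zero (f ↾ a) → ∃ λ c → c ≢ 𝟘 × (∀ x → f (a ∷ x) ≡ c))

    abstract
      -- If more than k slices are nonzero, all weigh k q^(n-1), and by induction one of them
      -- contains a subspace L of codimension 2 on which f is a nonzero constant. If the class of
      -- the heaviest sloped hyperplane through L were of the same kind, the pencil count would give
      -- q ≤ k. So that class has at most k nonzero slices, and f is constant on each.
      minimal-parallel : ∀ n (f : V (suc n) → K) {d} k → Pol d f → d + k ≤ 1 * Q + 2 → 1 ≤ k → k ≤ Q → wt f ≡ k * q ^ n →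
                         ∃ λ (φ : Iso (suc n)) → ParallelConstant k (f ∘ to φ)
      minimal-parallel n f {d} k p h 1≤k k≤Q wf = analyse (#nonzero f ≤? k)
        where
        nonzero : ∀ (g : V (suc n) → K) → wt g ≡ k * q ^ n → ¬ Zero g
        nonzero g = nonzero-of-wt {f = g} {n = n} 1≤k

        low : ∀ (g : V (suc n) → K) → Pol d g → wt g ≡ k * q ^ n → #nonzero g ≤ k → ParallelConstant k g
        low g pg wg κ≤k = constant-slices g k pg h κ≤k (nonzero g wg)

        high : ∀ {n′} (n≡ : n ≡ suc n′) → k < #nonzero f → ∃ λ (φ : Iso (suc n)) → ParallelConstant k (f ∘ to φ)
        high {n′} refl κ>k = step (nonzero-slice (nonzero f wf))
          where
          slices : ∀ (g : V (suc n) → K) → Pol d g → wt g ≡ k * q ^ n → k < #nonzero g → ∀ a → ¬ Zero (g ↾ a) → wt (g ↾ a) ≡ k * q ^ n′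
          slices g pg wg k<κ = proj₂ (no-zero-slices {t = 0} {n′} refl g k pg h wg k<κ (nonzero g wg))

          module _ (a c l : K) (ψ : Iso n) (na : ¬ Zero (f ↾ a)) {v} (v≢0 : v ≢ 𝟘) (ev : ∀ x → f (a ∷ to ψ (c ∷ x)) ≡ v) where
            f₁ g : V (suc n) → K
            f₁ = f ∘ to (ext-iso ψ)
            g  = f₁ ∘ to (pencil-iso a l)
            pg : Pol d g
            pg = pol-iso (pencil-iso a l) (pol-iso (ext-iso ψ) p)
            wf₁ : wt f₁ ≡ k * q ^ n
            wf₁ = trans (wt-iso (ext-iso ψ) f) wf
            wg : wt g ≡ k * q ^ n
            wg = trans (wt-iso (pencil-iso a l) f₁) wf₁
            wa : wt (f₁ ↾ a) ≡ k * q ^ n′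
            wa = trans (wt-iso ψ (f ↾ a)) (slices f p wf κ>k a na)
            light : k < #nonzero g → Dec (Zero (g ↾ c)) → wt (g ↾ c) ≤ k * q ^ n′
            light _   (yes z) = ≤-trans (≤-reflexive (Zero⇒wt≡0 z)) z≤n
            light k<κ (no nz) = ≤-reflexive (slices g pg wg k<κ c nz)
            eq : ∀ q k U → q * U + (q * (k * U) + k * U) + 0 ≡ k * U + (q * U + k * (q * U))
            eq = solve-∀
            finish : q * wt (λ x → f₁ (a ∷ c ∷ x)) + wt f₁ ≤ q * wt (g ↾ c) + wt (f₁ ↾ a) → Dec (#nonzero g ≤ k) →
                     ∃ λ (φ : Iso (suc n)) → ParallelConstant k (f ∘ to φ)
            finish big (yes κ≤k) = ext-iso ψ ∘I pencil-iso a l , low g pg wg κ≤k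
            finish big (no κ≰k)  = ⊥-elim (n≮n k (≤-trans (s≤s k≤Q) (*-cancelʳ-≤ q k (q ^ n′) {{>-nonZero (q^-pos n′)}}
              (lin {q * q ^ n′ + k * (q * q ^ n′)} {q * (k * q ^ n′) + k * q ^ n′}
                (subst₂ _≤_ (cong₂ (λ u w → q * u + w) (wt-const v≢0 ev) wf₁) refl
                  (≤-trans big (+-mono-≤ (*-monoʳ-≤ q (light (≰⇒> κ≰k) (zero? (g ↾ c)))) (≤-reflexive wa)))) 0 (eq q k (q ^ n′))))))

          step₂ : ∀ a → ¬ Zero (f ↾ a) → (ψ : Iso n) → ParallelConstant k ((f ↾ a) ∘ to ψ) → ∃ λ (φ : Iso (suc n)) → ParallelConstant k (f ∘ to φ)
          step₂ a na ψ (_ , const) with nonzero-slice {f = (f ↾ a) ∘ to ψ} (λ z → na (Zero-iso ψ z))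
          ... | c , nc with const c nc | pencil-max (f ∘ to (ext-iso ψ)) a c
          ... | v , v≢0 , ev | l , big = finish a c l ψ na v≢0 ev big (#nonzero (g a c l ψ na v≢0 ev) ≤? k)

          step : (∃ λ a → ¬ Zero (f ↾ a)) → ∃ λ (φ : Iso (suc n)) → ParallelConstant k (f ∘ to φ)
          step (a , na) with minimal-parallel n′ (f ↾ a) k (pol-slice a p) h 1≤k k≤Q (slices f p wf κ>k a na)
          ... | ψ , pc = step₂ a na ψ pc

        positive-dimension : ∀ n′ → n ≡ n′ → k < #nonzero f → ∃ λ (φ : Iso (suc n)) → ParallelConstant k (f ∘ to φ)
        positive-dimension zero    refl k<κ = ⊥-elim (n≮n k (≤-trans k<κ
          (≤-trans (subst (_≤ wt f) (*-identityʳ _) (slice-bound f (λ a na → wt-pos na))) (≤-reflexive (trans wf (*-identityʳ k))))))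
        positive-dimension (suc n′) e k<κ = high e k<κ

        analyse : Dec (#nonzero f ≤ k) → ∃ λ (φ : Iso (suc n)) → ParallelConstant k (f ∘ to φ)
        analyse (yes κ≤k) = id-iso , low f p wf κ≤k
        analyse (no κ≰k)  = positive-dimension n refl (≰⇒> κ≰k)

  open MinimalWords

  -- Slice counts up to the second weight, and light slices

  module Pencils where

    private
      class-arithmetic : ∀ κ Z → κ + Z ≡ suc Q → 1 ≤ κ → κ * suc Z ≤ 2 * Q → κ ≡ 1 ⊎ κ ≡ 2 ⊎ (Z ≡ 1 × 3 ≤ κ) ⊎ Z ≡ 0
      class-arithmetic 1 Z e _ b = inj₁ refl
      class-arithmetic 2 Z e _ b = inj₂ (inj₁ refl)
      class-arithmetic (suc (suc (suc i))) 0 e _ b = inj₂ (inj₂ (inj₂ refl))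
      class-arithmetic (suc (suc (suc i))) 1 e _ b = inj₂ (inj₂ (inj₁ (refl , s≤s (s≤s (s≤s z≤n)))))
      class-arithmetic (suc (suc (suc i))) (suc (suc j)) e _ b = absurd-≤ (subst (λ w → (3 + i) * (3 + j) ≤ 2 * w) (suc-injective (sym e)) b)
        (i + j + i * j) (eq i j)
        where
        eq : ∀ i j → 2 * (suc (suc i) + suc (suc j)) + suc (i + j + i * j) ≡ (3 + i) * (3 + j)
        eq = solve-∀

    -- `U` is q^n, and K is 1, 2, q - 1 or q. For 2 and q - 1 the lower bound on the slices is
    -- attained, which fixes their weights; `3 ≤ Q` keeps q - 1 apart from 2.
    data Profile {m : ℕ} (U : ℕ) (f : V (suc m) → K) : Set where
      one        : #nonzero f ≡ 1 → Profile U f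
      two        : #nonzero f ≡ 2 → (∀ a → ¬ Zero (f ↾ a) → wt (f ↾ a) ≡ Q * U) → Profile U f
      all-but-one : #zero f ≡ 1 → 3 ≤ Q → (∀ a → ¬ Zero (f ↾ a) → wt (f ↾ a) ≡ 2 * U) → wt f ≡ 2 * Q * U → Profile U f
      all        : #zero f ≡ 0 → Profile U f

    abstract
      main-slices : ∀ {m} t₀ n → m ≡ t₀ + n → (f : V (suc (suc m)) → K) → Pol (suc (suc t₀ * Q)) f → ¬ Zero f →
                    ∀ a → ¬ Zero (f ↾ a) → suc (#zero f) * q ^ n ≤ wt (f ↾ a)
      main-slices {m} t₀ n e f p nf = codim-slices {t₀ = t₀} {n} e f (#zero f) p
        (≤-reflexive (trans (cong (suc (suc t₀ * Q) +_) (#nonzero+#zero f)) (eq t₀ Q))) (≤-reflexive (#nonzero+#zero f)) nf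
        where
        eq : ∀ t₀ Q → suc (suc t₀ * Q) + suc Q ≡ suc (suc t₀) * Q + 2
        eq = solve-∀

      profile : ∀ {m} t₀ n → m ≡ t₀ + n → (f : V (suc (suc m)) → K) → Pol (suc (suc t₀ * Q)) f → ¬ Zero f →
                wt f ≤ 2 * Q * q ^ n → Profile (q ^ n) f
      profile t₀ n e f p nf σ≤ with class-arithmetic (#nonzero f) (#zero f) (#nonzero+#zero f) (#nonzero-pos nf)
          (*-cancelʳ-≤ _ _ (q ^ n) {{>-nonZero (q^-pos n)}} (≤-trans (≤-reflexive (*-assoc (#nonzero f) _ _)) (≤-trans (slice-bound f (main-slices t₀ n e f p nf)) σ≤)))
      ... | inj₁ κ≡1 = one κ≡1
      ... | inj₂ (inj₁ κ≡2) = two κ≡2 (λ a na → trans (slice-exact f (main-slices t₀ n e f p nf) (≤-trans σ≤ (≤-reflexive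
              (trans (eq Q (q ^ n)) (sym (cong₂ (λ u v → u * (v * q ^ n)) κ≡2 sZ≡Q))))) na) (cong (_* q ^ n) sZ≡Q))
        where
        sZ≡Q : suc (#zero f) ≡ Q
        sZ≡Q = suc-injective (trans (cong (_+ #zero f) (sym κ≡2)) (#nonzero+#zero f))
        eq : ∀ Q U → 2 * Q * U ≡ 2 * (Q * U)
        eq = solve-∀
      ... | inj₂ (inj₂ (inj₁ (Z≡1 , 3≤κ))) = all-but-one Z≡1 (subst (3 ≤_) κ≡Q 3≤κ)
          (λ a na → trans (slice-exact f (main-slices t₀ n e f p nf) (≤-trans σ≤ σ=) na) (cong (λ w → suc w * q ^ n) Z≡1))
          (≤-antisym σ≤ (≤-trans (≤-reflexive (trans (eq Q (q ^ n)) (sym (cong₂ (λ u v → u * (suc v * q ^ n)) κ≡Q Z≡1)))) (slice-bound f (main-slices t₀ n e f p nf))))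
        where
        κ≡Q : #nonzero f ≡ Q
        κ≡Q = suc-injective (trans (+-comm 1 _) (trans (cong (#nonzero f +_) (sym Z≡1)) (#nonzero+#zero f)))
        eq : ∀ Q U → 2 * Q * U ≡ Q * (2 * U)
        eq = solve-∀
        σ= : 2 * Q * q ^ n ≤ #nonzero f * (suc (#zero f) * q ^ n)
        σ= = ≤-reflexive (trans (eq Q (q ^ n)) (sym (cong₂ (λ u v → u * (suc v * q ^ n)) κ≡Q Z≡1)))
      ... | inj₂ (inj₂ (inj₂ Z≡0)) = all Z≡0

    -- The conclusions Res that the pencil argument can reach.
    record Closed (t₀ n m : ℕ) (Res : (V (suc (suc m)) → K) → Set) : Set where
      field
        res-iso : ∀ {f} (φ : Iso (suc (suc m))) → Res (f ∘ to φ) → Res f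
        res-one : ∀ {f} → Pol (suc (suc t₀ * Q)) f → ¬ Zero f → #nonzero f ≡ 1 → Res f
        res-two : ∀ {f} → Pol (suc (suc t₀ * Q)) f → wt f ≤ 2 * Q * q ^ n → #nonzero f ≡ 2 →
                  (∀ a → ¬ Zero (f ↾ a) → wt (f ↾ a) ≡ Q * q ^ n) → Res f
        res-cross : ∀ {f a c} → Pol (suc (suc t₀ * Q)) f → wt f ≤ 2 * Q * q ^ n → a ≢ c → (∀ y → y ≢ c → ∀ x → f (y ∷ x) ≡ f (a ∷ x)) →
                    wt (f ↾ a) ≡ q ^ n → wt (f ↾ c) ≡ Q * q ^ n → Res f

    -- The classification applied to a slice, whose space has one dimension less and second weight
    -- 2Q q^(n-1). The factor q avoids the exponent n - 1, as n may be 0.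
    Gap : ℕ → ℕ → ℕ → Set
    Gap t₀ n m = (h : V (suc m) → K) → Pol (suc (suc t₀ * Q)) h → wt h ≡ 0 ⊎ wt h ≡ q ^ n ⊎ 2 * Q * q ^ n ≤ q * wt h

    private
      -- `κ` and `Z` count the slices of the difference `g′` in the shear argument. With Q = κ + Z -
      -- 1 the bound becomes (κ - 1)(Z - 2) ≤ 0.
      cross-arithmetic : ∀ κ Z → κ + Z ≡ suc Q → 1 ≤ κ → 2 ≤ Z → Z + κ * Z ≤ 2 * Q → κ ≡ 1 ⊎ (Z ≡ 2 × 2 ≤ κ)
      cross-arithmetic 1 Z e _ _ b = inj₁ refl
      cross-arithmetic (suc (suc i)) 2 e _ _ b = inj₂ (refl , s≤s (s≤s z≤n))
      cross-arithmetic (suc (suc i)) (suc (suc (suc j))) e _ _ b = absurd-≤ (subst (λ w → 3 + j + (2 + i) * (3 + j) ≤ 2 * w) (suc-injective (sym e)) b)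
        (i + j + i * j) (eq i j)
        where
        eq : ∀ i j → 2 * (suc i + suc (suc (suc j))) + suc (i + j + i * j) ≡ 3 + j + (2 + i) * (3 + j)
        eq = solve-∀
      cross-arithmetic (suc (suc i)) 1 e _ (s≤s ()) b

    private
      -- The last two bounds give N ≤ 2U. The second also gives σ ≥ N + 2(Q - 1)U; inserted into the
      -- first this leaves (3Q - 2)U ≤ QN ≤ 2QU, which fails for Q ≥ 3.
      two-zeros-impossible : ∀ Q U N σ → 1 ≤ U → 3 ≤ Q → Q * U + σ ≤ suc Q * N → N + 2 * Q * U ≤ σ + 2 * U → σ ≤ 2 * Q * U → ⊥
      two-zeros-impossible (suc (suc (suc Q))) (suc U) N σ _ (s≤s (s≤s (s≤s z≤n))) h₁ h₂ h₃ = absurd-≤ (+-mono-≤ (+-mono-≤ h₁ h₂) (*-monoʳ-≤ (3 + Q) N≤)) (Q + U + Q * U) (eq Q U N σ)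
        where
        N≤ : N ≤ 2 * suc U
        N≤ = lin (+-mono-≤ h₂ h₃) 0 (eq₁ (3 + Q) (suc U) N σ)
          where
          eq₁ : ∀ Q U N σ → N + (σ + 2 * U + 2 * Q * U) + 0 ≡ 2 * U + (N + 2 * Q * U + σ)
          eq₁ = solve-∀
        eq : ∀ Q U N σ → suc (3 + Q) * N + (σ + 2 * suc U) + (3 + Q) * (2 * suc U) + suc (Q + U + Q * U) ≡
                         (3 + Q) * suc U + σ + (N + 2 * (3 + Q) * suc U) + (3 + Q) * N
        eq = solve-∀

    module PencilArgument (t₀ n m : ℕ) (e : m ≡ t₀ + n) (gap : Gap t₀ n m) {Res : (V (suc (suc m)) → K) → Set} (closed : Closed t₀ n m Res) where
      open Closed closed

      U : ℕ
      U = q ^ n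

      Degree : (V (suc (suc m)) → K) → Set
      Degree = Pol (suc (suc t₀ * Q))

      module TwoLightSlices {f : V (suc (suc m)) → K} (p : Degree f) (nf : ¬ Zero f) (σ≤ : wt f ≤ 2 * Q * U) (Z≡0 : #zero f ≡ 0)
                            {a₁ a₂ c : K} (a₁≢a₂ : a₁ ≢ a₂) (light₁ : wt (f ↾ a₁) ≡ U) (light₂ : wt (f ↾ a₂) ≡ U)
                            (heavy : Q * U + wt f ≤ q * wt (f ↾ c)) where
        x₁ x₂ w : V (suc m)
        x₁ = proj₁ (nonzero-point (#zero≡0 Z≡0 a₁))
        x₂ = proj₁ (nonzero-point (#zero≡0 Z≡0 a₂))
        -- After the shear along `w` both light slices are nonzero at `x₁`. This overlap makes their
        -- difference lighter than 2U.
        w = connect (a₂ ⊖ a₁) x₁ x₂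

        g : V (suc (suc m)) → K
        g = f ∘ to (shear-iso a₁ w)

        pg : Degree g
        pg = pol-iso (shear-iso a₁ w) p

        wg : ∀ b → wt (g ↾ b) ≡ wt (f ↾ b)
        wg b = wt-reindex (shift (b ⊖ a₁) w) (shift (⊝ (b ⊖ a₁)) w) (shift-inverseʳ (b ⊖ a₁) w) (shift-inverseˡ (b ⊖ a₁) w) (f ↾ b)

        abstract
          g-a₁ : g (a₁ ∷ x₁) ≢ 𝟘
          g-a₁ z = proj₂ (nonzero-point (#zero≡0 Z≡0 a₁)) (trans (cong (λ x → f (a₁ ∷ x)) (sym (shift-zero (a₁ ⊖ a₁) w x₁ (⊖-self a₁)))) z)

          g-a₂ : g (a₂ ∷ x₁) ≢ 𝟘
          g-a₂ z = proj₂ (nonzero-point (#zero≡0 Z≡0 a₂)) (trans (cong (λ x → f (a₂ ∷ x))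
            (sym (shift-connect (a₂ ⊖ a₁) (⊖-nonzero (λ e → a₁≢a₂ (sym e))) x₁ x₂))) z)

          -- The difference of the two light slices has lower degree, hence is too light to be nonzero.
          slices-agree : ∀ x → g (a₂ ∷ x) ≡ g (a₁ ∷ x)
          slices-agree = agree (pol-divide pg a₁)
            where
            d : V (suc m) → K
            d x = g (a₂ ∷ x) ⊖ g (a₁ ∷ x)
            d-light : suc (wt d) ≤ U + U
            d-light = ≤-trans (wt-sub-overlap (g ↾ a₂) (g ↾ a₁) g-a₂ g-a₁) (≤-reflexive (cong₂ _+_ (trans (wg a₂) light₂) (trans (wg a₁) light₁)))
            d-heavy : Pol (suc t₀ * Q) d → ¬ Zero d → 2 * U ≤ wt d
            d-heavy pd = minimum-weight m t₀ n e d 2 pd ≤-refl (s≤s (≤-trans (n≤1+n 1) 2≤Q))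
            agree : (∃ λ h → Pol (suc t₀ * Q) h × (∀ y x → g (y ∷ x) ≡ (y ⊖ a₁) ⊗ h (y ∷ x) ⊹ g (a₁ ∷ x))) → ∀ x → g (a₂ ∷ x) ≡ g (a₁ ∷ x)
            agree (h , ph , eh) x with zero? d
            ... | yes z = ⊖-zero (z x)
            ... | no nz = ⊥-elim (n≮n (U + U) (≤-trans (s≤s (≤-trans (≤-reflexive (cong (U +_) (sym (+-identityʳ U)))) (d-heavy pd nz))) d-light))
              where
              pd : Pol (suc t₀ * Q) d
              pd = pol-ext (λ x → trans (cong (_⊖ g (a₁ ∷ x)) (eh a₂ x)) (solve 2 (λ u v → (u :+ v) :- v := u) refl ((a₂ ⊖ a₁) ⊗ h (a₂ ∷ x)) (g (a₁ ∷ x))))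
                (pol-scale (a₂ ⊖ a₁) (pol-slice a₂ ph))

        -- Subtracts from every slice the same light slice, so that the vanishing slices of `g′` are
        -- the copies of it in `g`. Each slice of `f` then weighs at least U or ZU, and the total
        -- leaves one slice that is no copy, or exactly two copies; the heavy slice excludes the
        -- latter.
        g′ : V (suc (suc m)) → K
        g′ v = g v ⊖ g (a₁ ∷ tail v)

        abstract
          result : Res f
          result = res-iso (shear-iso a₁ w) (conclude (cross-arithmetic (#nonzero g′) (#zero g′) (#nonzero+#zero g′) (#nonzero-pos ng′)
              (#zero≥2 {f = g′} a₁≢a₂ (λ x → ⊖-self _) z₂) (*-cancelʳ-≤ _ _ U {{>-nonZero (q^-pos n)}} sum≤)))
            where
            pg′ : Degree g′
            pg′ = pol-sub pg (pol-pull {φ = λ v → a₁ ∷ tail v} (λ { s (_ ∷ x) (_ ∷ y) (_ ∷ z) → cons-affine a₁ s x y z }) pg)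
            z₂ : Zero (g′ ↾ a₂)
            z₂ x = trans (cong (_⊖ g (a₁ ∷ x)) (slices-agree x)) (⊖-self _)
            σ≥ : q * U ≤ wt f
            σ≥ = ≤-trans (≤-reflexive (cong₂ _*_ (sym κ≡q) (sym (+-identityʳ U)))) (slice-bound f (λ a na →
                   ≤-trans (*-monoˡ-≤ U (s≤s (z≤n {#zero f}))) (main-slices t₀ n e f p nf a na)))
              where
              κ≡q : #nonzero f ≡ q
              κ≡q = trans (sym (+-identityʳ _)) (trans (cong (#nonzero f +_) (sym Z≡0)) (#nonzero+#zero f))
            nc : ¬ Zero (g′ ↾ c)
            nc z = absurd-≤ (≤-trans (+-monoʳ-≤ (Q * U) σ≥) (≤-trans heavy (≤-reflexive (cong (q *_) (trans (sym (wg c)) (trans same (trans (wg a₁) light₁)))))))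
                     (Q * U ∸ 1) (trans (+-comm (q * U) _) (cong (_+ q * U) (m+[n∸m]≡n {1} (≤-trans (q^-pos n) (m≤n*m U Q {{>-nonZero (≤-trans (n≤1+n 1) 2≤Q)}})))))
              where
              same : wt (g ↾ c) ≡ wt (g ↾ a₁)
              same = wt-cong (λ x → ⊖-zero (z x))
            ng′ : ¬ Zero g′
            ng′ z = nc (λ x → z (c ∷ x))
            lo : ∀ a → Zero (g′ ↾ a) → U ≤ wt (f ↾ a)
            lo a z = ≤-reflexive (sym (trans (sym (wg a)) (trans (wt-cong (λ x → ⊖-zero (z x))) (trans (wg a₁) light₁))))
            -- A nonzero slice of `g′` weighs at least (Z + 1)U, of which the subtracted light slice
            -- accounts for at most U.
            hi : ∀ a → ¬ Zero (g′ ↾ a) → #zero g′ * U ≤ wt (f ↾ a)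
            hi a na = +-cancelˡ-≤ U _ _ (≤-trans (main-slices t₀ n e g′ pg′ ng′ a na)
              (≤-trans (wt-sub (g ↾ a) (g ↾ a₁)) (≤-reflexive (trans (cong₂ _+_ (wg a) (trans (wg a₁) light₁)) (+-comm _ U)))))
            at-c : wt (f ↾ c) + (#zero g′ * U + #nonzero g′ * (#zero g′ * U)) ≤ wt f + #zero g′ * U
            at-c = ≤-trans (two-sided-bound g′ (λ a → wt (f ↾ a)) lo hi nc) (≤-reflexive (cong (_+ #zero g′ * U) (sym (wt-suc f))))
            sum≤ : (#zero g′ + #nonzero g′ * #zero g′) * U ≤ 2 * Q * U
            sum≤ = ≤-trans (lin (≤-trans (+-monoˡ-≤ _ (hi c nc)) at-c) 0 (eq (#zero g′) (#nonzero g′) U (wt f))) σ≤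
              where
              eq : ∀ Z κ U σ → (Z + κ * Z) * U + (σ + Z * U) + 0 ≡ σ + (Z * U + (Z * U + κ * (Z * U)))
              eq = solve-∀
            conclude : #nonzero g′ ≡ 1 ⊎ (#zero g′ ≡ 2 × 2 ≤ #nonzero g′) → Res g
            conclude (inj₁ κ≡1) = res-cross pg (≤-trans (≤-reflexive (wt-iso (shear-iso a₁ w) f)) σ≤)
                (λ { refl → nc (λ x → ⊖-self _) }) (λ y y≢c x → ⊖-zero (#nonzero≡1 κ≡1 nc y y≢c x))
                (trans (wg a₁) light₁) (trans (wg c) (≤-antisym (lin at-c′ 0 (eq Q U (wt (f ↾ c)))) (≤-trans (≤-reflexive (cong (_* U) (sym Z≡Q))) (hi c nc))))
              where
              Z≡Q : #zero g′ ≡ Q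
              Z≡Q = suc-injective (trans (cong (_+ #zero g′) (sym κ≡1)) (#nonzero+#zero g′))
              at-c′ : wt (f ↾ c) + (Q * U + 1 * (Q * U)) ≤ 2 * Q * U + Q * U
              at-c′ = ≤-trans (subst₂ (λ κ Z → wt (f ↾ c) + (Z * U + κ * (Z * U)) ≤ wt f + Z * U) κ≡1 Z≡Q at-c) (+-monoˡ-≤ (Q * U) σ≤)
              eq : ∀ Q U N → N + (2 * Q * U + Q * U) + 0 ≡ Q * U + (N + (Q * U + 1 * (Q * U)))
              eq = solve-∀
            conclude (inj₂ (Z≡2 , 2≤κ)) = ⊥-elim (two-zeros-impossible Q U (wt (f ↾ c)) (wt f) (q^-pos n)
              (subst (3 ≤_) κ+1≡Q (s≤s 2≤κ)) heavy
              (≤-trans (≤-reflexive (trans (cong (λ w → wt (f ↾ c) + 2 * w * U) (sym κ+1≡Q)) (eq (wt (f ↾ c)) (#nonzero g′) U)))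
                (subst (λ Z → wt (f ↾ c) + (Z * U + #nonzero g′ * (Z * U)) ≤ wt f + Z * U) Z≡2 at-c)) σ≤)
              where
              κ+1≡Q : suc (#nonzero g′) ≡ Q
              κ+1≡Q = suc-injective (trans (+-comm 2 _) (trans (cong (#nonzero g′ +_) (sym Z≡2)) (#nonzero+#zero g′)))
              eq : ∀ N κ U → N + 2 * suc κ * U ≡ N + (2 * U + κ * (2 * U))
              eq = solve-∀

      abstract
        U≤QU : U ≤ Q * U
        U≤QU = m≤n*m U Q {{>-nonZero (≤-trans (n≤1+n 1) 2≤Q)}}

        -- s corrects the lower bound 2 Q U for q times the weight of a slice at the light slices.
        few-light-impossible : ∀ {f : V (suc (suc m)) → K} {c} → wt f ≤ 2 * Q * U → Q * U + wt f ≤ q * wt (f ↾ c) →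
                               ∀ s → (∀ b → 2 * Q * U ≤ q * wt (f ↾ b) + s b) → sumF s + U ≤ Q * U → ⊥
        few-light-impossible {f} {c} σ≤ heavy s lower s≤ = absurd-≤ (+-mono-≤ (+-mono-≤ (+-mono-≤ heavy total) s≤) (*-monoʳ-≤ Q σ≤)) (U ∸ 1)
          (trans (cong (q * wt (f ↾ c) + (q * wt f + sumF s) + Q * U + Q * (2 * Q * U) +_) (m+[n∸m]≡n (q^-pos n))) (eq Q U (q * wt (f ↾ c)) (wt f) (sumF s)))
          where
          h : K → ℕ
          h b = q * wt (f ↾ b) + s b
          total : q * wt (f ↾ c) + Q * (2 * Q * U) ≤ q * wt f + sumF s
          total = begin
            q * wt (f ↾ c) + Q * (2 * Q * U)
              ≤⟨ +-mono-≤ (m≤m+n _ (s c)) (sumF-lower (λ j → lower (punchIn c j))) ⟩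
            h c + sumF (λ j → h (punchIn c j))
              ≡⟨ sym (sumF-punch h c) ⟩
            sumF h
              ≡⟨ trans (sumF-+ (λ b → q * wt (f ↾ b)) s) (cong (_+ sumF s) (trans (sumF-* q (λ b → wt (f ↾ b))) (cong (q *_) (sym (wt-suc f))))) ⟩
            q * wt f + sumF s ∎
            where open ≤-Reasoning
          eq : ∀ Q U N σ S → N + (suc Q * σ + S) + Q * U + Q * (2 * Q * U) + U ≡ Q * U + σ + (N + Q * (2 * Q * U)) + (S + U) + Q * σ
          eq = solve-∀

        slice-gap : ∀ {f : V (suc (suc m)) → K} → Degree f → #zero f ≡ 0 → ∀ b → wt (f ↾ b) ≢ U → 2 * Q * U ≤ q * wt (f ↾ b)
        slice-gap {f} p Z≡0 b ≢U with gap (f ↾ b) (pol-slice b p)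
        ... | inj₁ w≡0         = ⊥-elim (#zero≡0 Z≡0 b (wt≡0⇒Zero w≡0))
        ... | inj₂ (inj₁ w≡U)  = ⊥-elim (≢U w≡U)
        ... | inj₂ (inj₂ big)  = big

        -- By the gap each of the q slices weighs at least 2QU/q, and their sum is at most 2QU.
        balanced : ∀ {f : V (suc (suc m)) → K} → Degree f → wt f ≤ 2 * Q * U → #zero f ≡ 0 → (∀ b → wt (f ↾ b) ≢ U) →
                   ∀ b → q * wt (f ↾ b) ≡ 2 * Q * U
        balanced {f} p σ≤ Z≡0 none b = ≤-antisym (lin (≤-trans total (*-monoʳ-≤ q σ≤)) 0 (eq Q (2 * Q * U) (q * wt (f ↾ b))))
                                         (slice-gap p Z≡0 b (none b))
          where
          total : q * wt (f ↾ b) + Q * (2 * Q * U) ≤ q * wt f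
          total = ≤-trans (+-monoʳ-≤ (q * wt (f ↾ b)) (sumF-lower (λ j → slice-gap p Z≡0 (punchIn b j) (none (punchIn b j)))))
            (≤-reflexive (trans (sym (sumF-punch (λ b → q * wt (f ↾ b)) b)) (trans (sumF-* q (λ b → wt (f ↾ b))) (cong (q *_) (sym (wt-suc f))))))
          eq : ∀ Q M N → N + suc Q * M + 0 ≡ M + (N + Q * M)
          eq = solve-∀

        -- K = 1 and K = 2 are passed to `Res`. For K = q - 1 the slices weigh 2U, and the threshold
        -- would give Q ≤ 2. For K = q it excludes fewer than two light slices, since by the gap all
        -- others weigh at least 2QU/q.
        heavy-slice : ∀ {f : V (suc (suc m)) → K} → Degree f → ¬ Zero f → wt f ≤ 2 * Q * U → ∀ {c} → Q * U + wt f ≤ q * wt (f ↾ c) → Res f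
        heavy-slice {f} p nf σ≤ {c} heavy = by-profile (profile t₀ n e f p nf σ≤)
          where
          three-halves : 3 ≤ Q → wt f ≡ 2 * Q * U → (∀ a → ¬ Zero (f ↾ a) → wt (f ↾ a) ≡ 2 * U) → ⊥
          three-halves 3≤Q σ≡ s = n≮n 2 (≤-trans 3≤Q (*-cancelʳ-≤ Q 2 U {{>-nonZero (q^-pos n)}}
            (lin heavy′ 0 (eq Q U))))
            where
            nc : ¬ Zero (f ↾ c)
            nc z = n≮n 0 (≤-trans (q^-pos n) (≤-trans U≤QU (≤-trans (m≤m+n _ (wt f)) (≤-trans heavy
              (≤-reflexive (trans (cong (q *_) (Zero⇒wt≡0 z)) (*-zeroʳ q)))))))
            heavy′ : Q * U + 2 * Q * U ≤ q * (2 * U)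
            heavy′ = subst₂ (λ u v → Q * U + u ≤ q * v) σ≡ (s c nc) heavy
            eq : ∀ Q U → Q * U + suc Q * (2 * U) + 0 ≡ 2 * U + (Q * U + 2 * Q * U)
            eq = solve-∀

          one-light : #zero f ≡ 0 → ∀ {a₁} → wt (f ↾ a₁) ≡ U → (∀ a → wt (f ↾ a) ≡ U → a₁ ≡ a) → ⊥
          one-light Z≡0 {a₁} light unique = few-light-impossible {f} {c} σ≤ heavy (λ b → [ b ≟F a₁ ] * (Q * U ∸ U)) lower
            (≤-reflexive (trans (cong (_+ U) (sumF-pick a₁ (λ _ → Q * U ∸ U))) (m∸n+n≡m U≤QU)))
            where
            lower : ∀ b → 2 * Q * U ≤ q * wt (f ↾ b) + [ b ≟F a₁ ] * (Q * U ∸ U)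
            lower b with b ≟F a₁
            ... | no b≢a₁  = ≤-trans (slice-gap p Z≡0 b (λ w → b≢a₁ (sym (unique b w)))) (m≤m+n _ _)
            ... | yes refl = ≤-reflexive (sym (trans (cong₂ (λ u v → q * u + v) light (+-identityʳ _))
                               (trans (eq₁ Q U (Q * U ∸ U)) (trans (cong (Q * U +_) (m∸n+n≡m U≤QU)) (eq₂ Q U)))))
              where
              eq₁ : ∀ Q U d → suc Q * U + d ≡ Q * U + (d + U)
              eq₁ = solve-∀
              eq₂ : ∀ Q U → Q * U + Q * U ≡ 2 * Q * U
              eq₂ = solve-∀

          full : #zero f ≡ 0 → Dec (∃ λ a → wt (f ↾ a) ≡ U) → Res f
          full Z≡0 (no none) = ⊥-elim (few-light-impossible {f} {c} σ≤ heavy (λ _ → 0)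
            (λ b → ≤-trans (slice-gap p Z≡0 b (λ w → none (b , w))) (m≤m+n _ 0))
            (≤-trans (≤-reflexive (cong (_+ U) (Additive.zero-T (sumF-additive {q})))) U≤QU))
          full Z≡0 (yes (a₁ , light₁)) with any? (λ a → _×-dec_ (wt (f ↾ a) ≟ U) (¬? (a₁ ≟F a)))
          ... | yes (a₂ , light₂ , a₁≢a₂) = TwoLightSlices.result p nf σ≤ Z≡0 a₁≢a₂ light₁ light₂ heavy
          ... | no none = ⊥-elim (one-light Z≡0 light₁ unique)
            where
            unique : ∀ a → wt (f ↾ a) ≡ U → a₁ ≡ a
            unique a light with a₁ ≟F a
            ... | yes a₁≡a = a₁≡a
            ... | no a₁≢a  = ⊥-elim (none (a , light , a₁≢a))

          by-profile : Profile U f → Res f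
          by-profile (one κ≡1)                   = res-one p nf κ≡1
          by-profile (two κ≡2 s)                 = res-two p σ≤ κ≡2 s
          by-profile (all-but-one Z≡1 3≤Q s σ≡) = ⊥-elim (three-halves 3≤Q σ≡ s)
          by-profile (all Z≡0)                   = full Z≡0 (any? (λ a → wt (f ↾ a) ≟ U))

        -- All U points of the slice lie in a subspace of codimension 2. The pencil through it has a
        -- sloped member of weight N with qU + |f| ≤ qN + U, which is the threshold of
        -- `heavy-slice`.
        light-slice : ∀ {f : V (suc (suc m)) → K} → Degree f → ¬ Zero f → wt f ≤ 2 * Q * U → ∀ {a} → wt (f ↾ a) ≡ U → Res f
        light-slice {f} p nf σ≤ {a} light with flat-in-hyperplane n t₀ m e (f ↾ a) (pol-slice a p) (≤-reflexive (eq t₀ Q)) light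
          where
          eq : ∀ t₀ Q → suc (suc t₀ * Q) + suc Q ≡ suc (suc t₀) * Q + 2
          eq = solve-∀
        ... | ψ , c , z with pencil-max (f ∘ to (ext-iso ψ)) a c
        ... | l , big = res-iso (ext-iso ψ ∘I pencil-iso a l) (heavy-slice (pol-iso (ext-iso ψ ∘I pencil-iso a l) p)
            (λ zg → nf (Zero-iso (ext-iso ψ ∘I pencil-iso a l) {f} zg)) (≤-trans (≤-reflexive wg) σ≤)
            (≤-trans (≤-reflexive (cong (Q * U +_) wg)) (+-cancelʳ-≤ U _ _ (≤-trans (≤-reflexive (eq Q U (wt f)))
              (≤-trans (≤-reflexive (sym (cong₂ (λ u v → q * u + v) (trans (sym (wt-single {f = (f ↾ a) ∘ to ψ} z)) wa) (wt-iso (ext-iso ψ) f))))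
                (≤-trans big (+-monoʳ-≤ _ (≤-reflexive wa))))))))
          where
          wa : wt ((f ↾ a) ∘ to ψ) ≡ U
          wa = trans (wt-iso ψ (f ↾ a)) light
          wg : wt (f ∘ to (ext-iso ψ ∘I pencil-iso a l)) ≡ wt f
          wg = wt-iso (ext-iso ψ ∘I pencil-iso a l) f
          eq : ∀ Q U σ → Q * U + σ + U ≡ suc Q * U + σ
          eq = solve-∀

  open Pencils

  -- Slices containing half of the support

  module Halves where

    -- Removes the slice y = c from the support at the cost of one degree. For the new degree the
    -- minimum weight is QU, half of the second weight; so what remains outside a slice with at
    -- least half of the support is empty or minimal.
    off-slice : ∀ {m} → K → (V (suc m) → K) → V (suc m) → K
    off-slice c f v = (head v ⊖ c) ⊗ f v

    abstract
      off-slice-pol : ∀ {m d c} {f : V (suc m) → K} → Pol d f → Pol (suc d) (off-slice c f)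
      off-slice-pol {c = c} {f} p = addP (varP zero p (λ _ → refl)) (mul-const (⊝ c) p)
        (λ { (y ∷ x) → R.distribʳ (f (y ∷ x)) y (⊝ c) })

      off-slice-wt : ∀ {m c} (f : V (suc m) → K) → wt (f ↾ c) + wt (off-slice c f) ≡ wt f
      off-slice-wt {c = c} f = begin
        wt (f ↾ c) + wt (off-slice c f)
          ≡⟨ cong (wt (f ↾ c) +_) (trans (wt-suc (off-slice c f)) (sumF-punch (λ a → wt (off-slice c f ↾ a)) c)) ⟩
        wt (f ↾ c) + (wt (off-slice c f ↾ c) + sumF (λ j → wt (off-slice c f ↾ punchIn c j)))
          ≡⟨ cong (wt (f ↾ c) +_) (cong₂ _+_
               (Zero⇒wt≡0 (λ x → trans (cong (_⊗ f (c ∷ x)) (⊖-self c)) (R.zeroˡ _)))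
               (sumF-cong (λ j → wt-scale (⊖-nonzero (punchInᵢ≢i c j)) (λ x → refl)))) ⟩
        wt (f ↾ c) + sumF (λ j → wt (f ↾ punchIn c j))
          ≡⟨ sym (trans (wt-suc f) (sumF-punch (λ a → wt (f ↾ a)) c)) ⟩
        wt f ∎
        where open ≡-Reasoning

      off-slice-zero : ∀ {m c} {f : V (suc m) → K} → Zero (off-slice c f) → InHyperplane f
      off-slice-zero {c = c} z = id-iso , c , λ y y≢c x → ⊗-cancel-zero (⊖-nonzero y≢c) (z (y ∷ x))

      off-slice-bound : ∀ t₀ n m → m ≡ t₀ + n → (f : V (suc (suc m)) → K) → Pol (suc (suc t₀ * Q)) f → ∀ c →
                        ¬ Zero (off-slice c f) → Q * q ^ n ≤ wt (off-slice c f)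
      off-slice-bound t₀ n m e f p c nz = minimum-weight (suc m) (suc t₀) n (cong suc e) (off-slice c f) Q (off-slice-pol p)
        (≤-reflexive (eq t₀ Q)) (n≤1+n Q) nz
        where
        eq : ∀ t₀ Q → suc (suc (suc t₀ * Q)) + Q ≡ suc (suc t₀) * Q + 2
        eq = solve-∀

      more-than-half : ∀ t₀ n m → m ≡ t₀ + n → (f : V (suc (suc m)) → K) → Pol (suc (suc t₀ * Q)) f → wt f ≤ 2 * Q * q ^ n →
                       ∀ {c} → suc (Q * q ^ n) ≤ wt (f ↾ c) → InHyperplane f
      more-than-half t₀ n m e f p σ≤ {c} big with zero? (off-slice c f)
      ... | yes z = off-slice-zero z
      ... | no nz = absurd-≤ (≤-trans (+-mono-≤ big (off-slice-bound t₀ n m e f p c nz)) (≤-trans (≤-reflexive (off-slice-wt f)) σ≤)) 0 (eq Q (q ^ n))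
        where
        eq : ∀ Q U → 2 * Q * U + 1 ≡ suc (Q * U) + Q * U
        eq = solve-∀

      -- The other half of the support is that of a function of minimal weight, so it lies in a subspace of codimension 2,
      -- which spans with a point of the first half a hyperplane containing more than half of the support.
      half-in-hyperplane : ∀ t₁ n m → m ≡ t₁ + n → (f : V (suc (suc (suc m))) → K) → Pol (suc (suc (suc t₁) * Q)) f → wt f ≤ 2 * Q * q ^ n →
                           ∀ {c} → Q * q ^ n ≤ wt (f ↾ c) → InHyperplane f
      half-in-hyperplane t₁ n m e f p σ≤ {c} half with zero? (off-slice c f)
      ... | yes z = off-slice-zero z
      ... | no nz = stage₁ (minimal-in-hyperplane n (suc t₁) (suc m) (cong suc e) g Q pg (≤-reflexive (eq₁ t₁ Q)) 2≤Q (n≤1+n Q) wg)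
        where
        g : V (suc (suc (suc m))) → K
        g = off-slice c f
        pg : Pol (suc (suc (suc (suc t₁) * Q))) g
        pg = off-slice-pol p
        eq₁ : ∀ t₁ Q → suc (suc (suc (suc t₁) * Q)) + Q ≡ suc (suc (suc t₁)) * Q + 2
        eq₁ = solve-∀
        wg : wt g ≡ Q * q ^ n
        wg = ≤-antisym (+-cancelˡ-≤ (wt (f ↾ c)) _ _ (≤-trans (≤-reflexive (off-slice-wt f)) (≤-trans σ≤ (≤-trans (≤-reflexive (eq Q (q ^ n))) (+-monoˡ-≤ (Q * q ^ n) half)))))
               (off-slice-bound (suc t₁) n (suc m) (cong suc e) f p c nz)
          where
          eq : ∀ Q U → 2 * Q * U ≡ Q * U + Q * U
          eq = solve-∀
        nc : ¬ Zero (f ↾ c)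
        nc = wt-nonzero (≤-trans (≤-trans (q^-pos n) (m≤n*m (q ^ n) Q {{>-nonZero (≤-trans (n≤1+n 1) 2≤Q)}})) half)

        stage₂ : (φ : Iso (suc (suc (suc m)))) (c₁ : K) → (∀ y → y ≢ c₁ → Zero ((g ∘ to φ) ↾ y)) →
                 InHyperplane ((g ∘ to φ) ↾ c₁) → InHyperplane f
        stage₂ φ c₁ z₁ (ψ , c₂ , z₂) = inHyperplane-iso {f = f} θ (choose (from θ (c ∷ x₀)) refl)
          where
          θ : Iso (suc (suc (suc m)))
          θ = φ ∘I ext-iso ψ
          f′ g′ : V (suc (suc (suc m))) → K
          f′ = f ∘ to θ
          g′ = g ∘ to θ
          x₀ : V (suc (suc m))
          x₀ = proj₁ (nonzero-point nc)
          core : V (suc m) → K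
          core x = g′ (c₁ ∷ c₂ ∷ x)
          w-core : wt core ≡ Q * q ^ n
          w-core = trans (sym (wt-single {f = g′ ↾ c₁} z₂)) (trans (wt-iso ψ ((g ∘ to φ) ↾ c₁)) (trans (sym (wt-single {f = g ∘ to φ} z₁)) (trans (wt-iso φ g) wg)))
          sub : ∀ v → f′ v ≡ 𝟘 → g′ v ≡ 𝟘
          sub v z = trans (cong ((head (to θ v) ⊖ c) ⊗_) z) (R.zeroʳ _)
          pf′ : Pol (suc (suc (suc t₁) * Q)) f′
          pf′ = pol-iso θ p
          conclude : ∀ φ′ c′ → suc (Q * q ^ n) ≤ wt ((f′ ∘ to φ′) ↾ c′) → InHyperplane f′
          conclude φ′ c′ big = inHyperplane-iso {f = f′} φ′ (more-than-half (suc t₁) n (suc m) (cong suc e) (f′ ∘ to φ′) (pol-iso φ′ pf′)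
            (≤-trans (≤-reflexive (trans (wt-iso φ′ f′) (wt-iso θ f))) σ≤) big)
          at : ∀ {p₀} → p₀ ≡ from θ (c ∷ x₀) → to θ p₀ ≡ c ∷ x₀
          at e₀ = trans (cong (to θ) e₀) (to-from θ (c ∷ x₀))
          in-support : ∀ {p₀} → p₀ ≡ from θ (c ∷ x₀) → f′ p₀ ≢ 𝟘
          in-support e₀ z = proj₂ (nonzero-point nc) (trans (cong f (sym (at e₀))) z)
          join : ∀ y z x → (y ∷ z ∷ x) ≡ from θ (c ∷ x₀) → ¬ (y ≡ c₁ × z ≡ c₂) → InHyperplane f′
          join y z x e₀ ¬L with join-point f′ c₁ c₂ (in-support e₀) ¬L
          ... | φ′ , c′ , big = conclude φ′ c′ (≤-trans (s≤s (≤-trans (≤-reflexive (sym w-core)) (wt-mono (λ x → sub (c₁ ∷ c₂ ∷ x))))) big)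
          choose : ∀ p₀ → p₀ ≡ from θ (c ∷ x₀) → InHyperplane f′
          choose (y ∷ z ∷ x) e₀ with y ≟F c₁ | z ≟F c₂
          ... | no y≢    | _        = join y z x e₀ (λ { (y≡ , _) → y≢ y≡ })
          ... | yes _    | no z≢    = join y z x e₀ (λ { (_ , z≡) → z≢ z≡ })
          -- The point lies in the subspace of codimension 2 itself. There `g` vanishes and `f` does
          -- not, so this subspace alone has more than QU points of the support.
          ... | yes refl | yes refl = conclude id-iso c₁ (≤-trans (≤-trans (≤-reflexive (cong suc (sym w-core)))
                  (wt-strict {f = λ x → f′ (c₁ ∷ c₂ ∷ x)} {core} {x} (λ x → sub (c₁ ∷ c₂ ∷ x)) (in-support e₀)
                    (trans (cong g (at e₀)) (trans (cong (_⊗ f (c ∷ x₀)) (⊖-self c)) (R.zeroˡ _)))))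
                  (≤-trans (sumF-term (λ b → wt (λ x → f′ (c₁ ∷ b ∷ x))) c₂) (≤-reflexive (sym (wt-suc (f′ ↾ c₁))))))

        stage₁ : InHyperplane g → InHyperplane f
        -- Restricted to the hyperplane, `g` loses `Q` degrees and is again of minimum weight with k
        -- = Q; a second hyperplane cuts out the subspace of codimension 2.
        stage₁ (φ , c₁ , z₁) = stage₂ φ c₁ z₁ (minimal-in-hyperplane n t₁ m e ((g ∘ to φ) ↾ c₁) Q
            (pol-weaken (≤-trans (∸-monoʳ-≤ _ (#zero≥Q {f = g ∘ to φ} z₁)) (≤-reflexive (trans (cong (_∸ Q) (eq₂ t₁ Q)) (m+n∸n≡m _ Q)))) (pol-slice-∸ (pol-iso φ pg) c₁))
            (≤-reflexive (eq₃ t₁ Q)) 2≤Q (n≤1+n Q)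
            (trans (sym (wt-single {f = g ∘ to φ} z₁)) (trans (wt-iso φ g) wg)))
          where
          eq₂ : ∀ t₁ Q → suc (suc (suc (suc t₁) * Q)) ≡ 2 + suc t₁ * Q + Q
          eq₂ = solve-∀
          eq₃ : ∀ t₁ Q → 2 + suc t₁ * Q + Q ≡ suc (suc t₁) * Q + 2
          eq₃ = solve-∀

  open Halves

  -- Codimension at least two: the support lies in a hyperplane

  module Spanning where

    SpansHyperplane : ℕ → ℕ → ℕ → Set
    SpansHyperplane t₁ n m = (f : V (suc (suc (suc m))) → K) → Pol (suc (suc (suc t₁) * Q)) f → wt f ≤ 2 * Q * q ^ n → InHyperplane f

    module HighCodimension (t₁ n m : ℕ) (e : m ≡ t₁ + n) (gap : Gap (suc t₁) n (suc m))
      (ih : ∀ n′ → n ≡ suc n′ → (h : V (suc (suc m)) → K) → Pol (suc (suc (suc t₁) * Q)) h → wt h ≤ 2 * Q * q ^ n′ → InHyperplane h) where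

      abstract
        -- The case of two slices and that of crossing translates both exhibit a slice of weight QU,
        -- at least half of the support, so `half-in-hyperplane` applies.
        closed : Closed (suc t₁) n (suc m) InHyperplane
        closed = record
          { res-iso   = λ {f} φ → inHyperplane-iso {f = f} φ
          ; res-one   = λ _ nf κ≡1 → inHyperplane-#nonzero nf κ≡1
          ; res-two   = λ {f} p σ≤ κ≡2 s → let (c , nc) = nonzero-slice (nf f κ≡2) in half-in-hyperplane t₁ n m e f p σ≤ (≤-reflexive (sym (s c nc)))
          ; res-cross = λ {f} p σ≤ _ _ _ half → half-in-hyperplane t₁ n m e f p σ≤ (≤-reflexive (sym half))
          }
          where
          nf : ∀ (f : V (suc (suc (suc m))) → K) → #nonzero f ≡ 2 → ¬ Zero f
          nf f κ≡2 z = case trans (sym κ≡2) (n≤0⇒n≡0 (+-cancelˡ-≤ q _ 0 (≤-trans (≤-trans (+-monoˡ-≤ (#nonzero f) q≤)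
              (≤-reflexive (trans (+-comm (#zero f) _) (#nonzero+#zero f)))) (≤-reflexive (sym (+-identityʳ q)))))) of λ ()
            where
            q≤ : q ≤ #zero f
            q≤ = #zero≥q {f = f} (λ y x → z (y ∷ x))

      open PencilArgument (suc t₁) n (suc m) (cong suc e) gap {InHyperplane} closed

      abstract
        -- Dividing by the one vanishing slice lowers the degree by one, and 2U is then the minimum
        -- weight of a slice.
        all-but-one-slice : ∀ {f : V (suc (suc (suc m))) → K} → Degree f → #zero f ≡ 1 → ∀ {a} → wt (f ↾ a) ≡ 2 * U → InHyperplane (f ↾ a)
        all-but-one-slice {f} p Z≡1 {a} w = minimal-in-hyperplane n t₁ m e (f ↾ a) 2
          (subst (λ Z → Pol (suc (suc (suc t₁) * Q) ∸ Z) (f ↾ a)) Z≡1 (pol-slice-∸ p a)) ≤-refl ≤-refl (s≤s (≤-trans (n≤1+n 1) 2≤Q)) w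

        join : ∀ {f : V (suc (suc (suc m))) → K} {a} → InHyperplane (f ↾ a) →
               (∀ φ c → suc (wt (f ↾ a)) ≤ wt ((f ∘ to φ) ↾ c) → InHyperplane (f ∘ to φ)) → InHyperplane f
        join {f} {a} ha next with other-slice {f = f} a
        ... | inj₁ z = id-iso , a , z
        ... | inj₂ (b , b≢a , nb) with join-slice {f = f} ha b≢a nb
        ... | φ , c , big = inHyperplane-iso {f = f} φ (next φ c big)

        light? : ∀ (f : V (suc (suc (suc m))) → K) → (∃ λ a → wt (f ↾ a) ≡ U) ⊎ (∀ a → wt (f ↾ a) ≢ U)
        light? f with any? (λ a → wt (f ↾ a) ≟ U)
        ... | yes l = inj₁ l
        ... | no none = inj₂ (λ a w → none (a , w))

        bounded : ∀ {f : V (suc (suc (suc m))) → K} (φ : Iso (suc (suc (suc m)))) → wt f ≤ 2 * Q * U → wt (f ∘ to φ) ≤ 2 * Q * U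
        bounded {f} φ σ≤ = ≤-trans (≤-reflexive (wt-iso φ f)) σ≤

        -- More than 2U points exclude K = q - 1, where slices weigh 2U, and K = q without light
        -- slices, where they weigh 2QU/q.
        heavier : ∀ {f : V (suc (suc (suc m))) → K} → Degree f → ¬ Zero f → wt f ≤ 2 * Q * U → ∀ {c} → suc (2 * U) ≤ wt (f ↾ c) → InHyperplane f
        heavier {f} p nf σ≤ {c} big with profile (suc t₁) n (cong suc e) f p nf σ≤
        ... | one κ≡1 = inHyperplane-#nonzero nf κ≡1
        ... | two κ≡2 s = Closed.res-two closed p σ≤ κ≡2 s
        ... | all-but-one _ _ s _ = ⊥-elim (n≮n (2 * U) (≤-trans big (≤-reflexive (s c (wt-nonzero (≤-trans (s≤s z≤n) big))))))
        ... | all Z≡0 with light? f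
        ... | inj₁ (a , l) = light-slice p nf σ≤ l
        ... | inj₂ none = absurd-≤ (≤-trans (*-monoʳ-≤ q big) (≤-reflexive (balanced p σ≤ Z≡0 none c))) (2 * U + Q) (eq Q U)
          where
          eq : ∀ Q U → 2 * Q * U + suc (2 * U + Q) ≡ suc Q * suc (2 * U)
          eq = solve-∀

        heavy : ∀ {f : V (suc (suc (suc m))) → K} → Degree f → ¬ Zero f → wt f ≤ 2 * Q * U → ∀ {c} → suc (2 * Q * U) ≤ q * wt (f ↾ c) → InHyperplane f
        heavy {f} p nf σ≤ {c} big with profile (suc t₁) n (cong suc e) f p nf σ≤
        ... | one κ≡1 = inHyperplane-#nonzero nf κ≡1
        ... | two κ≡2 s = Closed.res-two closed p σ≤ κ≡2 s
        ... | all-but-one Z≡1 _ s _ with nonzero-slice nf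
        ...   | a , na = join {f} (all-but-one-slice p Z≡1 (s a na)) (λ φ c′ big′ →
                  heavier (pol-iso φ p) (λ z → nf (Zero-iso φ {f} z)) (bounded {f} φ σ≤) (≤-trans (s≤s (≤-reflexive (sym (s a na)))) big′))
        heavy {f} p nf σ≤ {c} big | all Z≡0 with light? f
        ... | inj₁ (a , l) = light-slice p nf σ≤ l
        ... | inj₂ none = ⊥-elim (n≮n (2 * Q * U) (≤-trans big (≤-reflexive (balanced p σ≤ Z≡0 none c))))

        -- 2QU/q is the second weight 2Q q^(n-1) of the slice, so the induction applies. For n = 0
        -- it is less than 2, which leaves only the excluded weight U = 1.
        balanced-slice : ∀ {f : V (suc (suc (suc m))) → K} → Degree f → ∀ {a} → ¬ Zero (f ↾ a) → wt (f ↾ a) ≢ U → q * wt (f ↾ a) ≡ 2 * Q * U →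
                         ∀ n′ → n ≡ n′ → InHyperplane (f ↾ a)
        balanced-slice {f} p {a} na ≢U w zero refl = absurd-≤ (≤-trans (*-monoʳ-≤ q 2≤w) (≤-reflexive w)) 1 (eq Q)
          where
          2≤w : 2 ≤ wt (f ↾ a)
          2≤w = ≤∧≢⇒< (wt-pos na) (λ 1≡w → ≢U (sym 1≡w))
          eq : ∀ Q → 2 * Q * 1 + 2 ≡ suc Q * 2
          eq = solve-∀
        balanced-slice {f} p {a} na ≢U w (suc n′) refl = ih n′ refl (f ↾ a) (pol-slice a p)
          (*-cancelˡ-≤ q (≤-trans (≤-reflexive w) (≤-reflexive (eq q Q (q ^ n′)))))
          where
          eq : ∀ q Q U → 2 * Q * (q * U) ≡ q * (2 * Q * U)
          eq = solve-∀

        -- The classes that do not finish at once have slices of weight 2QU/q (K = q without light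
        -- slices) or the larger 2U (K = q - 1). Each join gives a slice strictly above the current
        -- value, so two joins suffice.
        spans-hyperplane : SpansHyperplane t₁ n m
        spans-hyperplane f p σ≤ with zero? f
        ... | yes z = inHyperplane-zero z
        ... | no nf with profile (suc t₁) n (cong suc e) f p nf σ≤
        ... | one κ≡1 = inHyperplane-#nonzero nf κ≡1
        ... | two κ≡2 s = Closed.res-two closed p σ≤ κ≡2 s
        ... | all-but-one Z≡1 _ s _ with nonzero-slice nf
        ...   | a , na = join {f} (all-but-one-slice p Z≡1 (s a na)) (λ φ c′ big′ →
                  heavier (pol-iso φ p) (λ z → nf (Zero-iso φ {f} z)) (bounded {f} φ σ≤) (≤-trans (s≤s (≤-reflexive (sym (s a na)))) big′))
        spans-hyperplane f p σ≤ | no nf | all Z≡0 with light? f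
        ... | inj₁ (a , l) = light-slice p nf σ≤ l
        ... | inj₂ none = join {f} (balanced-slice p (#zero≡0 Z≡0 zero) (none zero) (balanced p σ≤ Z≡0 none zero) n refl) (λ φ c′ big′ →
                heavy (pol-iso φ p) (λ z → nf (Zero-iso φ {f} z)) (bounded {f} φ σ≤)
                  (≤-trans (s≤s (≤-trans (≤-reflexive (sym (balanced p σ≤ Z≡0 none zero))) (m≤n+m _ Q)))
                    (≤-trans (≤-reflexive (sym (trans (*-suc q _) refl))) (*-monoʳ-≤ q big′))))

  open Spanning

  -- The case t = 1: normal forms

  module HypersurfaceForms where

    -- The two shapes of the theorem in coordinates y, z: two parallel hyperplanes without z = c, or
    -- the two crossing hyperplanes y = b and z = c without their intersection.
    data Configuration {n : ℕ} (f : V (suc (suc n)) → K) : Set where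
      parallel : ∀ a b c → a ≢ b → (∀ y z x → f (y ∷ z ∷ x) ≢ 𝟘 → (y ≡ a ⊎ y ≡ b) × z ≢ c) →
                 (∀ y z x → (y ≡ a ⊎ y ≡ b) × z ≢ c → f (y ∷ z ∷ x) ≢ 𝟘) → Configuration f
      crossing : ∀ b c → (∀ y z x → f (y ∷ z ∷ x) ≢ 𝟘 → (y ≡ b × z ≢ c) ⊎ (y ≢ b × z ≡ c)) →
                 (∀ y z x → (y ≡ b × z ≢ c) ⊎ (y ≢ b × z ≡ c) → f (y ∷ z ∷ x) ≢ 𝟘) → Configuration f

    LowWeightForm : ∀ {n} → (V (suc (suc n)) → K) → Set
    LowWeightForm {n} f = wt f ≡ q ^ suc n ⊎ (∃ λ (φ : Iso (suc (suc n))) → Configuration (f ∘ to φ))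

    -- Stated for all weights up to the second one, because the gap for slices needs the words below
    -- it.
    ClassifiesHypersurfaces : ℕ → Set
    ClassifiesHypersurfaces n = (f : V (suc (suc n)) → K) → Pol (suc (1 * Q)) f → ¬ Zero f → wt f ≤ 2 * Q * q ^ n → LowWeightForm f

    abstract
      1*Q≡Q : 1 * Q ≡ Q
      1*Q≡Q = +-identityʳ Q

      0<Q : 0 < Q
      0<Q = ≤-trans (n≤1+n 1) 2≤Q

      constant-slice : ∀ {m} {f : V (suc m) → K} → Pol (suc (1 * Q)) f → ∀ {c} → (∀ y → y ≢ c → Zero (f ↾ y)) → ∃ λ κ → ∀ x → f (c ∷ x) ≡ κ
      constant-slice {f = f} p {c} z = pol-1 (pol-weaken (≤-trans (∸-monoʳ-≤ (suc (1 * Q)) (#zero≥Q {f = f} z))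
        (≤-reflexive (trans (cong (λ w → suc w ∸ Q) 1*Q≡Q) (m+n∸n≡m 1 Q)))) (pol-slice-∸ p c))

      low-weight-iso : ∀ {n} {f : V (suc (suc n)) → K} (φ : Iso (suc (suc n))) → LowWeightForm (f ∘ to φ) → LowWeightForm f
      low-weight-iso {f = f} φ (inj₁ w)       = inj₁ (trans (sym (wt-iso φ f)) w)
      low-weight-iso φ (inj₂ (ψ , conf)) = inj₂ (φ ∘I ψ , conf)

      one-hyperplane : ∀ {n} {f : V (suc (suc n)) → K} → Pol (suc (1 * Q)) f → ¬ Zero f → #nonzero f ≡ 1 → LowWeightForm f
      one-hyperplane {f = f} p nf κ≡1 with nonzero-slice nf
      ... | c , nc with constant-slice p (#nonzero≡1 κ≡1 nc)
      ... | κ , e = inj₁ (trans (wt-single (#nonzero≡1 κ≡1 nc)) (wt-const (λ κ≡0 → nc (λ x → trans (e x) κ≡0)) e))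

  open HypersurfaceForms

  -- Two nonzero slices: two parallel hyperplanes

  module TwoHyperplanes where

    module _ {n} {f : V (suc (suc n)) → K} (p : Pol (suc (1 * Q)) f) (κ≡2 : #nonzero f ≡ 2)
             (s : ∀ a → ¬ Zero (f ↾ a) → wt (f ↾ a) ≡ Q * q ^ n) where

      abstract
        sZ≡Q : suc (#zero f) ≡ Q
        sZ≡Q = suc-injective (trans (cong (_+ #zero f) (sym κ≡2)) (#nonzero+#zero f))

        degree≡2 : suc (1 * Q) ∸ #zero f ≡ 2
        degree≡2 = trans (cong (λ w → suc w ∸ #zero f) (trans 1*Q≡Q (sym sZ≡Q))) (m+n∸n≡m 2 (#zero f))

        -- The quotient g of f by its vanishing hyperplanes is affine, and its zero set meets y = a and y = b properly.
        two-hyperplanes-at : ∀ {a b} → a ≢ b → ¬ Zero (f ↾ a) → ¬ Zero (f ↾ b) → LowWeightForm f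
        two-hyperplanes-at {a} {b} a≢b na nb with pol-quotient p | minimal-parallel n (f ↾ a) Q (subst (λ d → Pol d (f ↾ a)) degree≡2 (pol-slice-∸ p a))
                                                  (≤-reflexive (trans (+-comm 2 Q) (cong (_+ 2) (sym 1*Q≡Q)))) 0<Q ≤-refl (s a na)
        -- The slice at `a` is a minimal word supported on `Q` of the q hyperplanes of a parallel
        -- class; the missing one is z = c.
        ... | g , pg , fg | ψ , κ≡Q , const with zero-slice ((f ↾ a) ∘ to ψ) (≤-reflexive (sym Z≡1))
          where
          Z≡1 : #zero ((f ↾ a) ∘ to ψ) ≡ 1
          Z≡1 = +-cancelˡ-≡ Q _ 1 (trans (cong (_+ #zero ((f ↾ a) ∘ to ψ)) (sym κ≡Q)) (trans (#nonzero+#zero ((f ↾ a) ∘ to ψ)) (+-comm 1 Q)))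
        ... | c , zc with fg a na | fg b nb | pol-divide (pol-iso (ext-iso ψ) (subst (λ d → Pol d g) degree≡2 pg)) a
                      | pol-divide (pol-slice a (pol-iso (ext-iso ψ) (subst (λ d → Pol d g) degree≡2 pg))) c
        ... | κa , κa≢0 , ea | κb , κb≢0 , eb | h , ph , eh | h₂ , ph₂ , eh₂ with pol-1 ph | pol-1 ph₂
        ... | α , hα | β , hβ = inj₂ (θ , parallel a b c a≢b only-if if)
          where
          g₁ : V (suc (suc n)) → K
          g₁ = g ∘ to (ext-iso ψ)
          base-zero : ∀ x → g₁ (a ∷ c ∷ x) ≡ 𝟘
          base-zero x = ⊗-cancel-zero κa≢0 (trans (sym (ea _)) (zc x))
          slice-a : ∀ z x → g₁ (a ∷ z ∷ x) ≡ (z ⊖ c) ⊗ β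
          slice-a z x = trans (eh₂ z x) (trans (cong₂ (λ u v → (z ⊖ c) ⊗ u ⊹ v) (hβ _) (base-zero x)) (R.+-identityʳ _))
          affine-form : ∀ y z x → g₁ (y ∷ z ∷ x) ≡ (y ⊖ a) ⊗ α ⊹ (z ⊖ c) ⊗ β
          affine-form y z x = trans (eh y (z ∷ x)) (cong₂ (λ u v → (y ⊖ a) ⊗ u ⊹ v) (hα _) (slice-a z x))
          β≢0 : β ≢ 𝟘
          β≢0 β≡0 = na (λ v → trans (cong (λ v → f (a ∷ v)) (sym (to-from ψ v))) (trans (ea _) (trans (cong (κa ⊗_) (vanish (from ψ v))) (R.zeroʳ κa))))
            where
            vanish : ∀ v → g₁ (a ∷ v) ≡ 𝟘
            vanish (z ∷ x) = trans (slice-a z x) (trans (cong ((z ⊖ c) ⊗_) β≡0) (R.zeroʳ _))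
          -- In these coordinates the quotient is α(y - a) + β(z - c). A shear with slope -α/β fixes
          -- y = a and turns its zero set into z = c.
          w : V (suc n)
          w = ⊝ (β ⁻¹ ⊗ α) ∷ 0V
          θ : Iso (suc (suc n))
          θ = ext-iso ψ ∘I shear-iso a w
          straight : ∀ y z x → g (to θ (y ∷ z ∷ x)) ≡ (z ⊖ c) ⊗ β
          straight y z x = trans (affine-form y (z ⊹ (y ⊖ a) ⊗ ⊝ (β ⁻¹ ⊗ α)) _)
            (trans (solve 6 (λ d α z i c β → d :* α :+ ((z :+ d :* (:- (i :* α))) :- c) :* β := (z :- c) :* β :+ (d :* α :- (β :* i) :* (d :* α))) refl (y ⊖ a) α z (β ⁻¹) c β)
              (trans (cong (λ u → (z ⊖ c) ⊗ β ⊹ ((y ⊖ a) ⊗ α ⊖ u ⊗ ((y ⊖ a) ⊗ α))) (⁻¹-inverse β β≢0))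
                (trans (cong (λ u → (z ⊖ c) ⊗ β ⊹ ((y ⊖ a) ⊗ α ⊖ u)) (R.*-identityˡ _))
                  (solve 2 (λ u v → u :+ (v :- v) := u) refl ((z ⊖ c) ⊗ β) ((y ⊖ a) ⊗ α)))))
          scaled : ∀ {y κ} → κ ≢ 𝟘 → (∀ x → f (y ∷ x) ≡ κ ⊗ g (y ∷ x)) → ∀ z x → (f (to θ (y ∷ z ∷ x)) ≢ 𝟘 → z ≢ c) × (z ≢ c → f (to θ (y ∷ z ∷ x)) ≢ 𝟘)
          scaled {y} {κ} κ≢0 eκ z x =
            (λ ne z≡c → ne (trans value (trans (cong (λ u → κ ⊗ (u ⊗ β)) (trans (cong (_⊖ c) z≡c) (⊖-self c))) (trans (cong (κ ⊗_) (R.zeroˡ β)) (R.zeroʳ κ)))))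
            , (λ z≢c fz → ⊗-nonzero κ≢0 (⊗-nonzero (⊖-nonzero z≢c) β≢0) (trans (sym value) fz))
            where
            value : f (to θ (y ∷ z ∷ x)) ≡ κ ⊗ ((z ⊖ c) ⊗ β)
            value = trans (eκ _) (cong (κ ⊗_) (straight y z x))
          only-if : ∀ y z x → f (to θ (y ∷ z ∷ x)) ≢ 𝟘 → (y ≡ a ⊎ y ≡ b) × z ≢ c
          only-if y z x ne with y ≟F a | y ≟F b
          ... | yes refl | _        = inj₁ refl , proj₁ (scaled κa≢0 ea z x) ne
          ... | no _     | yes refl = inj₂ refl , proj₁ (scaled κb≢0 eb z x) ne
          ... | no y≢a   | no y≢b   = ⊥-elim (ne (#nonzero≡2 {f = f} κ≡2 a≢b na nb y y≢a y≢b _))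
          if : ∀ y z x → (y ≡ a ⊎ y ≡ b) × z ≢ c → f (to θ (y ∷ z ∷ x)) ≢ 𝟘
          if y z x (inj₁ refl , z≢c) = proj₂ (scaled κa≢0 ea z x) z≢c
          if y z x (inj₂ refl , z≢c) = proj₂ (scaled κb≢0 eb z x) z≢c

        two-hyperplanes : ¬ Zero f → LowWeightForm f
        two-hyperplanes nf with nonzero-slice nf
        ... | a , na with other-slice {f = f} a
        ... | inj₂ (b , b≢a , nb) = two-hyperplanes-at (λ eq → b≢a (sym eq)) na nb
        ... | inj₁ z = ⊥-elim (n≮n (#zero f) (≤-trans (≤-reflexive sZ≡Q) (#zero≥Q {f = f} z)))

  open TwoHyperplanes

  -- Translated slices: two crossing hyperplanes

  module CrossingHyperplanes where

    abstract
      -- The slice at `a` is a constant `κ₁` on z = c₂. The difference from its translates is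
      -- supported on y = c, hence a constant `κ₂` there by degree. On y = c the values are thus
      -- `κ₂` off z = c₂ and `κ₂ ⊹ κ₁` on it, and the weight QU forces the latter to be zero.
      crossing-hyperplanes : ∀ {n} {f : V (suc (suc n)) → K} {a c} → Pol (suc (1 * Q)) f → a ≢ c → (∀ y → y ≢ c → ∀ x → f (y ∷ x) ≡ f (a ∷ x)) →
                             wt (f ↾ a) ≡ q ^ n → wt (f ↾ c) ≡ Q * q ^ n → LowWeightForm f
      crossing-hyperplanes {n} {f} {a} {c} p a≢c const wa wc with flat-in-hyperplane n 0 n refl (f ↾ a) (pol-slice a p) (≤-reflexive (eq Q)) wa
        where
        eq : ∀ Q → suc (1 * Q) + suc Q ≡ 2 * Q + 2
        eq = solve-∀
      ... | ψ , c₂ , z₂ with constant-slice (pol-slice a (pol-iso (ext-iso ψ) p)) z₂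
                           | constant-slice {f = λ v → f (to (ext-iso ψ) v) ⊖ f (to (ext-iso ψ) (a ∷ tail v))}
                               (pol-sub (pol-iso (ext-iso ψ) p) (pol-pull {φ = λ v → a ∷ tail v} (λ { s (_ ∷ x) (_ ∷ y) (_ ∷ z) → cons-affine a s x y z }) (pol-iso (ext-iso ψ) p)))
                               {c} (λ y y≢c x → trans (cong (_⊖ f (a ∷ to ψ x)) (const y y≢c (to ψ x))) (⊖-self _))
      ... | κ₁ , e₁ | κ₂ , e₂ = inj₂ (ext-iso ψ , crossing c c₂ only-if if)
        where
        f₁ : V (suc (suc n)) → K
        f₁ = f ∘ to (ext-iso ψ)
        wa₁ : wt (f₁ ↾ a) ≡ q ^ n
        wa₁ = trans (wt-iso ψ (f ↾ a)) wa
        wc₁ : wt (f₁ ↾ c) ≡ Q * q ^ n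
        wc₁ = trans (wt-iso ψ (f ↾ c)) wc
        at-c : ∀ v → f₁ (c ∷ v) ≡ κ₂ ⊹ f₁ (a ∷ v)
        at-c v = trans (solve 2 (λ u v → u := (u :- v) :+ v) refl (f₁ (c ∷ v)) (f₁ (a ∷ v))) (cong (_⊹ f₁ (a ∷ v)) (e₂ v))
        off-c : ∀ y → y ≢ c → ∀ v → f₁ (y ∷ v) ≡ f₁ (a ∷ v)
        off-c y y≢c v = const y y≢c (to ψ v)
        κ₁≢0 : κ₁ ≢ 𝟘
        κ₁≢0 κ₁≡0 = n≮n 0 (≤-trans (q^-pos n) (≤-reflexive (trans (sym wa₁) (trans (wt-single {f = f₁ ↾ a} z₂) (Zero⇒wt≡0 (λ x → trans (e₁ x) κ₁≡0))))))
        κ₂≢0 : κ₂ ≢ 𝟘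
        κ₂≢0 κ₂≡0 = n≮n 1 (≤-trans 2≤Q (*-cancelʳ-≤ Q 1 (q ^ n) {{>-nonZero (q^-pos n)}} (≤-reflexive (trans (sym wc₁)
          (trans (wt-cong (λ v → trans (at-c v) (trans (cong (_⊹ f₁ (a ∷ v)) κ₂≡0) (R.+-identityˡ _)))) (trans wa₁ (sym (*-identityˡ _))))))))
        κ₂+κ₁≡0 : κ₂ ⊹ κ₁ ≡ 𝟘
        κ₂+κ₁≡0 with κ₂ ⊹ κ₁ ≟F 𝟘
        ... | yes e = e
        ... | no ne = ⊥-elim (n≮n Q (*-cancelʳ-≤ q Q (q ^ n) {{>-nonZero (q^-pos n)}} (≤-reflexive (trans (sym (wt-full {f = f₁ ↾ c} full)) wc₁))))
          where
          full : ∀ v → f₁ (c ∷ v) ≢ 𝟘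
          full (z ∷ x) fz with z ≟F c₂
          ... | yes refl = ne (trans (cong (κ₂ ⊹_) (sym (e₁ x))) (trans (sym (at-c (c₂ ∷ x))) fz))
          ... | no z≢    = κ₂≢0 (trans (sym (R.+-identityʳ κ₂)) (trans (cong (κ₂ ⊹_) (sym (z₂ z z≢ x))) (trans (sym (at-c (z ∷ x))) fz)))
        only-if : ∀ y z x → f₁ (y ∷ z ∷ x) ≢ 𝟘 → (y ≡ c × z ≢ c₂) ⊎ (y ≢ c × z ≡ c₂)
        only-if y z x ne with y ≟F c | z ≟F c₂
        ... | yes refl | yes refl = ⊥-elim (ne (trans (at-c (c₂ ∷ x)) (trans (cong (κ₂ ⊹_) (e₁ x)) κ₂+κ₁≡0)))
        ... | yes refl | no z≢    = inj₁ (refl , z≢)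
        ... | no y≢    | yes refl = inj₂ (y≢ , refl)
        ... | no y≢    | no z≢    = ⊥-elim (ne (trans (off-c y y≢ (z ∷ x)) (z₂ z z≢ x)))
        if : ∀ y z x → (y ≡ c × z ≢ c₂) ⊎ (y ≢ c × z ≡ c₂) → f₁ (y ∷ z ∷ x) ≢ 𝟘
        if y z x (inj₁ (refl , z≢)) fz = κ₂≢0 (trans (sym (R.+-identityʳ κ₂)) (trans (cong (κ₂ ⊹_) (sym (z₂ z z≢ x))) (trans (sym (at-c (z ∷ x))) fz)))
        if y z x (inj₂ (y≢ , refl)) fz = κ₁≢0 (trans (sym (e₁ x)) (trans (sym (off-c y y≢ (c₂ ∷ x))) fz))

      low-weight-closed : ∀ n → Closed 0 n n LowWeightForm
      low-weight-closed n = record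
        { res-iso   = λ φ → low-weight-iso φ
        ; res-one   = one-hyperplane
        ; res-two   = λ {f} p _ κ≡2 s → two-hyperplanes p κ≡2 s (λ z → n≮n 0 (≤-trans (s≤s z≤n) (≤-reflexive (trans (sym κ≡2) (none f z)))))
        ; res-cross = λ p _ a≢c const wa wc → crossing-hyperplanes p a≢c const wa wc
        }
        where
        none : ∀ (f : V (suc (suc n)) → K) → Zero f → #nonzero f ≡ 0
        none f z = n≤0⇒n≡0 (+-cancelʳ-≤ q _ 0 (≤-trans (+-monoʳ-≤ (#nonzero f) (#zero≥q {f = f} (λ y x → z (y ∷ x)))) (≤-reflexive (#nonzero+#zero f))))

  open CrossingHyperplanes

  -- Functions vanishing on many hyperplanes of a pencil

  module PencilZeros where

    swap : ∀ {m} → V (suc (suc m)) → V (suc (suc m))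
    swap (y ∷ u ∷ x) = u ∷ y ∷ x

    abstract
      swap-affine : ∀ {m} → IsAffine {suc (suc m)} swap
      swap-affine s (_ ∷ _ ∷ _) (_ ∷ _ ∷ _) (_ ∷ _ ∷ _) = refl

      line-affine : ∀ {m} a c l (x : V m) → IsAffine {1} (λ { (y ∷ []) → c ⊹ l ⊗ (y ⊖ a) ∷ y ∷ x })
      line-affine a c l x s (y₁ ∷ []) (y₂ ∷ []) (y₃ ∷ []) = cong₂ _∷_
        (solve 7 (λ a c l s y₁ y₂ y₃ → c :+ l :* ((y₁ :+ s :* (y₂ :- y₃)) :- a) :=
           (c :+ l :* (y₁ :- a)) :+ s :* ((c :+ l :* (y₂ :- a)) :- (c :+ l :* (y₃ :- a)))) refl a c l s y₁ y₂ y₃)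
        (cong (cmb s y₁ y₂ y₃ ∷_) (sym (cmbV-fixed s x x)))

      -- A nonzero polynomial in one variable of degree less than q - 1 has at least two nonzero
      -- values: the minimum weight with k = 2.
      vanishes-on-line : ∀ {k} (φ : V 1 → K) → Pol k φ → suc k ≤ q → (∀ y y′ → y ≢ y′ → φ (y ∷ []) ≢ 𝟘 → φ (y′ ∷ []) ≡ 𝟘) → ∀ y → φ (y ∷ []) ≡ 𝟘
      vanishes-on-line {k} φ p k≤ unique y with zero? φ
      ... | yes z = z (y ∷ [])
      ... | no nz with nonzero-point nz
      ... | (y₁ ∷ []) , ne = ⊥-elim (n≮n 1 (≤-trans (minimum-weight 0 0 0 refl φ 2 p (+-monoˡ-≤ 2 (≤-trans (≤-pred k≤) (≤-reflexive (sym 1*Q≡Q))))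
          (s≤s (≤-trans (n≤1+n 1) 2≤Q)) nz)
        (≤-trans (≤-reflexive (wt-single {f = φ} {y₁} (λ { y y≢ [] → unique y₁ y (λ e → y≢ (sym e)) ne }))) (wt-upper (φ ↾ y₁)))))

      slope-quotient : ∀ {m k} → (f : V (suc (suc m)) → K) → Pol (suc k) f → ∀ a l c → (∀ y x → f (y ∷ c ⊹ l ⊗ (y ⊖ a) ∷ x) ≡ 𝟘) →
        ∃ λ h → Pol k h × (∀ y u x → f (y ∷ u ⊹ l ⊗ (y ⊖ a) ∷ x) ≡ (u ⊖ c) ⊗ h (y ∷ u ∷ x))
      slope-quotient f p a l c z with pol-divide (pol-iso (pencil-iso a l) p) c
      ... | h , ph , eh = h ∘ swap , pol-pull swap-affine ph , λ y u x →
          trans (eh u (y ∷ x)) (trans (cong ((u ⊖ c) ⊗ h (u ∷ y ∷ x) ⊹_) (z y x)) (R.+-identityʳ _))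

    -- Each of k hyperplanes of distinct slopes on which f vanishes can be divided out in turn.
    vanishes-on-pencil : ∀ {m} k → k ≤ q → (f : V (suc (suc m)) → K) → Pol k f → ∀ a (l : Fin k → K) → (∀ {i j} → l i ≡ l j → i ≡ j) →
                         (∀ i → ∃ λ c → ∀ y x → f (y ∷ c ⊹ l i ⊗ (y ⊖ a) ∷ x) ≡ 𝟘) → Zero f
    vanishes-on-pencil zero    k≤q f p a l inj z = pol-0 p
    vanishes-on-pencil {m} (suc k) k≤q f p a l inj z = divide (slope-quotient f p a (l zero) (proj₁ (z zero)) (proj₂ (z zero)))
      where
      l₀ c₀ : K
      l₀ = l zero
      c₀ = proj₁ (z zero)
      divide : (∃ λ h → Pol k h × (∀ y u x → f (y ∷ u ⊹ l₀ ⊗ (y ⊖ a) ∷ x) ≡ (u ⊖ c₀) ⊗ h (y ∷ u ∷ x))) → Zero f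
      divide (h , ph , eh) (y ∷ w ∷ x) = trans (cong (λ v → f (y ∷ v ∷ x)) (solve 2 (λ w v → w := (w :- v) :+ v) refl w (l₀ ⊗ (y ⊖ a))))
          (trans (eh y (w ⊖ l₀ ⊗ (y ⊖ a)) x) (trans (cong ((w ⊖ l₀ ⊗ (y ⊖ a) ⊖ c₀) ⊗_) (h-zero (y ∷ _ ∷ x))) (R.zeroʳ _)))
        where
        h-zero : Zero h
        -- In the sheared coordinates of the quotient the remaining hyperplanes have the slopes l -
        -- l₀, still distinct, and the same constants c.
        h-zero = vanishes-on-pencil k (≤-trans (n≤1+n k) k≤q) h ph a (λ i → l (suc i) ⊖ l₀)
          (λ {i} {j} e → sucF-injective (inj (trans (solve 2 (λ u v → u := (u :- v) :+ v) refl (l (suc i)) l₀)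
             (trans (cong (_⊹ l₀) e) (solve 2 (λ u v → (u :- v) :+ v := u) refl (l (suc j)) l₀)))))
          (λ i → proj₁ (z (suc i)) , λ y x → on-line i x y)
          where
          module _ (i : Fin k) (x : V m) where
            s c : K
            s = l (suc i) ⊖ l₀
            c = proj₁ (z (suc i))
            φ : V 1 → K
            φ (y ∷ []) = h (y ∷ c ⊹ s ⊗ (y ⊖ a) ∷ x)
            s≢0 : s ≢ 𝟘
            s≢0 e = case inj {suc i} {zero} (⊖-zero e) of λ ()
            product-zero : ∀ y → (c ⊹ s ⊗ (y ⊖ a) ⊖ c₀) ⊗ φ (y ∷ []) ≡ 𝟘
            product-zero y = trans (sym (eh y (c ⊹ s ⊗ (y ⊖ a)) x))
              (trans (cong (λ v → f (y ∷ v ∷ x)) (solve 5 (λ c l l₀ y a → (c :+ (l :- l₀) :* (y :- a)) :+ l₀ :* (y :- a) := c :+ l :* (y :- a)) refl c (l (suc i)) l₀ y a))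
                (proj₂ (z (suc i)) y x))
            -- The factor that multiplies φ is affine in y with slope s ≠ 0, hence zero at one y at
            -- most. So φ has at most one nonzero value, too few for its degree.
            on-line : ∀ y → φ (y ∷ []) ≡ 𝟘
            on-line = vanishes-on-line φ (pol-ext (λ { (y ∷ []) → refl }) (pol-pull (line-affine a c s x) (pol-pull swap-affine ph))) k≤q one-nonzero
              where
              at-c₀ : ∀ y → φ (y ∷ []) ≢ 𝟘 → c ⊹ s ⊗ (y ⊖ a) ≡ c₀
              at-c₀ y ne with (c ⊹ s ⊗ (y ⊖ a)) ≟F c₀
              ... | yes e = e
              ... | no u≢ = ⊥-elim (ne (⊗-cancel-zero (⊖-nonzero u≢) (product-zero y)))
              one-nonzero : ∀ y y′ → y ≢ y′ → φ (y ∷ []) ≢ 𝟘 → φ (y′ ∷ []) ≡ 𝟘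
              one-nonzero y y′ y≢y′ ne = ⊗-cancel-zero (⊖-nonzero (λ e′ → y≢y′ (⊖-zero (⊗-cancel-zero s≢0
                (trans (solve 5 (λ c s a y y′ → s :* (y :- y′) := (c :+ s :* (y :- a)) :- (c :+ s :* (y′ :- a))) refl c s a y y′)
                  (trans (cong₂ _⊖_ (at-c₀ y ne) e′) (⊖-self c₀))))))) (product-zero y′)

  open PencilZeros

  -- The case t = 1: classification

  module HypersurfaceClassification where

    abstract
      punctured : ∀ {m} {h : V (suc m) → K} c → (∀ z x → z ≢ c → h (z ∷ x) ≢ 𝟘) → Q * q ^ m ≤ wt h
      punctured {m} {h} c ne = ≤-trans (sumF-lower (λ j → ≤-reflexive (sym (wt-full (λ x → ne (punchIn c j) x (punchInᵢ≢i c j))))))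
        (≤-trans (m≤n+m _ (wt (h ↾ c))) (≤-reflexive (sym (trans (wt-suc h) (sumF-punch (λ z → wt (h ↾ z)) c)))))

      configuration-slice : ∀ {n} {h : V (suc (suc n)) → K} → Configuration h → ∃ λ a → Q * q ^ n ≤ wt (h ↾ a)
      configuration-slice (parallel a b c _ _ if) = a , punctured c (λ z x z≢c → if a z x (inj₁ refl , z≢c))
      configuration-slice (crossing b c _ if)     = b , punctured c (λ z x z≢c → if b z x (inj₁ (refl , z≢c)))

    module Hypersurfaces (n : ℕ) (gap : Gap 0 n n) (ih : ∀ n′ → n ≡ suc n′ → ClassifiesHypersurfaces n′) where

      open PencilArgument 0 n n refl gap {LowWeightForm} (low-weight-closed n)

      abstract
        light? : ∀ (f : V (suc (suc n)) → K) → (∃ λ a → wt (f ↾ a) ≡ U) ⊎ (∀ a → wt (f ↾ a) ≢ U)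
        light? f with any? (λ a → wt (f ↾ a) ≟ U)
        ... | yes l = inj₁ l
        ... | no none = inj₂ (λ a w → none (a , w))

      module Missed {f : V (suc (suc n)) → K} (p : Degree f) (nf : ¬ Zero f) (3≤Q : 3 ≤ Q) (σ≡ : wt f ≡ 2 * Q * U) (a c : K) (wa : wt (f ↾ a) ≡ 2 * U)
                    (ψ : Iso (suc n)) (wc : wt (λ x → f (a ∷ to ψ (c ∷ x))) ≡ U) where
        f₁ : V (suc (suc n)) → K
        f₁ = f ∘ to (ext-iso ψ)

        θ : K → Iso (suc (suc n))
        θ l = ext-iso ψ ∘I pencil-iso a l

        N : K → ℕ
        N l = wt ((f ∘ to (θ l)) ↾ c)

        Balanced Missing : K → Set
        Balanced l = ∀ b → q * wt ((f ∘ to (θ l)) ↾ b) ≡ 2 * Q * U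
        Missing l = ∃ λ b → Zero ((f ∘ to (θ l)) ↾ b)

        abstract
          total : sumF N + 2 * U ≡ q * U + 2 * Q * U
          total = trans (cong (sumF N +_) (sym (trans (wt-iso ψ (f ↾ a)) wa)))
            (trans (pencil-sum f₁ a c) (cong₂ (λ u v → q * u + v) wc (trans (wt-iso (ext-iso ψ) f) σ≡)))

          -- By `total` the q sloped hyperplanes have (3Q - 1)U points in sum. One balanced class
          -- contributes 2QU/q and the others at most 2U each, and 2Q + 2Q/q < 3Q - 1 for Q ≥ 3.
          balanced-impossible : (∀ l → N l ≤ 2 * U) → (∃ λ l → Balanced l) → ⊥
          balanced-impossible N≤ (l , bal) = too-small Q U (N l) 3≤Q (q^-pos n) (bal c)
            (≤-trans (≤-reflexive (trans (sym total) (cong (_+ 2 * U) (sumF-punch N l))))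
              (+-monoˡ-≤ (2 * U) (+-monoʳ-≤ (N l) (sumF-upper (λ j → N≤ (punchIn l j))))))
            where
            too-small : ∀ Q U N → 3 ≤ Q → 1 ≤ U → suc Q * N ≡ 2 * Q * U → suc Q * U + 2 * Q * U ≤ N + Q * (2 * U) + 2 * U → ⊥
            too-small (suc (suc (suc Q))) (suc U) N (s≤s (s≤s (s≤s z≤n))) _ e h = absurd-≤ (*-monoʳ-≤ (4 + Q) h)
              ((2 + 4 * Q + Q * Q) * suc U ∸ 1) (trans (cong ((4 + Q) * (N + (3 + Q) * (2 * suc U) + 2 * suc U) +_) (m+[n∸m]≡n {1} (s≤s z≤n)))
                (trans (eq₁ Q U N) (trans (cong (_+ ((4 + Q) * ((3 + Q) * (2 * suc U) + 2 * suc U) + (2 + 4 * Q + Q * Q) * suc U)) e) (eq₂ Q U))))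
              where
              eq₁ : ∀ Q U N → (4 + Q) * (N + (3 + Q) * (2 * suc U) + 2 * suc U) + (2 + 4 * Q + Q * Q) * suc U ≡
                              (4 + Q) * N + ((4 + Q) * ((3 + Q) * (2 * suc U) + 2 * suc U) + (2 + 4 * Q + Q * Q) * suc U)
              eq₁ = solve-∀
              eq₂ : ∀ Q U → 2 * (3 + Q) * suc U + ((4 + Q) * ((3 + Q) * (2 * suc U) + 2 * suc U) + (2 + 4 * Q + Q * Q) * suc U) ≡
                            (4 + Q) * ((4 + Q) * suc U + 2 * (3 + Q) * suc U)
              eq₂ = solve-∀

          -- Each slope has a hyperplane on which f vanishes, and the degree is less than q. Weights
          -- alone would not do: for q = 4 every sloped hyperplane weighing 2U is consistent with
          -- `total`.
          missing-impossible : (∀ l → Missing l) → ⊥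
          missing-impossible missing = nf (Zero-iso (ext-iso ψ) {f} (vanishes-on-pencil q ≤-refl f₁
            (subst (λ d → Pol d f₁) (cong suc 1*Q≡Q) (pol-iso (ext-iso ψ) p)) a id id
            (λ l → proj₁ (missing l) , λ y x → proj₂ (missing l) (y ∷ x))))

          classify : ∀ l → LowWeightForm f ⊎ (N l ≤ 2 * U × (Balanced l ⊎ Missing l))
          classify l = by-profile (profile 0 n refl g pg ng σg)
            where
            g : V (suc (suc n)) → K
            g = f ∘ to (θ l)
            pg : Degree g
            pg = pol-iso (θ l) p
            ng : ¬ Zero g
            ng z = nf (Zero-iso (θ l) {f} z)
            σg : wt g ≤ 2 * Q * U
            σg = ≤-reflexive (trans (wt-iso (θ l) f) σ≡)
            Result : Set
            Result = LowWeightForm f ⊎ (N l ≤ 2 * U × (Balanced l ⊎ Missing l))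
            done : LowWeightForm g → Result
            done r = inj₁ (low-weight-iso (θ l) r)
            at-most : (∀ b → ¬ Zero (g ↾ b) → wt (g ↾ b) ≡ 2 * U) → Dec (Zero (g ↾ c)) → N l ≤ 2 * U
            at-most s (yes z) = ≤-trans (≤-reflexive (Zero⇒wt≡0 z)) z≤n
            at-most s (no nz) = ≤-reflexive (s c nz)
            by-light : #zero g ≡ 0 → (∃ λ b → wt (g ↾ b) ≡ U) ⊎ (∀ b → wt (g ↾ b) ≢ U) → Result
            by-light Z≡0 (inj₁ (b , light)) = done (light-slice pg ng σg light)
            by-light Z≡0 (inj₂ none) = inj₂ (*-cancelˡ-≤ q (≤-trans (≤-reflexive (balanced pg σg Z≡0 none c)) (le (2 * U) (eq Q U)))
                                            , inj₁ (balanced pg σg Z≡0 none))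
              where
              eq : ∀ Q U → 2 * Q * U + 2 * U ≡ suc Q * (2 * U)
              eq = solve-∀
            by-profile : Profile U g → Result
            by-profile (one κ≡1) = done (Closed.res-one (low-weight-closed n) pg ng κ≡1)
            by-profile (two κ≡2 s) = done (Closed.res-two (low-weight-closed n) pg σg κ≡2 s)
            by-profile (all-but-one Z≡1 _ s _) = inj₂ (at-most s (zero? (g ↾ c)) , inj₂ (zero-slice g (≤-reflexive (sym Z≡1))))
            by-profile (all Z≡0) = by-light Z≡0 (light? g)

          result : LowWeightForm f
          result with choose-all classify
          ... | inj₁ r = r
          ... | inj₂ d with choose-all {B = Missing} (λ l → first l (proj₂ (d l)))
            where
            first : ∀ l → Balanced l ⊎ Missing l → (∃ λ l → Balanced l) ⊎ Missing l
            first l (inj₁ b) = inj₁ (l , b)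
            first l (inj₂ m) = inj₂ m
          ... | inj₁ b = ⊥-elim (balanced-impossible (λ l → proj₁ (d l)) b)
          ... | inj₂ missing = ⊥-elim (missing-impossible missing)

      abstract
        missed-hyperplane : ∀ {f : V (suc (suc n)) → K} → Degree f → ¬ Zero f → #zero f ≡ 1 → 3 ≤ Q →
                            (∀ a → ¬ Zero (f ↾ a) → wt (f ↾ a) ≡ 2 * U) → wt f ≡ 2 * Q * U → LowWeightForm f
        missed-hyperplane {f} p nf Z≡1 3≤Q s σ≡ with nonzero-slice nf
        ... | a , na with minimal-parallel n (f ↾ a) 2 (subst (λ Z → Pol (suc (1 * Q) ∸ Z) (f ↾ a)) Z≡1 (pol-slice-∸ p a)) ≤-refl (s≤s z≤n) 2≤Q (s a na)
        ... | ψ , _ , const with nonzero-slice {f = (f ↾ a) ∘ to ψ} (λ z → na (Zero-iso ψ {f ↾ a} z))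
        ... | c , nc with const c nc
        ... | κ , κ≢0 , e = Missed.result p nf 3≤Q σ≡ a c (s a na) ψ (wt-const κ≢0 e)

        -- In the remaining case all slices have weight 2 Q U / q; the pencil through a heavy subspace of a slice leaves this case.
        balanced-slices : ∀ {f : V (suc (suc n)) → K} → Degree f → ¬ Zero f → wt f ≤ 2 * Q * U → #zero f ≡ 0 → (∀ b → wt (f ↾ b) ≢ U) → ∀ n′ → n ≡ n′ → LowWeightForm f
        balanced-slices {f} p nf σ≤ Z≡0 none zero refl = absurd-≤ (≤-trans (*-monoʳ-≤ q 2≤w) (≤-reflexive (balanced p σ≤ Z≡0 none zero))) 1 (eq Q)
          where
          2≤w : 2 ≤ wt (f ↾ zero)
          2≤w = ≤∧≢⇒< (wt-pos (#zero≡0 Z≡0 zero)) (λ 1≡w → none zero (sym 1≡w))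
          eq : ∀ Q → 2 * Q * 1 + 2 ≡ suc Q * 2
          eq = solve-∀
        balanced-slices {f} p nf σ≤ Z≡0 none (suc n′) refl = by-slice (ih n′ refl (f ↾ zero) (pol-slice zero p) (#zero≡0 Z≡0 zero)
            (*-cancelˡ-≤ q (≤-trans (≤-reflexive (balanced p σ≤ Z≡0 none zero)) (≤-reflexive (eq q Q (q ^ n′))))))
          where
          eq : ∀ q Q U → 2 * Q * (q * U) ≡ q * (2 * Q * U)
          eq = solve-∀
          W : ℕ
          W = q ^ n′
          -- With `A` = 2QW the inequality of the pencil reduces to q QW ≤ 2QW, that is q ≤ 2.
          too-small : ∀ Q W M N A S → 2 ≤ Q → 1 ≤ W → Q * W ≤ M → 2 * Q * (suc Q * W) ≤ S → suc Q * A ≡ 2 * Q * (suc Q * W) → suc Q * N ≡ 2 * Q * (suc Q * W) →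
                      suc Q * M + S ≤ suc Q * N + A → ⊥
          too-small (suc (suc Q)) (suc W) M N A S (s≤s (s≤s z≤n)) _ hM hS hA hN h = absurd-≤ (+-mono-≤ (+-mono-≤ h′ (*-monoʳ-≤ (3 + Q) hM)) hS)
            ((2 + 3 * Q + Q * Q) * suc W ∸ 1) (trans (cong (2 * (2 + Q) * ((3 + Q) * suc W) + 2 * (2 + Q) * suc W + (3 + Q) * M + S +_) (m+[n∸m]≡n {1} (s≤s z≤n))) (eq₁ Q W M S))
            where
            A≡ : A ≡ 2 * (2 + Q) * suc W
            A≡ = *-cancelˡ-≡ A _ (3 + Q) (trans hA (eq₂ Q W))
              where
              eq₂ : ∀ Q W → 2 * (2 + Q) * ((3 + Q) * suc W) ≡ (3 + Q) * (2 * (2 + Q) * suc W)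
              eq₂ = solve-∀
            h′ : (3 + Q) * M + S ≤ 2 * (2 + Q) * ((3 + Q) * suc W) + 2 * (2 + Q) * suc W
            h′ = ≤-trans h (≤-reflexive (cong₂ _+_ hN A≡))
            eq₁ : ∀ Q W M S → 2 * (2 + Q) * ((3 + Q) * suc W) + 2 * (2 + Q) * suc W + (3 + Q) * M + S + (2 + 3 * Q + Q * Q) * suc W ≡
                              (3 + Q) * M + S + (3 + Q) * ((2 + Q) * suc W) + 2 * (2 + Q) * ((3 + Q) * suc W)
            eq₁ = solve-∀
          by-slice : LowWeightForm (f ↾ zero) → LowWeightForm f
          by-slice (inj₁ w) = ⊥-elim (none zero w)
          by-slice (inj₂ (ψ , conf)) with configuration-slice conf
          ... | c , big with pencil-max (f ∘ to (ext-iso ψ)) zero c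
          ... | l , large = low-weight-iso {f = f} θ (by-profile (profile 0 n refl g pg ng σg))
            where
            θ : Iso (suc (suc n))
            θ = ext-iso ψ ∘I pencil-iso zero l
            g : V (suc (suc n)) → K
            g = f ∘ to θ
            pg : Degree g
            pg = pol-iso θ p
            ng : ¬ Zero g
            ng z = nf (Zero-iso θ {f} z)
            σg : wt g ≤ 2 * Q * U
            σg = ≤-trans (≤-reflexive (wt-iso θ f)) σ≤
            σ≥ : 2 * Q * U ≤ wt f
            σ≥ = *-cancelˡ-≤ q (≤-trans (sumF-lower {c = 2 * Q * U} (λ b → ≤-reflexive (sym (balanced p σ≤ Z≡0 none b))))
              (≤-reflexive (trans (sumF-* q (λ b → wt (f ↾ b))) (cong (q *_) (sym (wt-suc f))))))
            by-profile : Profile U g → LowWeightForm g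
            by-profile (one κ≡1) = Closed.res-one (low-weight-closed n) pg ng κ≡1
            by-profile (two κ≡2 s) = Closed.res-two (low-weight-closed n) pg σg κ≡2 s
            by-profile (all-but-one Z≡1 3≤Q s σ≡) = missed-hyperplane pg ng Z≡1 3≤Q s σ≡
            by-profile (all Zg≡0) with light? g
            ... | inj₁ (b , light) = light-slice pg ng σg light
            ... | inj₂ none′ = ⊥-elim (too-small Q W (wt (λ x → f (zero ∷ to ψ (c ∷ x)))) (wt (g ↾ c)) (wt (f ↾ zero)) (wt f) 2≤Q (q^-pos n′)
                    big σ≥ (balanced p σ≤ Z≡0 none zero) (balanced pg σg Zg≡0 none′ c)
                    (subst₂ (λ u v → q * wt (λ x → f (zero ∷ to ψ (c ∷ x))) + u ≤ q * wt (g ↾ c) + v) (wt-iso (ext-iso ψ) f) (wt-iso ψ (f ↾ zero)) large))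

        classifies-hypersurfaces : ClassifiesHypersurfaces n
        classifies-hypersurfaces f p nf σ≤ = by-profile (profile 0 n refl f p nf σ≤)
          where
          by-profile : Profile U f → LowWeightForm f
          by-profile (one κ≡1) = Closed.res-one (low-weight-closed n) p nf κ≡1
          by-profile (two κ≡2 s) = Closed.res-two (low-weight-closed n) p σ≤ κ≡2 s
          by-profile (all-but-one Z≡1 3≤Q s σ≡) = missed-hyperplane p nf Z≡1 3≤Q s σ≡
          by-profile (all Z≡0) with light? f
          ... | inj₁ (b , light) = light-slice p nf σ≤ light
          ... | inj₂ none = balanced-slices p nf σ≤ Z≡0 none n refl

  open HypersurfaceClassification

  -- The mutual induction

  module Classification where

    abstract
      configuration-weight : ∀ {n} {f : V (suc (suc n)) → K} → Configuration f → 2 * Q * q ^ n ≤ wt f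
      configuration-weight {n} {f} (parallel a b c a≢b _ if) = ≤-trans (≤-reflexive (eq Q (q ^ n)))
        (≤-trans (+-mono-≤ (punctured {h = f ↾ a} c (λ z x z≢c → if a z x (inj₁ refl , z≢c))) (punctured {h = f ↾ b} c (λ z x z≢c → if b z x (inj₂ refl , z≢c))))
          (≤-trans (sumF-terms (λ y → wt (f ↾ y)) a≢b) (≤-reflexive (sym (wt-suc f)))))
        where
        eq : ∀ Q U → 2 * Q * U ≡ Q * U + Q * U
        eq = solve-∀
      configuration-weight {n} {f} (crossing b c _ if) = ≤-trans (≤-reflexive (eq Q (q ^ n)))
        (≤-trans (+-mono-≤ (punctured {h = f ↾ b} c (λ z x z≢c → if b z x (inj₁ (refl , z≢c))))
            (sumF-lower (λ j → ≤-trans (≤-reflexive (sym (wt-full (λ x → if (punchIn b j) c x (inj₂ (punchInᵢ≢i b j , refl))))))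
              (≤-trans (sumF-term (λ z → wt (λ x → f (punchIn b j ∷ z ∷ x))) c) (≤-reflexive (sym (wt-suc (f ↾ punchIn b j))))))))
          (≤-reflexive (sym (trans (wt-suc f) (sumF-punch (λ y → wt (f ↾ y)) b)))))
        where
        eq : ∀ Q U → 2 * Q * U ≡ Q * U + Q * U
        eq = solve-∀

      hyperplane-degree : ∀ {m t} {f : V (suc m) → K} → Pol (suc (suc t * Q)) f → ∀ {c} → (∀ y → y ≢ c → Zero (f ↾ y)) → Pol (suc (t * Q)) (f ↾ c)
      hyperplane-degree {t = t} {f} p {c} z = pol-weaken (≤-trans (∸-monoʳ-≤ (suc (suc t * Q)) (#zero≥Q {f = f} z))
        (≤-reflexive (trans (cong (_∸ Q) (eq t Q)) (m+n∸n≡m (suc (t * Q)) Q)))) (pol-slice-∸ p c)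
        where
        eq : ∀ t Q → suc (suc t * Q) ≡ suc (t * Q) + Q
        eq = solve-∀

    -- The induction on n closes as follows: the gap at n + 1 rests on `low-weight` at n, this on
    -- `hypersurfaces` for t = 1 and on `spans` for larger t, and these two on the gap at n and on
    -- themselves at n - 1.
    gap : ∀ n t₀ m → m ≡ t₀ + n → Gap t₀ n m
    low-weight : ∀ n t₀ m → m ≡ t₀ + suc n → (h : V (suc m) → K) → Pol (suc (suc t₀ * Q)) h → ¬ Zero h → suc (wt h) ≤ 2 * Q * q ^ n → wt h ≡ q ^ suc n
    spans : ∀ n t₁ m → m ≡ t₁ + n → SpansHyperplane t₁ n m
    spans-below : ∀ n t₁ m → m ≡ t₁ + n → ∀ n′ → n ≡ suc n′ → (h : V (suc (suc m)) → K) → Pol (suc (suc (suc t₁) * Q)) h → wt h ≤ 2 * Q * q ^ n′ → InHyperplane h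
    hypersurfaces : ∀ n → ClassifiesHypersurfaces n
    hypersurfaces-below : ∀ n n′ → n ≡ suc n′ → ClassifiesHypersurfaces n′

    gap zero t₀ m e h p with wt h
    ... | 0           = inj₁ refl
    ... | 1           = inj₂ (inj₁ refl)
    ... | suc (suc w) = inj₂ (inj₂ (le (Q * w + (2 + w)) (eq Q w)))
      where
      eq : ∀ Q w → 2 * Q * 1 + (Q * w + (2 + w)) ≡ suc Q * suc (suc w)
      eq = solve-∀
    gap (suc n) t₀ m e h p with 2 * Q * q ^ suc n ≤? q * wt h | zero? h
    ... | yes big | _     = inj₂ (inj₂ big)
    ... | no _    | yes z = inj₁ (Zero⇒wt≡0 z)
    ... | no ≰    | no nz = inj₂ (inj₁ (low-weight n t₀ m e h p nz (*-cancelˡ-< q _ _ (≤-trans (≰⇒> ≰) (≤-reflexive (eq q Q (q ^ n)))))))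
      where
      eq : ∀ q Q U → 2 * Q * (q * U) ≡ q * (2 * Q * U)
      eq = solve-∀

    low-weight n zero m refl h p nz small with hypersurfaces n h p nz (<⇒≤ small)
    ... | inj₁ w = w
    ... | inj₂ (φ , conf) = ⊥-elim (n≮n _ (≤-trans small (≤-trans (configuration-weight conf) (≤-reflexive (wt-iso φ h)))))
    low-weight n (suc t₁) zero () h p nz small
    low-weight n (suc t₁) (suc zero) e h p nz small with () ← trans (suc-injective e) (+-suc t₁ n)
    low-weight n (suc t₁) (suc (suc m)) e h p nz small with spans n t₁ m (suc-injective (trans (suc-injective e) (+-suc t₁ n))) h p (<⇒≤ small)
    ... | φ , c , z = trans (sym wt-slice) (low-weight n t₁ (suc m) (suc-injective e) ((h ∘ to φ) ↾ c) (hyperplane-degree {t = suc t₁} (pol-iso φ p) z)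
            (wt-nonzero (≤-trans (wt-pos nz) (≤-reflexive (sym wt-slice)))) (≤-trans (s≤s (≤-reflexive wt-slice)) small))
      where
      wt-slice : wt ((h ∘ to φ) ↾ c) ≡ wt h
      wt-slice = trans (sym (wt-single {f = h ∘ to φ} z)) (wt-iso φ h)

    spans n t₁ m e = HighCodimension.spans-hyperplane t₁ n m e (gap n (suc t₁) (suc m) (cong suc e)) (spans-below n t₁ m e)

    spans-below (suc n) t₁ zero    e n′ refl with () ← trans e (+-suc t₁ n)
    spans-below (suc n) t₁ (suc m) e n′ refl = spans n t₁ m (suc-injective (trans e (+-suc t₁ n)))

    hypersurfaces n = Hypersurfaces.classifies-hypersurfaces n (gap n 0 n refl) (hypersurfaces-below n)

    hypersurfaces-below (suc n) n′ refl = hypersurfaces n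

    -- `ι` parametrises the subspace of codimension t - 1 in the theorem, with the coordinates y and
    -- z of the configuration first.
    record Shape {m : ℕ} (n : ℕ) (f : V m → K) : Set where
      field
        ι : V (suc (suc n)) → V m
        ι-affine : IsAffine ι
        ι-injective : ∀ {u v} → ι u ≡ ι v → u ≡ v
        support : ∀ x → f x ≢ 𝟘 → ∃ λ v → x ≡ ι v
        configuration : Configuration (f ∘ ι)

    abstract
      second-weight-shape : ∀ t₀ n m → m ≡ t₀ + n → (f : V (suc (suc m)) → K) → Pol (suc (suc t₀ * Q)) f → wt f ≡ 2 * Q * q ^ n → Shape n f
      second-weight-shape zero n m refl f p w with hypersurfaces n f p (nonzero-of-wt {f = f} {n = n} (≤-trans 0<Q (m≤m+n Q _)) w) (≤-reflexive w)
      -- A single hyperplane has q · q^n points, and q < 2(q - 1) as q ≥ 3.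
      ... | inj₁ w′ = absurd-≤ (≤-reflexive (sym (*-cancelʳ-≡ (suc Q) (2 * Q) (q ^ n) {{>-nonZero (q^-pos n)}} (trans (sym w′) w)))) (Q ∸ 2)
            (trans (eq Q (Q ∸ 2)) (cong (Q +_) (trans (m+[n∸m]≡n 2≤Q) (sym (+-identityʳ Q)))))
        where
        eq : ∀ Q d → suc Q + suc d ≡ Q + (2 + d)
        eq = solve-∀
      ... | inj₂ (φ , conf) = record
        { ι = to φ ; ι-affine = affine φ
        ; ι-injective = λ {u} {v} e → trans (sym (from-to φ u)) (trans (cong (from φ) e) (from-to φ v))
        ; support = λ x _ → from φ x , sym (to-from φ x) ; configuration = conf }
      second-weight-shape (suc t₁) n zero    () f p w
      second-weight-shape (suc t₁) n (suc m) e f p w with spans n t₁ m (suc-injective e) f p (≤-reflexive w)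
      ... | φ , c , z with second-weight-shape t₁ n m (suc-injective e) ((f ∘ to φ) ↾ c) (hyperplane-degree {t = suc t₁} (pol-iso φ p) z)
                           (trans (sym (wt-single {f = f ∘ to φ} z)) (trans (wt-iso φ f) w))
      ... | shape = record
        { ι = λ v → to φ (c ∷ ι v)
        ; ι-affine = λ s x y z → trans (cong (λ u → to φ (c ∷ u)) (ι-affine s x y z)) (trans (cong (to φ) (cons-affine c s _ _ _)) (affine φ s _ _ _))
        ; ι-injective = λ {u} {v} e → ι-injective (cong tail (trans (sym (from-to φ (c ∷ ι u))) (trans (cong (from φ) e) (from-to φ (c ∷ ι v)))))
        ; support = λ x fx → let (v , e) = inside (from φ x) (λ fz → fx (trans (cong f (sym (to-from φ x))) fz)) in v , trans (sym (to-from φ x)) (cong (to φ) e)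
        ; configuration = configuration }
        where
        open Shape shape
        inside : ∀ y → f (to φ y) ≢ 𝟘 → ∃ λ v → y ≡ c ∷ ι v
        inside (y ∷ x) ne with y ≟F c
        ... | no y≢c = ⊥-elim (ne (z y y≢c x))
        ... | yes refl with support x ne
        ... | v , e = v , cong (c ∷_) e

  open Classification

  -- From polynomials and points as functions to vectors and affine subspaces

  module AffineSubspaces where

    module P = FF F

    abstract
      sumFin-cong : ∀ n {g h : Fin n → K} → (∀ i → g i ≡ h i) → P.sumFin n g ≡ P.sumFin n h
      sumFin-cong zero    e = refl
      sumFin-cong (suc n) e = cong₂ _⊹_ (e zero) (sumFin-cong n (λ i → e (suc i)))

      prodFin-cong : ∀ n {g h : Fin n → K} → (∀ i → g i ≡ h i) → P.prodFin n g ≡ P.prodFin n h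
      prodFin-cong zero    e = refl
      prodFin-cong (suc n) e = cong₂ _⊗_ (e zero) (prodFin-cong n (λ i → e (suc i)))

      sumPt-cong : ∀ k {g h : P.Pt k → K} → (∀ e → g e ≡ h e) → P.sumPt k g ≡ P.sumPt k h
      sumPt-cong zero    e = e (λ ())
      sumPt-cong (suc k) e = sumFin-cong q (λ a → sumPt-cong k (λ x → e (a VF.∷ x)))

      eval-cong : ∀ {m} (c : P.RedPoly m) {x y : P.Pt m} → (∀ i → x i ≡ y i) → P.eval c x ≡ P.eval c y
      eval-cong {m} c x≐y = sumPt-cong m (λ e → cong (c e ⊗_) (prodFin-cong m (λ i → cong (λ a → P.pow a (toℕ (e i))) (x≐y i))))

      sumFin-pol : ∀ {m d} n {g : Fin n → V m → K} → (∀ i → Pol d (g i)) → Pol d (λ v → P.sumFin n (λ i → g i v))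
      sumFin-pol zero    p = zeroP (λ _ → refl)
      sumFin-pol (suc n) p = addP (p zero) (sumFin-pol n (λ i → p (suc i))) (λ _ → refl)

      sumPt-pol : ∀ {m d} k {g : P.Pt k → V m → K} → (∀ e → Pol d (g e)) → Pol d (λ v → P.sumPt k (λ e → g e v))
      sumPt-pol zero    p = p (λ ())
      sumPt-pol (suc k) p = sumFin-pol q (λ a → sumPt-pol k (λ e → p (a VF.∷ e)))

      pow-pol : ∀ {m d} {f : V m → K} i a → Pol d f → Pol (a + d) (λ v → P.pow (lookup v i) a ⊗ f v)
      pow-pol i zero    p = pol-ext (λ v → R.*-identityˡ _) p
      pow-pol i (suc a) p = varP i (pow-pol i a p) (λ v → R.*-assoc _ _ _)

      -- The renaming `ρ` makes the recursion on the number of factors possible while all variables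
      -- remain those of one space.
      monomial-pol : ∀ {m} k (ρ : Fin k → Fin m) (e : P.Pt k) → Pol (suc (P.totalDeg e)) (λ v → P.prodFin k (λ i → P.pow (lookup v (ρ i)) (toℕ (e i))))
      monomial-pol zero    ρ e = constP 𝟙 (λ _ → refl)
      monomial-pol (suc k) ρ e = pol-weaken (≤-reflexive (+-suc _ _)) (pow-pol (ρ zero) (toℕ (e zero)) (monomial-pol k (λ i → ρ (suc i)) (λ i → e (suc i))))

      reed-muller-pol : ∀ {r m f} → P.InRM r m f → Pol (suc r) (λ v → f (lookup v))
      reed-muller-pol {r} {m} (c , deg , e) = pol-ext (λ v → e (lookup v)) (sumPt-pol m term)
        where
        term : ∀ e → Pol (suc r) (λ v → c e ⊗ P.monomial e (lookup v))
        term e with c e ≟F 𝟘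
        ... | yes z = zeroP (λ v → trans (cong (_⊗ P.monomial e (lookup v)) z) (R.zeroˡ _))
        ... | no nz = pol-scale (c e) (pol-weaken (s≤s (deg e nz)) (monomial-pol m id e))

      -- A function on points might distinguish pointwise equal points; a word cannot, as it is
      -- given by a polynomial.
      reed-muller-extensional : ∀ {r m f} → P.InRM r m f → ∀ x → f x ≡ f (lookup (tabulate x))
      reed-muller-extensional (c , _ , e) x = trans (e x) (trans (eval-cong c (λ i → sym (lookup∘tabulate x i))) (sym (e _)))

      weight≡wt : ∀ {m} (f : P.Pt m → K) → (∀ x → f x ≡ f (lookup (tabulate x))) → P.weight f ≡ wt (λ v → f (lookup v))
      weight≡wt f ext = trans (countPt≡sumV F _ (λ v → not (does (f (lookup v) ≟F 𝟘))) (λ x → cong (λ a → not (does (a ≟F 𝟘))) (ext x)))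
        (sym (wt-indicator (λ v → f (lookup v))))

    unit : ∀ {d} → Fin d → V d
    unit zero    = 𝟙 ∷ 0V
    unit (suc i) = 𝟘 ∷ unit i

    abstract
      vec-ext : ∀ {m} {u v : V m} → (∀ i → lookup u i ≡ lookup v i) → u ≡ v
      vec-ext {u = []}    {[]}    e = refl
      vec-ext {u = a ∷ u} {b ∷ v} e = cong₂ _∷_ (e zero) (vec-ext (λ i → e (suc i)))

      lookup-0V : ∀ {m} i → lookup (0V {m}) i ≡ 𝟘
      lookup-0V zero    = refl
      lookup-0V (suc i) = lookup-0V i

      -- The first coordinate is split off as an affine combination of `𝟘 ∷ v`, the first unit
      -- vector and 0; recursion treats the rest.
      affine-coordinates : ∀ {d} (ℓ : V d → K) → (∀ s x y z → ℓ (cmbV s x y z) ≡ cmb s (ℓ x) (ℓ y) (ℓ z)) →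
                           ∀ v → ℓ v ≡ ℓ 0V ⊹ P.sumFin d (λ i → lookup v i ⊗ (ℓ (unit i) ⊖ ℓ 0V))
      affine-coordinates {zero}  ℓ aff []      = sym (R.+-identityʳ _)
      affine-coordinates {suc d} ℓ aff (a ∷ v) = begin
        ℓ (a ∷ v)
          ≡⟨ cong ℓ (sym (cong₂ _∷_ (cmb-unit a) (cmbV-fixed a v 0V))) ⟩
        ℓ (cmbV a (𝟘 ∷ v) (𝟙 ∷ 0V) (𝟘 ∷ 0V))
          ≡⟨ aff a (𝟘 ∷ v) (𝟙 ∷ 0V) (𝟘 ∷ 0V) ⟩
        ℓ (𝟘 ∷ v) ⊹ a ⊗ (ℓ (𝟙 ∷ 0V) ⊖ ℓ 0V)
          ≡⟨ cong (_⊹ a ⊗ (ℓ (𝟙 ∷ 0V) ⊖ ℓ 0V)) (affine-coordinates (λ x → ℓ (𝟘 ∷ x))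
               (λ s x y z → trans (cong (λ b → ℓ (b ∷ cmbV s x y z)) (sym (cmb-fixed s 𝟘 𝟘))) (aff s (𝟘 ∷ x) (𝟘 ∷ y) (𝟘 ∷ z))) v) ⟩
        ℓ 0V ⊹ S ⊹ a ⊗ (ℓ (𝟙 ∷ 0V) ⊖ ℓ 0V)
          ≡⟨ solve 3 (λ b s t → b :+ s :+ t := b :+ (t :+ s)) refl (ℓ 0V) S (a ⊗ (ℓ (𝟙 ∷ 0V) ⊖ ℓ 0V)) ⟩
        ℓ 0V ⊹ (a ⊗ (ℓ (𝟙 ∷ 0V) ⊖ ℓ 0V) ⊹ S) ∎
        where
        open ≡-Reasoning
        S : K
        S = P.sumFin d (λ i → lookup v i ⊗ (ℓ (𝟘 ∷ unit i) ⊖ ℓ 0V))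

    module Image {d m : ℕ} (ι : V d → V m) (ι-affine : IsAffine ι) (ι-injective : ∀ {u v} → ι u ≡ ι v → u ≡ v) where

      directions : Fin d → P.Pt m
      directions i j = lookup (ι (unit i)) j ⊖ lookup (ι 0V) j

      abstract
        image-coordinates : ∀ v j → lookup (ι v) j ≡ lookup (ι 0V) j ⊹ P.lincomb (lookup v) directions j
        image-coordinates v j = affine-coordinates (λ u → lookup (ι u) j)
          (λ s x y z → trans (cong (λ u → lookup u j) (ι-affine s x y z)) (lookup-cmbV s (ι x) (ι y) (ι z) j)) v

        lincomb-tabulate : ∀ (λs : Fin d → K) j → P.lincomb (lookup (tabulate λs)) directions j ≡ P.lincomb λs directions j
        lincomb-tabulate λs j = sumFin-cong d (λ i → cong (_⊗ directions i j) (lookup∘tabulate λs i))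

        independent : P.LinIndep directions
        independent λs e i = trans (sym (lookup∘tabulate λs i)) (trans (cong (λ v → lookup v i) (ι-injective {tabulate λs} {0V} (vec-ext same))) (lookup-0V i))
          where
          same : ∀ j → lookup (ι (tabulate λs)) j ≡ lookup (ι 0V) j
          same j = trans (image-coordinates (tabulate λs) j) (trans (cong (lookup (ι 0V) j ⊹_) (trans (lincomb-tabulate λs j) (e j))) (R.+-identityʳ _))

      image : P.AffSub m
      image = record { dim = d ; base = lookup (ι 0V) ; dirs = directions ; indep = independent }

      abstract
        member : ∀ {x} v → tabulate x ≡ ι v → x P.∈A image
        member {x} v e = lookup v , λ j → trans (sym (lookup∘tabulate x j)) (trans (cong (λ u → lookup u j) e) (image-coordinates v j))

        member⁻¹ : ∀ {x} → x P.∈A image → ∃ λ v → tabulate x ≡ ι v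
        member⁻¹ {x} (λs , e) = tabulate λs , vec-ext (λ j → trans (lookup∘tabulate x j) (trans (e j)
          (sym (trans (image-coordinates (tabulate λs) j) (cong (lookup (ι 0V) j ⊹_) (lincomb-tabulate λs j))))))

        direction : ∀ {w} v → (∀ j → w j ≡ lookup (ι v) j ⊖ lookup (ι 0V) j) → P.InDir image w
        direction {w} v e = lookup v , λ j → trans (e j) (trans (cong (_⊖ lookup (ι 0V) j) (image-coordinates v j))
          (solve 2 (λ a b → (a :+ b) :- a := b) refl (lookup (ι 0V) j) (P.lincomb (lookup v) directions j)))

        direction⁻¹ : ∀ {w} → P.InDir image w → ∃ λ v → ∀ j → w j ≡ lookup (ι v) j ⊖ lookup (ι 0V) j
        direction⁻¹ {w} (λs , e) = tabulate λs , λ j → trans (e j) (sym (trans (cong (_⊖ lookup (ι 0V) j) (image-coordinates (tabulate λs) j))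
          (trans (solve 2 (λ a b → (a :+ b) :- a := b) refl (lookup (ι 0V) j) (P.lincomb (lookup (tabulate λs)) directions j)) (lincomb-tabulate λs j))))

  open AffineSubspaces

  -- Rows and columns of a configuration as affine subspaces

  insert : ∀ {n} → K → V (suc n) → V (suc (suc n))
  insert c (y ∷ x) = y ∷ c ∷ x

  abstract
    insert-affine : ∀ {n} c → IsAffine {suc n} (insert c)
    insert-affine c s (y₁ ∷ x₁) (y₂ ∷ x₂) (y₃ ∷ x₃) = cong (λ a → cmb s y₁ y₂ y₃ ∷ a ∷ cmbV s x₁ x₂ x₃) (sym (cmb-fixed s c c))

    insert-injective : ∀ {n} c {u v : V (suc n)} → insert c u ≡ insert c v → u ≡ v
    insert-injective c {y ∷ x} {y′ ∷ x′} e = cong₂ _∷_ (cong head e) (cong (tail ∘ tail) e)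

  module Flats {m n : ℕ} (ι : V (suc (suc n)) → V m) (ι-affine : IsAffine ι) (ι-injective : ∀ {u v} → ι u ≡ ι v → u ≡ v) where

    module Whole = Image ι ι-affine ι-injective

    module Row (a : K) = Image (λ v → ι (a ∷ v)) (λ s x y z → trans (cong ι (cons-affine a s x y z)) (ι-affine s _ _ _))
                               (λ e → cong tail (ι-injective e))

    module Column (c : K) = Image (λ v → ι (insert c v)) (λ s x y z → trans (cong ι (insert-affine c s x y z)) (ι-affine s _ _ _))
                                  (λ e → insert-injective c (ι-injective e))

    abstract
      -- Injectivity of `ι` pulls an equality of difference vectors back to coordinates, where heads
      -- can be compared.
      translate : ∀ u v w w′ → (∀ j → lookup (ι u) j ⊖ lookup (ι v) j ≡ lookup (ι w) j ⊖ lookup (ι w′) j) → u ≡ cmbV 𝟙 v w w′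
      translate u v w w′ e = ι-injective (vec-ext (λ j → trans (solve 2 (λ a b → a := b :+ (a :- b)) refl (lookup (ι u) j) (lookup (ι v) j))
        (trans (cong (lookup (ι v) j ⊹_) (trans (e j) (sym (R.*-identityˡ _))))
          (sym (trans (cong (λ x → lookup x j) (ι-affine 𝟙 v w w′)) (lookup-cmbV 𝟙 (ι v) (ι w) (ι w′) j))))))

      rows-direction : ∀ a b w → P.InDir (Row.image a) w → P.InDir (Row.image b) w
      rows-direction a b w i with Row.direction⁻¹ a i
      ... | v , e = Row.direction b v (λ j → trans (e j) (sym (moved j)))
        where
        moved : ∀ j → lookup (ι (b ∷ v)) j ⊖ lookup (ι (b ∷ 0V)) j ≡ lookup (ι (a ∷ v)) j ⊖ lookup (ι (a ∷ 0V)) j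
        moved j = trans (cong (_⊖ lookup (ι (b ∷ 0V)) j) (trans (cong (λ x → lookup x j) (trans (cong ι (sym shifted)) (ι-affine 𝟙 (b ∷ 0V) (a ∷ v) (a ∷ 0V))))
              (lookup-cmbV 𝟙 (ι (b ∷ 0V)) (ι (a ∷ v)) (ι (a ∷ 0V)) j)))
            (trans (cong (λ t → lookup (ι (b ∷ 0V)) j ⊹ t ⊖ lookup (ι (b ∷ 0V)) j) (R.*-identityˡ _))
              (solve 2 (λ x y → (x :+ y) :- x := y) refl (lookup (ι (b ∷ 0V)) j) (lookup (ι (a ∷ v)) j ⊖ lookup (ι (a ∷ 0V)) j)))
          where
          add-zero : ∀ {k} (v : V k) → cmbV 𝟙 0V v 0V ≡ v
          add-zero []      = refl
          add-zero (x ∷ v) = cong₂ _∷_ (trans (R.+-identityˡ _) (trans (R.*-identityˡ _) (trans (cong (x ⊹_) RG.ε⁻¹≈ε) (R.+-identityʳ x)))) (add-zero v)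
          shifted : cmbV 𝟙 (b ∷ 0V) (a ∷ v) (a ∷ 0V) ≡ b ∷ v
          shifted = cong₂ _∷_ (cmb-fixed 𝟙 b a) (add-zero v)

      rows-parallel : ∀ a b → P.Parallel (Row.image a) (Row.image b)
      rows-parallel a b w = mk⇔ (rows-direction a b w) (rows-direction b a w)

      rows-differ : ∀ {a b} → a ≢ b → ¬ P.SameSet (Row.image a) (Row.image b)
      rows-differ {a} {b} a≢b same with Row.member⁻¹ b (Equivalence.to (same x) (Row.member a {x} 0V (tabulate∘lookup _)))
        where
        x : P.Pt m
        x = lookup (ι (a ∷ 0V))
      ... | v , e = a≢b (cong head (ι-injective (trans (sym (tabulate∘lookup _)) e)))

      -- The direction of the y-axis belongs to the column, while the first coordinate is constant
      -- on a row.
      row-column-not-parallel : ∀ a c → ¬ P.Parallel (Row.image a) (Column.image c)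
      row-column-not-parallel a c par with Row.direction⁻¹ a (Equivalence.from (par w) (Column.direction c (𝟙 ∷ 0V) (λ j → refl)))
        where
        w : P.Pt m
        w j = lookup (ι (insert c (𝟙 ∷ 0V))) j ⊖ lookup (ι (insert c 0V)) j
      ... | v , e = 𝟙≢𝟘 (trans (cong head (translate (𝟙 ∷ c ∷ 0V) (𝟘 ∷ c ∷ 0V) (a ∷ v) (a ∷ 0V) e)) (cmb-fixed 𝟙 𝟘 a))

  -- Structure of second weight words

  TwoParallelFlats TwoCrossingFlats SecondWeightStructure : ∀ {m} → ℕ → (P.Pt m → K) → Set
  TwoParallelFlats {m} t f = Σ (P.AffSub m) λ A → Σ (P.AffSub m) λ B → Σ (P.AffSub m) λ C →
    P.Codim t A × P.Codim t B × P.Codim t C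
    × P.Parallel A B × ¬ P.SameSet A B × ¬ P.Parallel A C
    × (∀ x → P.Supp f x ⇔ ((x P.∈A A ⊎ x P.∈A B) × ¬ x P.∈A C))
  TwoCrossingFlats {m} t f = Σ (P.AffSub m) λ A → Σ (P.AffSub m) λ B →
    P.Codim t A × P.Codim t B × ¬ P.Parallel A B
    × (∀ x → P.Supp f x ⇔ ((x P.∈A A ⊎ x P.∈A B) × ¬ (x P.∈A A × x P.∈A B)))
  SecondWeightStructure {m} t f =
    (Σ (P.AffSub m) λ E → P.Codim (t ∸ 1) E × (∀ x → P.Supp f x → x P.∈A E)) × (TwoParallelFlats t f ⊎ TwoCrossingFlats t f)

  abstract
    shape-structure : ∀ {t₀ n m} → suc (suc n) + t₀ ≡ m → (f : P.Pt m → K) → (∀ x → f x ≡ f (lookup (tabulate x))) →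
                      Shape n (λ v → f (lookup v)) → SecondWeightStructure (suc t₀) f
    shape-structure {t₀} {n} {m} dimension f ext shape = (Whole.image , dimension , whole) , by-configuration configuration
      where
      open Shape shape
      open Flats ι ι-affine ι-injective

      codim : suc n + suc t₀ ≡ m
      codim = trans (+-suc (suc n) t₀) dimension

      point : ∀ x → P.Supp f x → ∃ λ v → tabulate x ≡ ι v
      point x fx = support (tabulate x) (λ z → fx (trans (ext x) z))

      nonzero-at : ∀ {x v} → tabulate x ≡ ι v → P.Supp f x → f (lookup (ι v)) ≢ 𝟘
      nonzero-at {x} e fx z = fx (trans (ext x) (trans (cong (λ u → f (lookup u)) e) z))

      supp-at : ∀ {x v} → tabulate x ≡ ι v → f (lookup (ι v)) ≢ 𝟘 → P.Supp f x
      supp-at {x} e ne z = ne (trans (cong (λ u → f (lookup u)) (sym e)) (trans (sym (ext x)) z))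

      whole : ∀ x → P.Supp f x → x P.∈A Whole.image
      whole x fx = let (v , e) = point x fx in Whole.member v e

      column-coordinate : ∀ c {x y z v} → tabulate x ≡ ι (y ∷ z ∷ v) → x P.∈A Column.image c → z ≡ c
      column-coordinate c e i with Column.member⁻¹ c i
      ... | (_ ∷ _) , e′ = cong (head ∘ tail) (ι-injective (trans (sym e) e′))

      row-coordinate : ∀ b {x y v} → tabulate x ≡ ι (y ∷ v) → x P.∈A Row.image b → y ≡ b
      row-coordinate b e i with Row.member⁻¹ b i
      ... | _ , e′ = cong head (ι-injective (trans (sym e) e′))

      in-row : ∀ {x y v b} → y ≡ b → tabulate x ≡ ι (y ∷ v) → x P.∈A Row.image b
      in-row {b = b} refl e = Row.member b _ e

      in-column : ∀ {x y z v c} → z ≡ c → tabulate x ≡ ι (y ∷ z ∷ v) → x P.∈A Column.image c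
      in-column {y = y} {v = v} {c} refl e = Column.member c (y ∷ v) e

      by-configuration : Configuration (λ v → f (lookup (ι v))) → TwoParallelFlats (suc t₀) f ⊎ TwoCrossingFlats (suc t₀) f
      by-configuration (parallel a b c a≢b only-if if) = inj₁ (Row.image a , Row.image b , Column.image c , codim , codim , codim
        , rows-parallel a b , rows-differ a≢b , row-column-not-parallel a c , λ x → mk⇔ (forward x) (backward x))
        where
        forward : ∀ x → P.Supp f x → (x P.∈A Row.image a ⊎ x P.∈A Row.image b) × ¬ x P.∈A Column.image c
        forward x fx with point x fx
        ... | (y ∷ z ∷ v) , e with only-if y z v (nonzero-at e fx)
        ... | inj₁ y≡a , z≢c = inj₁ (in-row y≡a e) , λ i → z≢c (column-coordinate c e i)
        ... | inj₂ y≡b , z≢c = inj₂ (in-row y≡b e) , λ i → z≢c (column-coordinate c e i)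
        backward : ∀ x → (x P.∈A Row.image a ⊎ x P.∈A Row.image b) × ¬ x P.∈A Column.image c → P.Supp f x
        backward x (inj₁ i , ¬C) with Row.member⁻¹ a i
        ... | (z ∷ v) , e = supp-at e (if a z v (inj₁ refl , λ z≡c → ¬C (in-column z≡c e)))
        backward x (inj₂ i , ¬C) with Row.member⁻¹ b i
        ... | (z ∷ v) , e = supp-at e (if b z v (inj₂ refl , λ z≡c → ¬C (in-column z≡c e)))
      by-configuration (crossing b c only-if if) = inj₂ (Row.image b , Column.image c , codim , codim
        , row-column-not-parallel b c , λ x → mk⇔ (forward x) (backward x))
        where
        forward : ∀ x → P.Supp f x → (x P.∈A Row.image b ⊎ x P.∈A Column.image c) × ¬ (x P.∈A Row.image b × x P.∈A Column.image c)
        forward x fx with point x fx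
        ... | (y ∷ z ∷ v) , e with only-if y z v (nonzero-at e fx)
        ... | inj₁ (y≡b , z≢c) = inj₁ (in-row y≡b e) , λ { (_ , i) → z≢c (column-coordinate c e i) }
        ... | inj₂ (y≢b , z≡c) = inj₂ (in-column z≡c e) , λ { (i , _) → y≢b (row-coordinate b e i) }
        backward : ∀ x → (x P.∈A Row.image b ⊎ x P.∈A Column.image c) × ¬ (x P.∈A Row.image b × x P.∈A Column.image c) → P.Supp f x
        backward x (inj₁ i , ¬both) with Row.member⁻¹ b i
        ... | (z ∷ v) , e = supp-at e (if b z v (inj₁ (refl , λ z≡c → ¬both (i , in-column z≡c e))))
        backward x (inj₂ i , ¬both) with Column.member⁻¹ c i
        ... | (y ∷ v) , e = supp-at e (if y c v (inj₂ ((λ y≡b → ¬both (in-row y≡b e , i)) , refl)))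

    second-weight-structure : ∀ t₀ m → t₀ ≤ m → (f : P.Pt (suc (suc m)) → K) → P.InRM (suc t₀ * Q) (suc (suc m)) f →
                              P.weight f ≡ 2 * Q * q ^ (suc m ∸ t₀ ∸ 1) → SecondWeightStructure (suc t₀) f
    second-weight-structure t₀ m t₀≤m f rm w = shape-structure (cong (λ k → suc (suc k)) (m∸n+n≡m t₀≤m)) f (reed-muller-extensional rm)
      (second-weight-shape t₀ (m ∸ t₀) m (sym (m+[n∸m]≡n t₀≤m)) (λ v → f (lookup v)) (reed-muller-pol rm)
        (trans (sym (weight≡wt f (reed-muller-extensional rm))) (trans w (cong (λ n → 2 * Q * q ^ n) exponent))))
      where
      exponent : suc m ∸ t₀ ∸ 1 ≡ m ∸ t₀
      exponent = trans (∸-+-assoc (suc m) t₀ 1) (cong (suc m ∸_) (+-comm t₀ 1))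

theorem2p4 : (q m t : ℕ) → (F : FiniteField q) → 2 ≤ m → 3 ≤ q → 1 ≤ t → t ≤ m ∸ 1 →
    (f : FF.Pt F m → Fin q) → FF.InRM F (t * (q ∸ 1)) m f →
    FF.weight F f ≡ 2 * (q ∸ 1) * q ^ (m ∸ t ∸ 1) →
    (Σ (FF.AffSub F m) λ E → FF.Codim F (t ∸ 1) E × (∀ x → FF.Supp F f x → FF._∈A_ F x E))
    × ((Σ (FF.AffSub F m) λ A → Σ (FF.AffSub F m) λ B → Σ (FF.AffSub F m) λ C →
    FF.Codim F t A × FF.Codim F t B × FF.Codim F t C
    × FF.Parallel F A B × ¬ FF.SameSet F A B × ¬ FF.Parallel F A C
    × (∀ x → FF.Supp F f x ⇔ ((FF._∈A_ F x A ⊎ FF._∈A_ F x B) × ¬ FF._∈A_ F x C)))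
    ⊎ (Σ (FF.AffSub F m) λ A → Σ (FF.AffSub F m) λ B →
    FF.Codim F t A × FF.Codim F t B × ¬ FF.Parallel F A B
    × (∀ x → FF.Supp F f x ⇔ ((FF._∈A_ F x A ⊎ FF._∈A_ F x B) × ¬ (FF._∈A_ F x A × FF._∈A_ F x B)))))
theorem2p4 (suc Q) (suc (suc m)) (suc t₀) F _ (s≤s 2≤Q) _ (s≤s t₀≤m) = Proof.second-weight-structure Q F 2≤Q t₀ m t₀≤m
theorem2p4 q m zero F _ _ () _ f
theorem2p4 q zero t F () _ _ _ f
theorem2p4 q (suc zero) t F (s≤s ()) _ _ _ f
theorem2p4 zero m t F _ () _ _ f
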